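{- Let $A\in\mathbb{Z}^{d\times n}$ be of full row-rank with $\operatorname{cone}(A)$ pointed. Let $D(A)$ denote the maximum absolute value of the determinants of the $d\times d$ submatrices of $A$, and let \[ M_F(A)=\Bigl(\max_{i=1,\ldots,d}\sum_{j=1}^n |A_{ij}|\Bigr)-1 . \] If the set $H$ of holes of the semigroup $Q$ generated by the columns of $A$ is finite, then \[ \|h\|_{\infty}\leq (d+1)\,M_F(A)^2\,D(A) \] holds for every $h\in H$.
   Context: Let $A\in\mathbb{Z}^{d\times n}$, and let $\mathbb{Z}_+$ denote the nonnegative integers. The semigroup generated by the columns of $A$ is $Q=\{A\lambda:\lambda\in\mathbb{Z}_+^n\}$. Let $\operatorname{cone}(A)=\{A\lambda:\lambda\in\mathbb{R}^n,\ \lambda\ge 0\}$ and $\operatorname{lattice}(A)=\{A\lambda:\lambda\in\mathbb{Z}^n\}$. The saturation of $Q$ is $Q_{\mathrm{sat}}=\operatorname{cone}(A)\cap\operatorname{lattice}(A)$. Standing assumption: $\operatorname{cone}(A)$ is pointed (contains no line). The set of holes of $Q$ is $H=Q_{\mathrm{sat}}\setminus Q$. $\|h\|_\infty$ is the maximum absolute value of the entries of $h$. -}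

module Defs where

open import Level using (0ℓ)
open import Algebra.Bundles using (RawRing)
import Algebra.Definitions.RawMonoid as RawMonoidDefs
open import Data.Fin.Base using (Fin; zero; suc; toℕ; punchIn)
open import Data.Integer.Base as ℤ using (ℤ; +_)
open import Data.List.Base as List using (List)
open import Data.List.Relation.Unary.Any using (Any)
open import Data.Nat.Base as ℕ using (ℕ; zero; suc)
import Data.Nat.Properties as ℕₚ
open import Data.Product.Base using (∃; _×_; _,_; proj₁; proj₂)
open import Data.Rational.Base as ℚ using (ℚ; 0ℚ; 1ℚ; ½)
import Data.Rational.Properties as ℚₚ
open import Data.Rational.Solver using (module +-*-Solver)
open import Data.Vec.Base as Vec using (Vec)
open import Data.Vec.Functional as Vector using (Vector)
open import Function.Base using (_∘_)
open import Relation.Binary.PropositionalEquality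
  using (_≡_; _≗_; refl; sym; trans; cong; cong₂; subst)
open import Relation.Nullary using (¬_)
open import Relation.Unary using (Pred; _∈_)

-- The library has no reals: ℝ below is the setoid of Cauchy sequences of
-- rationals, each carrying its modulus of convergence.

IsCauchy : (ℕ → ℚ) → Set
IsCauchy x = ∀ ε → 0ℚ ℚ.< ε →
  ∃ λ N → ∀ m n → N ℕ.≤ m → N ℕ.≤ n → ℚ.∣ x m ℚ.- x n ∣ ℚ.< ε

private
  open +-*-Solver using (solve; _:+_; _:*_; _:-_; :-_; _:=_; con)
  open ℚₚ.≤-Reasoning

  half-pos : ∀ {ε} → 0ℚ ℚ.< ε → 0ℚ ℚ.< ½ ℚ.* ε
  half-pos = ℚₚ.*-monoʳ-<-pos ½

  half+half : ∀ ε → ½ ℚ.* ε ℚ.+ ½ ℚ.* ε ≡ ε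
  half+half ε = trans (sym (ℚₚ.*-distribʳ-+ ε ½ ½)) (ℚₚ.*-identityˡ ε)

  +-cauchy : ∀ {x y} → IsCauchy x → IsCauchy y → IsCauchy (λ k → x k ℚ.+ y k)
  +-cauchy {x} {y} cx cy ε 0<ε
    with cx (½ ℚ.* ε) (half-pos 0<ε) | cy (½ ℚ.* ε) (half-pos 0<ε)
  ... | N₁ , h₁ | N₂ , h₂ = N₁ ℕ.⊔ N₂ , λ m n p q → begin-strict
    ℚ.∣ (x m ℚ.+ y m) ℚ.- (x n ℚ.+ y n) ∣
      ≡⟨ cong ℚ.∣_∣ (solve 4 (λ a b c d →
           (a :+ b) :- (c :+ d) := (a :- c) :+ (b :- d)) refl (x m) (y m) (x n) (y n)) ⟩
    ℚ.∣ (x m ℚ.- x n) ℚ.+ (y m ℚ.- y n) ∣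
      ≤⟨ ℚₚ.∣p+q∣≤∣p∣+∣q∣ (x m ℚ.- x n) (y m ℚ.- y n) ⟩
    ℚ.∣ x m ℚ.- x n ∣ ℚ.+ ℚ.∣ y m ℚ.- y n ∣
      <⟨ ℚₚ.+-mono-<
           (h₁ m n (ℕₚ.m⊔n≤o⇒m≤o N₁ N₂ p) (ℕₚ.m⊔n≤o⇒m≤o N₁ N₂ q))
           (h₂ m n (ℕₚ.m⊔n≤o⇒n≤o N₁ N₂ p) (ℕₚ.m⊔n≤o⇒n≤o N₁ N₂ q)) ⟩
    ½ ℚ.* ε ℚ.+ ½ ℚ.* ε ≡⟨ half+half ε ⟩
    ε ∎

  neg-cauchy : ∀ {x} → IsCauchy x → IsCauchy (λ k → ℚ.- x k)
  neg-cauchy {x} cx ε 0<ε with cx ε 0<ε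
  ... | N , h = N , λ m n p q → begin-strict
    ℚ.∣ ℚ.- x m ℚ.- (ℚ.- x n) ∣
      ≡⟨ cong ℚ.∣_∣ (solve 2 (λ a b → :- a :- (:- b) := :- (a :- b)) refl (x m) (x n)) ⟩
    ℚ.∣ ℚ.- (x m ℚ.- x n) ∣ ≡⟨ ℚₚ.∣-p∣≡∣p∣ (x m ℚ.- x n) ⟩
    ℚ.∣ x m ℚ.- x n ∣ <⟨ h m n p q ⟩
    ε ∎

  0<1 : 0ℚ ℚ.< 1ℚ
  0<1 = ℚₚ.positive⁻¹ 1ℚ

  eventually-bounded : ∀ {x} → IsCauchy x →
    ∃ λ B → 0ℚ ℚ.< B × ∃ λ N → ∀ m → N ℕ.≤ m → ℚ.∣ x m ∣ ℚ.≤ B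
  eventually-bounded {x} cx with cx 1ℚ 0<1
  ... | N , h = 1ℚ ℚ.+ ℚ.∣ x N ∣ , ℚₚ.+-mono-<-≤ 0<1 (ℚₚ.0≤∣p∣ (x N)) , N , λ m p → begin
    ℚ.∣ x m ∣
      ≡⟨ cong ℚ.∣_∣ (solve 2 (λ a b → a := (a :- b) :+ b) refl (x m) (x N)) ⟩
    ℚ.∣ (x m ℚ.- x N) ℚ.+ x N ∣
      ≤⟨ ℚₚ.∣p+q∣≤∣p∣+∣q∣ (x m ℚ.- x N) (x N) ⟩
    ℚ.∣ x m ℚ.- x N ∣ ℚ.+ ℚ.∣ x N ∣
      ≤⟨ ℚₚ.+-monoˡ-≤ ℚ.∣ x N ∣ (ℚₚ.<⇒≤ (h m N p ℕₚ.≤-refl)) ⟩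
    1ℚ ℚ.+ ℚ.∣ x N ∣ ∎

  divide : ∀ B → 0ℚ ℚ.< B → ∀ ε → 0ℚ ℚ.< ε → ∃ λ δ → 0ℚ ℚ.< δ × B ℚ.* δ ≡ ε
  divide B 0<B ε 0<ε = 1/B ℚ.* ε , ℚₚ.positive⁻¹ (1/B ℚ.* ε) {{ℚₚ.pos*pos⇒pos 1/B {{1/B>0}} ε {{ℚ.positive 0<ε}}}} ,
    trans (sym (ℚₚ.*-assoc B 1/B ε))
      (trans (cong (ℚ._* ε) (ℚₚ.*-inverseʳ B {{B≢0}})) (ℚₚ.*-identityˡ ε))
    where
    B≢0 : ℚ.NonZero B
    B≢0 = ℚₚ.pos⇒nonZero B {{ℚ.positive 0<B}}
    1/B : ℚ
    1/B = (ℚ.1/ B) {{B≢0}}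
    1/B>0 : ℚ.Positive 1/B
    1/B>0 = ℚₚ.1/pos⇒pos B {{ℚ.positive 0<B}}

  *-mono : ∀ {a b B d} → 0ℚ ℚ.≤ b → 0ℚ ℚ.< B → a ℚ.≤ B → b ℚ.≤ d → a ℚ.* b ℚ.≤ B ℚ.* d
  *-mono {a} {b} {B} {d} 0≤b 0<B a≤B b≤d = begin
    a ℚ.* b ≤⟨ ℚₚ.*-monoʳ-≤-nonNeg b {{ℚ.nonNegative 0≤b}} a≤B ⟩
    B ℚ.* b ≤⟨ ℚₚ.*-monoˡ-≤-nonNeg B {{ℚ.nonNegative (ℚₚ.<⇒≤ 0<B)}} b≤d ⟩
    B ℚ.* d ∎

  product-diff : ∀ a b c d {B C δ} → 0ℚ ℚ.< B → 0ℚ ℚ.< C →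
    ℚ.∣ a ∣ ℚ.≤ B → ℚ.∣ d ∣ ℚ.≤ C → ℚ.∣ a ℚ.- c ∣ ℚ.≤ δ → ℚ.∣ b ℚ.- d ∣ ℚ.≤ δ →
    ℚ.∣ a ℚ.* b ℚ.- c ℚ.* d ∣ ℚ.≤ (B ℚ.+ C) ℚ.* δ
  product-diff a b c d {B} {C} {δ} 0<B 0<C a≤B d≤C ac≤δ bd≤δ = begin
    ℚ.∣ a ℚ.* b ℚ.- c ℚ.* d ∣
      ≡⟨ cong ℚ.∣_∣ (solve 4 (λ a b c d →
           a :* b :- c :* d := a :* (b :- d) :+ (a :- c) :* d) refl a b c d) ⟩
    ℚ.∣ a ℚ.* (b ℚ.- d) ℚ.+ (a ℚ.- c) ℚ.* d ∣
      ≤⟨ ℚₚ.∣p+q∣≤∣p∣+∣q∣ (a ℚ.* (b ℚ.- d)) ((a ℚ.- c) ℚ.* d) ⟩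
    ℚ.∣ a ℚ.* (b ℚ.- d) ∣ ℚ.+ ℚ.∣ (a ℚ.- c) ℚ.* d ∣
      ≡⟨ cong₂ ℚ._+_ (ℚₚ.∣p*q∣≡∣p∣*∣q∣ a (b ℚ.- d))
           (trans (ℚₚ.∣p*q∣≡∣p∣*∣q∣ (a ℚ.- c) d)
                  (ℚₚ.*-comm ℚ.∣ a ℚ.- c ∣ ℚ.∣ d ∣)) ⟩
    ℚ.∣ a ∣ ℚ.* ℚ.∣ b ℚ.- d ∣ ℚ.+ ℚ.∣ d ∣ ℚ.* ℚ.∣ a ℚ.- c ∣
      ≤⟨ ℚₚ.+-mono-≤ (*-mono (ℚₚ.0≤∣p∣ (b ℚ.- d)) 0<B a≤B bd≤δ)
                      (*-mono (ℚₚ.0≤∣p∣ (a ℚ.- c)) 0<C d≤C ac≤δ) ⟩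
    B ℚ.* δ ℚ.+ C ℚ.* δ ≡⟨ sym (ℚₚ.*-distribʳ-+ δ B C) ⟩
    (B ℚ.+ C) ℚ.* δ ∎

  half< : ∀ {ε} → 0ℚ ℚ.< ε → ½ ℚ.* ε ℚ.< ε
  half< {ε} 0<ε = begin-strict
    ½ ℚ.* ε ≡⟨ sym (ℚₚ.+-identityʳ (½ ℚ.* ε)) ⟩
    ½ ℚ.* ε ℚ.+ 0ℚ <⟨ ℚₚ.+-monoʳ-< (½ ℚ.* ε) (half-pos 0<ε) ⟩
    ½ ℚ.* ε ℚ.+ ½ ℚ.* ε ≡⟨ half+half ε ⟩
    ε ∎

  *-cauchy : ∀ {x y} → IsCauchy x → IsCauchy y → IsCauchy (λ k → x k ℚ.* y k)
  *-cauchy {x} {y} cx cy ε 0<ε =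
    let B , 0<B , N₁ , hB = eventually-bounded cx
        C , 0<C , N₂ , hC = eventually-bounded cy
        δ , 0<δ , eq = divide (B ℚ.+ C) (ℚₚ.+-mono-< 0<B 0<C) (½ ℚ.* ε) (half-pos 0<ε)
        N₃ , hx = cx δ 0<δ
        N₄ , hy = cy δ 0<δ
        N₁₂ = N₁ ℕ.⊔ N₂
        N₃₄ = N₃ ℕ.⊔ N₄
    in N₁₂ ℕ.⊔ N₃₄ , λ m n p q →
      let p₁₂ = ℕₚ.m⊔n≤o⇒m≤o N₁₂ N₃₄ p
          q₁₂ = ℕₚ.m⊔n≤o⇒m≤o N₁₂ N₃₄ q
          p₃₄ = ℕₚ.m⊔n≤o⇒n≤o N₁₂ N₃₄ p
          q₃₄ = ℕₚ.m⊔n≤o⇒n≤o N₁₂ N₃₄ q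
      in ℚₚ.≤-<-trans
        (product-diff (x m) (y m) (x n) (y n) 0<B 0<C
          (hB m (ℕₚ.m⊔n≤o⇒m≤o N₁ N₂ p₁₂))
          (hC n (ℕₚ.m⊔n≤o⇒n≤o N₁ N₂ q₁₂))
          (ℚₚ.<⇒≤ (hx m n (ℕₚ.m⊔n≤o⇒m≤o N₃ N₄ p₃₄) (ℕₚ.m⊔n≤o⇒m≤o N₃ N₄ q₃₄)))
          (ℚₚ.<⇒≤ (hy m n (ℕₚ.m⊔n≤o⇒n≤o N₃ N₄ p₃₄) (ℕₚ.m⊔n≤o⇒n≤o N₃ N₄ q₃₄))))
        (subst (ℚ._< ε) (sym eq) (half< 0<ε))

  const-cauchy : ∀ q → IsCauchy (λ _ → q)
  const-cauchy q ε 0<ε = 0 , λ _ _ _ _ →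
    subst (ℚ._< ε) (cong ℚ.∣_∣ (sym (ℚₚ.+-inverseʳ q))) 0<ε

record ℝ : Set where
  constructor mkℝ
  field
    seq    : ℕ → ℚ
    cauchy : IsCauchy seq

open ℝ public

infix 4 _≈ℝ_ _≤ℝ_

_≈ℝ_ : ℝ → ℝ → Set
x ≈ℝ y = ∀ ε → 0ℚ ℚ.< ε → ∃ λ N → ∀ k → N ℕ.≤ k → ℚ.∣ seq x k ℚ.- seq y k ∣ ℚ.< ε

-- The slack ε is essential: x ≤ y does not entail seq x k ≤ seq y k for any k.
_≤ℝ_ : ℝ → ℝ → Set
x ≤ℝ y = ∀ ε → 0ℚ ℚ.< ε → ∃ λ N → ∀ k → N ℕ.≤ k → seq x k ℚ.< seq y k ℚ.+ ε

fromℚ : ℚ → ℝ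
fromℚ q = mkℝ (λ _ → q) (const-cauchy q)

fromℤ : ℤ → ℝ
fromℤ z = fromℚ (z ℚ./ 1)

0ℝ 1ℝ : ℝ
0ℝ = fromℚ 0ℚ
1ℝ = fromℚ 1ℚ

infixl 6 _+ℝ_
infixl 7 _*ℝ_

_+ℝ_ _*ℝ_ : ℝ → ℝ → ℝ
x +ℝ y = mkℝ (λ k → seq x k ℚ.+ seq y k) (+-cauchy {seq x} {seq y} (cauchy x) (cauchy y))
x *ℝ y = mkℝ (λ k → seq x k ℚ.* seq y k) (*-cauchy {seq x} {seq y} (cauchy x) (cauchy y))

-ℝ_ : ℝ → ℝ
-ℝ x = mkℝ (λ k → ℚ.- seq x k) (neg-cauchy {seq x} (cauchy x))

ℝ-rawRing : RawRing 0ℓ 0ℓ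
ℝ-rawRing = record
  { Carrier = ℝ
  ; _≈_     = _≈ℝ_
  ; _+_     = _+ℝ_
  ; _*_     = _*ℝ_
  ; -_      = -ℝ_
  ; 0#      = 0ℝ
  ; 1#      = 1ℝ
  }

Matrix : Set → ℕ → ℕ → Set
Matrix X d n = Vector (Vector X n) d

module LinearAlgebra (R : RawRing 0ℓ 0ℓ) where
  open RawRing R
  open RawMonoidDefs +-rawMonoid using (sum)

  infix  4 _≈ᵥ_
  infixr 8 _*ᵥ_

  _≈ᵥ_ : ∀ {n} → Vector Carrier n → Vector Carrier n → Set
  v ≈ᵥ w = ∀ i → v i ≈ w i

  0ᵥ : ∀ {n} → Vector Carrier n
  0ᵥ _ = 0#

  _*ᵥ_ : ∀ {d n} → Matrix Carrier d n → Vector Carrier n → Vector Carrier d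
  (A *ᵥ v) i = sum (λ j → A i j * v j)

  LinearlyIndependentRows : ∀ {d n} → Matrix Carrier d n → Set
  LinearlyIndependentRows A =
    ∀ y → Vector.transpose A *ᵥ y ≈ᵥ 0ᵥ → y ≈ᵥ 0ᵥ

module Linℤ = LinearAlgebra ℤ.+-*-rawRing
module Linℝ = LinearAlgebra ℝ-rawRing

open RawMonoidDefs ℤ.+-0-rawMonoid using () renaming (sum to sumℤ)
open RawMonoidDefs ℕ.+-0-rawMonoid using () renaming (sum to sumℕ)

vecℝ : ∀ {d} → Vector ℤ d → Vector ℝ d
vecℝ = Vector.map fromℤ

matℝ : ∀ {d n} → Matrix ℤ d n → Matrix ℝ d n
matℝ = Vector.map vecℝ

FullRowRank : ∀ {d n} → Matrix ℤ d n → Set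
FullRowRank A = Linℝ.LinearlyIndependentRows (matℝ A)

-- Laplace expansion along the first row.
det : ∀ {d} → Matrix ℤ d d → ℤ
det {zero}  M = ℤ.1ℤ
det {suc d} M = sumℤ λ j →
  ℤ.-1ℤ ℤ.^ toℕ j ℤ.* M zero j ℤ.* det (λ i k → M (suc i) (punchIn j k))

-- All strictly increasing sequences of d column indices; these select the
-- d × d submatrices.
columnChoices : ∀ d n → List (Vec (Fin n) d)
columnChoices zero    n       = Vec.[] List.∷ List.[]
columnChoices (suc d) zero    = List.[]
columnChoices (suc d) (suc n) =
  List.map (λ c → zero Vec.∷ Vec.map suc c) (columnChoices d n)
  List.++ List.map (Vec.map suc) (columnChoices (suc d) n)

-- A maximum over an empty family is 0.
maximum : ∀ {n} → Vector ℕ n → ℕ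
maximum = Vector.foldr ℕ._⊔_ 0

D : ∀ {d n} → Matrix ℤ d n → ℕ
D {d} {n} A = List.foldr ℕ._⊔_ 0
  (List.map (λ c → ℤ.∣ det (λ i k → A i (Vec.lookup c k)) ∣) (columnChoices d n))

-- Integer-valued, so that the subtraction of 1 is never truncated.
M-F : ∀ {d n} → Matrix ℤ d n → ℤ
M-F A = + maximum (λ i → sumℕ (λ j → ℤ.∣ A i j ∣)) ℤ.- ℤ.1ℤ

‖_‖∞ : ∀ {d} → Vector ℤ d → ℕ
‖ h ‖∞ = maximum (λ i → ℤ.∣ h i ∣)

cone : ∀ {d n} → Matrix ℤ d n → Pred (Vector ℝ d) 0ℓ
cone A x = ∃ λ c → (∀ j → 0ℝ ≤ℝ c j) × x ≈ᵥ matℝ A *ᵥ c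
  where open Linℝ

ContainsLine : ∀ {d} → Pred (Vector ℝ d) 0ℓ → Set
ContainsLine {d} C = ∃ λ (p : Vector ℝ d) → ∃ λ (v : Vector ℝ d) →
  ¬ (v ≈ᵥ 0ᵥ) × (∀ t → (λ i → p i +ℝ t *ℝ v i) ∈ C)
  where open Linℝ

Pointed : ∀ {d} → Pred (Vector ℝ d) 0ℓ → Set
Pointed C = ¬ ContainsLine C

lattice : ∀ {d n} → Matrix ℤ d n → Pred (Vector ℤ d) 0ℓ
lattice A x = ∃ λ c → x ≈ᵥ A *ᵥ c
  where open Linℤ

semigroup : ∀ {d n} → Matrix ℤ d n → Pred (Vector ℤ d) 0ℓ
semigroup {n = n} A x = ∃ λ (c : Vector ℕ n) → x ≈ᵥ A *ᵥ (+_ ∘ c)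
  where open Linℤ

-- The lattice lies in ℤ^d, so the intersection with the cone is taken there.
saturation : ∀ {d n} → Matrix ℤ d n → Pred (Vector ℤ d) 0ℓ
saturation A x = vecℝ x ∈ cone A × x ∈ lattice A

holes : ∀ {d n} → Matrix ℤ d n → Pred (Vector ℤ d) 0ℓ
holes A x = x ∈ saturation A × ¬ (x ∈ semigroup A)

-- Vectors are functions, hence compared pointwise.
Finite : ∀ {d} → Pred (Vector ℤ d) 0ℓ → Set
Finite {d} S = ∃ λ (xs : List (Vector ℤ d)) → ∀ (x : Vector ℤ d) → x ∈ S → Any (x ≗_) xs

module Submission where

open import Defs
open import Data.Nat.Base using (ℕ; suc)
open import Data.Integer.Base using (ℤ; +_; _*_; _^_; _≤_)
open import Data.Vec.Functional using (Vector)
open import Relation.Unary using (_∈_)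

open import Algebra.Bundles using (CommutativeRing; RawRing)
import Algebra.Definitions.RawMonoid as RawMonoidDefs
import Algebra.Properties.Semiring.Sum as Sum
open import Data.Fin.Base using (Fin; zero; suc; toℕ; punchIn; punchOut)
import Data.Fin.Properties as Finₚ
open import Data.Integer.Base as ℤ using (_<_; 0ℤ; 1ℤ; -1ℤ; -[1+_]; _+_; _-_; -_; ∣_∣)
import Data.Integer.Properties as ℤₚ
open import Data.Integer.Tactic.RingSolver using (solve-∀)
open import Data.List.Base as List using (List)
import Data.List.Membership.Propositional as List
open import Data.List.Membership.Propositional.Properties using (∈-map⁺; ∈-++⁺ˡ; ∈-++⁺ʳ)
open import Data.List.Relation.Unary.Any using (Any; here; there)
open import Data.Nat.Base as ℕ using (zero)
import Data.Nat.Coprimality as Coprimality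
open import Data.Nat.DivMod using (m≡m%n+[m/n]*n; m%n<n)
import Data.Nat.Properties as ℕₚ
import Data.Nat.Tactic.RingSolver as ℕSolver
open import Data.Product.Base using (∃; _×_; _,_; proj₁; proj₂)
open import Data.Rational.Base as ℚ using (ℚ; mkℚ; 0ℚ; 1ℚ)
import Data.Rational.Properties as ℚₚ
open import Data.Rational.Solver using (module +-*-Solver)
import Data.Rational.Unnormalised.Base as ℚᵘ
import Data.Rational.Unnormalised.Properties as ℚᵘₚ
open import Data.Sum.Base using (_⊎_; inj₁; inj₂)
import Data.Vec.Base as Vec
open import Data.Vec.Functional using (_∷_; removeAt; insertAt; tail; transpose)
open import Data.Vec.Functional.Properties using (insertAt-lookup; insertAt-punchIn; removeAt-insertAt)
open import Data.Vec.Properties using (lookup-map)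
open import Function.Base using (_∘_)
open import Level using (0ℓ)
open import Relation.Binary.Definitions using (tri<; tri≈; tri>)
open import Relation.Binary.PropositionalEquality
open import Relation.Nullary using (¬_; Dec; yes; no; ¬?; contradiction)
open import Relation.Nullary.Decidable using (decidable-stable; _×-dec_)

open Sum ℤₚ.+-*-semiring using (sum; sum-cong-≗; sum-replicate-zero; sum-remove;
  ∑-distrib-+; ∑-comm; *-distribˡ-sum; *-distribʳ-sum)
open Sum ℕₚ.+-*-semiring using () renaming (sum to sumₙ; sum-cong-≗ to sumₙ-cong-≗;
  sum-remove to sumₙ-remove; ∑-distrib-+ to ∑ₙ-distrib-+; ∑-comm to ∑ₙ-comm; *-distribʳ-sum to *-distribʳ-sumₙ)
open Sum (CommutativeRing.semiring ℚₚ.+-*-commutativeRing) using () renaming (sum to sumℚ; sum-cong-≗ to sumℚ-cong-≗;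
  ∑-distrib-+ to ∑ℚ-distrib-+; *-distribˡ-sum to *-distribˡ-sumℚ; *-distribʳ-sum to *-distribʳ-sumℚ)

-- Write m = n - d, M for M-F A, and let h be a hole. Every vector of ker A is a sum of at most m multiples
-- of conformal circuits, and by Cramer's rule there are circuits with integral entries of size at most D;
-- hence a kernel vector can be rounded to a conformal integral kernel vector within distance m D.
-- Write h = A λ with λ ≥ 0. Since there are only finitely many holes, h + k a_j lies in the semigroup for
-- large k, so h = A z with z integral and nonnegative outside j. If λ_j > m D - 1, then subtracting from z
-- a rounding of z - λ gives a nonnegative integral solution, so h would not be a hole. Therefore
-- λ ≤ m D - 1, and |h_i| ≤ (M + 1) m D. Finally we may assume the columns of A to be nonzero and distinct;
-- as the cone is pointed, all but d of them have absolute sum at least 2, so 2 n ≤ d (M + 1) + d,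
-- that is 2 m ≤ d M, and (M + 1) m ≤ d M².

-- Membership in the real cone yields no exact λ ≥ 0 to compute with: at one index of the Cauchy
-- sequences there is only a rational vector that solves A λ = h up to ε and is nonnegative up to ε.
-- The residue is removed by a right inverse of A, which exists by full row rank, so A λ = h becomes
-- exact and only the sign condition stays approximate. This is harmless: the final solution is
-- integral, and an integer greater than -1 is nonnegative. All rational vectors are kept as L / N
-- with L integral, so the combinatorial core works over ℤ alone. Rounding must be conformal, not
-- merely close. With x between 0 and z - λ, each coordinate of z - x lies between those of z and λ,
-- so every coordinate other than j stays nonnegative at no cost; the distance m D matters at j
-- only, where z is uncontrolled. The row-sum and minor bounds are carried as upper bounds, since
-- they must survive the deletion of columns. Pointedness serves to exclude opposite columns,
-- without which two signed unit columns could share a row.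

sum-zero : ∀ {n} {f : Vector ℤ n} → (∀ i → f i ≡ 0ℤ) → sum f ≡ 0ℤ
sum-zero {n} f≡0 = trans (sum-cong-≗ f≡0) (sum-replicate-zero n)

sum-neg : ∀ {n} (f : Vector ℤ n) → sum (λ i → - f i) ≡ - sum f
sum-neg f = begin
  sum (λ i → - f i)      ≡⟨ sum-cong-≗ (λ i → sym (ℤₚ.-1*i≡-i (f i))) ⟩
  sum (λ i → -1ℤ * f i)  ≡⟨ *-distribˡ-sum -1ℤ f ⟨
  -1ℤ * sum f            ≡⟨ ℤₚ.-1*i≡-i (sum f) ⟩
  - sum f                ∎
  where open ≡-Reasoning

-- Determinants

sgn : ∀ {n} → Fin n → ℤ
sgn j = -1ℤ ^ toℕ j

det-cong : ∀ {d} (M N : Matrix ℤ d d) → (∀ i k → M i k ≡ N i k) → det M ≡ det N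
det-cong {zero}  M N eq = refl
det-cong {suc d} M N eq = sum-cong-≗ λ j → cong₂ _*_ (cong (sgn j *_) (eq zero j))
  (det-cong (λ i k → M (suc i) (punchIn j k)) (λ i k → N (suc i) (punchIn j k)) λ i k → eq (suc i) (punchIn j k))

-- Induction on the size. The corner terms agree; in every other term of the first-column expansion
-- the minor is expanded along its first row. The resulting double sum, over the first column and
-- the first row, is refolded in the other order.
det-transpose : ∀ {d} (M : Matrix ℤ d d) → det (transpose M) ≡ det M
det-transpose {zero}        M = refl
det-transpose {suc zero}    M = refl
det-transpose {suc (suc e)} M = cong₂ _+_ (cong (1ℤ * M zero zero *_) (det-transpose (corner M))) (begin
  sum (λ i → sgn (suc i) * M (suc i) zero * det (λ r k → M (punchIn (suc i) k) (suc r)))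
    ≡⟨ sum-cong-≗ (λ i → trans (cong (sgn (suc i) * M (suc i) zero *_)
         (sym (det-transpose (λ r k → M (punchIn (suc i) k) (suc r)))))
         (*-distribˡ-sum (sgn (suc i) * M (suc i) zero) (λ j → sgn j * M zero (suc j) * E i j))) ⟩
  sum (λ i → sum λ j → sgn (suc i) * M (suc i) zero * (sgn j * M zero (suc j) * E i j))
    ≡⟨ ∑-comm (λ i j → sgn (suc i) * M (suc i) zero * (sgn j * M zero (suc j) * E i j)) ⟩
  sum (λ j → sum λ i → sgn (suc i) * M (suc i) zero * (sgn j * M zero (suc j) * E i j))
    ≡⟨ sum-cong-≗ (λ j → sum-cong-≗ λ i → exchange (sgn i) (M (suc i) zero) (sgn j) (M zero (suc j)) (E i j)) ⟩
  sum (λ j → sum λ i → sgn (suc j) * M zero (suc j) * (sgn i * M (suc i) zero * E i j))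
    ≡⟨ sum-cong-≗ (λ j → sym (*-distribˡ-sum (sgn (suc j) * M zero (suc j)) (λ i → sgn i * M (suc i) zero * E i j))) ⟩
  sum (λ j → sgn (suc j) * M zero (suc j) * sum (λ i → sgn i * M (suc i) zero * E i j))
    ≡⟨ sum-cong-≗ (λ j → cong (sgn (suc j) * M zero (suc j) *_) (trans
         (sum-cong-≗ (λ i → cong (sgn i * M (suc i) zero *_) (sym (det-transpose (corner₂ i j)))))
         (det-transpose (λ r k → M (suc r) (punchIn (suc j) k))))) ⟩
  sum (λ j → sgn (suc j) * M zero (suc j) * det (λ r k → M (suc r) (punchIn (suc j) k))) ∎)
  where
  open ≡-Reasoning
  corner : Matrix ℤ (suc (suc e)) (suc (suc e)) → Matrix ℤ (suc e) (suc e)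
  corner N i k = N (suc i) (suc k)
  corner₂ : Fin (suc e) → Fin (suc e) → Matrix ℤ e e
  corner₂ i j r k = M (suc (punchIn i r)) (suc (punchIn j k))
  E : Fin (suc e) → Fin (suc e) → ℤ
  E i j = det (corner₂ i j)
  exchange : ∀ s a t b c → -1ℤ * s * a * (t * b * c) ≡ -1ℤ * t * b * (s * a * c)
  exchange = solve-∀

det-expand-column : ∀ {d} (M : Matrix ℤ (suc d) (suc d)) →
  det M ≡ sum (λ i → sgn i * M i zero * det (λ r k → M (punchIn i r) (suc k)))
det-expand-column M = trans (sym (det-transpose M))
  (sum-cong-≗ λ i → cong (sgn i * M i zero *_) (det-transpose (λ r k → M (punchIn i r) (suc k))))

-- In the expansion along the first column the terms of the two swapped rows trade places, with
-- opposite signs; every other minor still contains both rows, so induction applies.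
det-swap : ∀ {d} (M : Matrix ℤ (suc (suc d)) (suc (suc d))) →
  det (M (suc zero) ∷ M zero ∷ tail (tail M)) ≡ - det M
det-swap {d} M = begin
  det M′
    ≡⟨ det-expand-column M′ ⟩
  1ℤ * M₁ zero * det (λ r k → M′ (suc r) (suc k))
    + (-1ℤ * 1ℤ * M₀ zero * det (λ r k → M′ (punchIn (suc zero) r) (suc k)) + sum rest′)
    ≡⟨ cong₂ (λ x y → 1ℤ * M₁ zero * x + y)
         (det-cong (λ r k → M′ (suc r) (suc k)) (λ r k → M (punchIn (suc zero) r) (suc k))
           (λ { zero k → refl ; (suc r) k → refl }))
         (cong₂ (λ x y → -1ℤ * 1ℤ * M₀ zero * x + y)
           (det-cong (λ r k → M′ (punchIn (suc zero) r) (suc k)) (λ r k → M (suc r) (suc k))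
             (λ { zero k → refl ; (suc r) k → refl }))
           (trans (sum-cong-≗ (rest-swap M)) (sum-neg rest))) ⟩
  1ℤ * M₁ zero * B + (-1ℤ * 1ℤ * M₀ zero * A + - sum rest)
    ≡⟨ shuffle (M₁ zero) B (M₀ zero) A (sum rest) ⟩
  - (1ℤ * M₀ zero * A + (-1ℤ * 1ℤ * M₁ zero * B + sum rest))
    ≡⟨ cong -_ (det-expand-column M) ⟨
  - det M ∎
  where
  open ≡-Reasoning
  M₀ = M zero
  M₁ = M (suc zero)
  M′ : Matrix ℤ (suc (suc d)) (suc (suc d))
  M′ = M₁ ∷ M₀ ∷ tail (tail M)
  A = det (λ r k → M (suc r) (suc k))
  B = det (λ r k → M (punchIn (suc zero) r) (suc k))
  rest rest′ : Vector ℤ d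
  rest′ i = sgn (suc (suc i)) * M (suc (suc i)) zero * det (λ r k → M′ (punchIn (suc (suc i)) r) (suc k))
  rest i = sgn (suc (suc i)) * M (suc (suc i)) zero * det (λ r k → M (punchIn (suc (suc i)) r) (suc k))
  shuffle : ∀ a b c e s → 1ℤ * a * b + (-1ℤ * 1ℤ * c * e + - s) ≡ - (1ℤ * c * e + (-1ℤ * 1ℤ * a * b + s))
  shuffle = solve-∀
  rest-swap : ∀ {d} (M : Matrix ℤ (suc (suc d)) (suc (suc d))) (i : Fin d) →
    sgn (suc (suc i)) * M (suc (suc i)) zero
      * det (λ r k → (M (suc zero) ∷ M zero ∷ tail (tail M)) (punchIn (suc (suc i)) r) (suc k))
    ≡ - (sgn (suc (suc i)) * M (suc (suc i)) zero * det (λ r k → M (punchIn (suc (suc i)) r) (suc k)))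
  rest-swap {suc d} M i = trans (cong (sgn (suc (suc i)) * M (suc (suc i)) zero *_) (trans
    (det-cong (λ r k → (M (suc zero) ∷ M zero ∷ tail (tail M)) (punchIn (suc (suc i)) r) (suc k))
              (N (suc zero) ∷ N zero ∷ tail (tail N))
              (λ { zero k → refl ; (suc zero) k → refl ; (suc (suc r)) k → refl }))
    (det-swap N)))
    (sym (ℤₚ.neg-distribʳ-* (sgn (suc (suc i)) * M (suc (suc i)) zero) (det N)))
    where
    N : Matrix ℤ (suc (suc d)) (suc (suc d))
    N r k = M (punchIn (suc (suc i)) r) (suc k)

i≡-i⇒i≡0 : ∀ {i} → i ≡ - i → i ≡ 0ℤ
i≡-i⇒i≡0 {+ zero}  _ = refl
i≡-i⇒i≡0 {+ suc n} ()
i≡-i⇒i≡0 { -[1+ n ]} ()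

-- If the equal rows are adjacent, `det-swap` gives det M = - det M. Otherwise a swap moves the
-- first row into all the minors, each of which then has a repeated row.
det-repeated-row : ∀ {d} (M : Matrix ℤ (suc d) (suc d)) (i : Fin d) →
  (∀ k → M zero k ≡ M (suc i) k) → det M ≡ 0ℤ
det-repeated-row M zero eq = i≡-i⇒i≡0 (trans
  (det-cong M (M (suc zero) ∷ M zero ∷ tail (tail M)) λ { zero k → eq k ; (suc zero) k → sym (eq k) ; (suc (suc r)) k → refl })
  (det-swap M))
det-repeated-row {suc d} M (suc i) eq = ℤₚ.neg-injective (begin
  - det M                                        ≡⟨ det-swap M ⟨
  det (M (suc zero) ∷ M zero ∷ tail (tail M))    ≡⟨ sum-zero (λ j → trans
    (cong (sgn j * M (suc zero) j *_) (det-repeated-row (λ r k → (M zero ∷ tail (tail M)) r (punchIn j k)) i (λ k → eq (punchIn j k))))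
    (ℤₚ.*-zeroʳ (sgn j * M (suc zero) j))) ⟩
  0ℤ ∎)
  where open ≡-Reasoning

-- Row p is first brought to the front of each minor, that is to the second row, and then swapped
-- once more, which supplies the last factor of the sign.
det-move-to-front : ∀ {d} (M : Matrix ℤ (suc d) (suc d)) p →
  det M ≡ sgn p * det (M p ∷ removeAt M p)
det-move-to-front M zero = trans
  (det-cong M (M zero ∷ removeAt M zero) λ { zero k → refl ; (suc i) k → refl })
  (sym (ℤₚ.*-identityˡ (det (M zero ∷ removeAt M zero))))
det-move-to-front {suc d} M (suc p) = begin
  det M
    ≡⟨ sum-cong-≗ (λ j → trans
         (cong (sgn j * M zero j *_) (trans (det-move-to-front (minor j) p)
           (cong (sgn p *_) (det-cong (minor j p ∷ removeAt (minor j) p)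
              (λ r k → N (suc r) (punchIn j k)) λ { zero k → refl ; (suc r) k → refl }))))
         (exchange (sgn j) (M zero j) (sgn p) (det (λ r k → N (suc r) (punchIn j k))))) ⟩
  sum (λ j → sgn p * (sgn j * M zero j * det (λ r k → N (suc r) (punchIn j k))))
    ≡⟨ *-distribˡ-sum (sgn p) (λ j → sgn j * M zero j * det (λ r k → N (suc r) (punchIn j k))) ⟨
  sgn p * det N
    ≡⟨ signs (sgn p) (det N) ⟩
  -1ℤ * sgn p * - det N
    ≡⟨ cong (-1ℤ * sgn p *_) (trans (sym (det-swap N))
         (det-cong (N (suc zero) ∷ N zero ∷ tail (tail N)) (M (suc p) ∷ removeAt M (suc p))
           λ { zero k → refl ; (suc zero) k → refl ; (suc (suc r)) k → refl })) ⟩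
  sgn (suc p) * det (M (suc p) ∷ removeAt M (suc p)) ∎
  where
  open ≡-Reasoning
  minor : Fin (suc (suc d)) → Matrix ℤ (suc d) (suc d)
  minor j r k = M (suc r) (punchIn j k)
  N : Matrix ℤ (suc (suc d)) (suc (suc d))
  N = M zero ∷ M (suc p) ∷ removeAt (tail M) p
  exchange : ∀ s a t c → s * a * (t * c) ≡ t * (s * a * c)
  exchange = solve-∀
  signs : ∀ s x → s * x ≡ -1ℤ * s * - x
  signs = solve-∀

-- Dot products

infix 7 _·_

_·_ : ∀ {n} → Vector ℤ n → Vector ℤ n → ℤ
v · w = sum λ j → v j * w j

·-comm : ∀ {n} (v w : Vector ℤ n) → v · w ≡ w · v
·-comm v w = sum-cong-≗ λ j → ℤₚ.*-comm (v j) (w j)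

·-congʳ : ∀ {n} (v : Vector ℤ n) {w w′ : Vector ℤ n} → w ≗ w′ → v · w ≡ v · w′
·-congʳ v eq = sum-cong-≗ λ j → cong (v j *_) (eq j)

·-linearʳ : ∀ {n} (v : Vector ℤ n) a x b y →
  v · (λ j → a * x j + b * y j) ≡ a * (v · x) + b * (v · y)
·-linearʳ v a x b y = begin
  v · (λ j → a * x j + b * y j)
    ≡⟨ sum-cong-≗ (λ j → split (v j) a (x j) b (y j)) ⟩
  sum (λ j → a * (v j * x j) + b * (v j * y j))
    ≡⟨ ∑-distrib-+ (λ j → a * (v j * x j)) (λ j → b * (v j * y j)) ⟩
  sum (λ j → a * (v j * x j)) + sum (λ j → b * (v j * y j))
    ≡⟨ cong₂ _+_ (*-distribˡ-sum a (λ j → v j * x j)) (*-distribˡ-sum b (λ j → v j * y j)) ⟨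
  a * (v · x) + b * (v · y) ∎
  where
  open ≡-Reasoning
  split : ∀ v a x b y → v * (a * x + b * y) ≡ a * (v * x) + b * (v * y)
  split = solve-∀

·-transpose : ∀ {d n} (A : Matrix ℤ d n) (y : Vector ℤ d) (w : Vector ℤ n) →
  y · (λ i → A i · w) ≡ (λ j → y · (λ i → A i j)) · w
·-transpose A y w = begin
  sum (λ i → y i * sum (λ j → A i j * w j))
    ≡⟨ sum-cong-≗ (λ i → trans (*-distribˡ-sum (y i) (λ j → A i j * w j))
         (sum-cong-≗ λ j → sym (ℤₚ.*-assoc (y i) (A i j) (w j)))) ⟩
  sum (λ i → sum λ j → y i * A i j * w j)
    ≡⟨ ∑-comm (λ i j → y i * A i j * w j) ⟩
  sum (λ j → sum λ i → y i * A i j * w j)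
    ≡⟨ sum-cong-≗ (λ j → sym (*-distribʳ-sum (w j) (λ i → y i * A i j))) ⟩
  sum (λ j → sum (λ i → y i * A i j) * w j) ∎
  where open ≡-Reasoning

unit : ∀ {n} → Fin n → Vector ℤ n
unit zero    = 1ℤ ∷ λ _ → 0ℤ
unit (suc i) = 0ℤ ∷ unit i

·-unit : ∀ {n} (v : Vector ℤ n) i → v · unit i ≡ v i
·-unit v zero = trans (cong₂ _+_ (ℤₚ.*-identityʳ (v zero)) (sum-zero λ j → ℤₚ.*-zeroʳ (v (suc j))))
  (ℤₚ.+-identityʳ (v zero))
·-unit v (suc i) = trans (cong (_+ tail v · unit i) (ℤₚ.*-zeroʳ (v zero)))
  (trans (ℤₚ.+-identityˡ _) (·-unit (tail v) i))

unit-sym : ∀ {n} (i j : Fin n) → unit i j ≡ unit j i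
unit-sym zero    zero    = refl
unit-sym zero    (suc j) = refl
unit-sym (suc i) zero    = refl
unit-sym (suc i) (suc j) = unit-sym i j

-- Increasing choices of d out of n columns

-- An inductive counterpart of `columnChoices`. The empty choice has several representations, as
-- `skip` may precede `empty`; only `embed` matters.
data Thin : ℕ → ℕ → Set where
  empty : ∀ {n} → Thin 0 n
  keep  : ∀ {d n} → Thin d n → Thin (suc d) (suc n)
  skip  : ∀ {d n} → Thin d n → Thin d (suc n)

embed : ∀ {d n} → Thin d n → Fin d → Fin n
embed (keep θ) zero    = zero
embed (keep θ) (suc k) = suc (embed θ k)
embed (skip θ) k       = suc (embed θ k)

thin⇒≤ : ∀ {d n} → Thin d n → d ℕ.≤ n
thin⇒≤ empty    = ℕ.z≤n
thin⇒≤ (keep θ) = ℕ.s≤s (thin⇒≤ θ)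
thin⇒≤ (skip θ) = ℕₚ.m≤n⇒m≤1+n (thin⇒≤ θ)

avoid : ∀ {d n} → Fin (suc n) → Thin d n → Thin d (suc n)
avoid zero    θ        = skip θ
avoid (suc c) empty    = empty
avoid (suc c) (keep θ) = keep (avoid c θ)
avoid (suc c) (skip θ) = skip (avoid c θ)

embed-avoid : ∀ {d n} c (θ : Thin d n) k → embed (avoid c θ) k ≡ punchIn c (embed θ k)
embed-avoid zero    θ        k       = refl
embed-avoid (suc c) (keep θ) zero    = refl
embed-avoid (suc c) (keep θ) (suc k) = cong suc (embed-avoid c θ k)
embed-avoid (suc c) (skip θ) k       = cong suc (embed-avoid c θ k)

drop : ∀ {d n} → Thin (suc d) n → Fin (suc d) → Thin d n
drop         (keep θ) zero    = skip θ
drop {suc d} (keep θ) (suc j) = keep (drop θ j)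
drop         (skip θ) j       = skip (drop θ j)

embed-drop : ∀ {d n} (θ : Thin (suc d) n) j k → embed (drop θ j) k ≡ embed θ (punchIn j k)
embed-drop         (keep θ) zero    k       = refl
embed-drop {suc d} (keep θ) (suc j) zero    = refl
embed-drop {suc d} (keep θ) (suc j) (suc k) = cong suc (embed-drop θ j k)
embed-drop         (skip θ) j       k       = cong suc (embed-drop θ j k)

Insertion : ∀ {d n} → Fin n → Thin d n → Set
Insertion {d} {n} c θ = ∃ λ (θ′ : Thin (suc d) n) → ∃ λ p →
  embed θ′ p ≡ c × (∀ k → embed θ′ (punchIn p k) ≡ embed θ k)

insert : ∀ {d n} (c : Fin n) (θ : Thin d n) → (∃ λ k → embed θ k ≡ c) ⊎ Insertion c θ
insert zero    empty    = inj₂ (keep empty , zero , refl , λ ())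
insert (suc c) empty    with insert c empty
... | inj₂ (θ′ , p , eq , _) = inj₂ (skip θ′ , p , cong suc eq , λ ())
insert zero    (keep θ) = inj₁ (zero , refl)
insert (suc c) (keep θ) with insert c θ
... | inj₁ (k , eq) = inj₁ (suc k , cong suc eq)
... | inj₂ (θ′ , p , eq , eqs) = inj₂ (keep θ′ , suc p , cong suc eq ,
        λ { zero → refl ; (suc k) → cong suc (eqs k) })
insert zero    (skip θ) = inj₂ (keep θ , zero , refl , λ k → refl)
insert (suc c) (skip θ) with insert c θ
... | inj₁ (k , eq) = inj₁ (k , cong suc eq)
... | inj₂ (θ′ , p , eq , eqs) = inj₂ (skip θ′ , p , cong suc eq , λ k → cong suc (eqs k))

scatter : ∀ {d n} → Thin d n → Vector ℤ d → Vector ℤ n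
scatter empty    f = λ _ → 0ℤ
scatter (keep θ) f = f zero ∷ scatter θ (tail f)
scatter (skip θ) f = 0ℤ ∷ scatter θ f

scatter-embed : ∀ {d n} (θ : Thin d n) f k → scatter θ f (embed θ k) ≡ f k
scatter-embed (keep θ) f zero    = refl
scatter-embed (keep θ) f (suc k) = scatter-embed θ (tail f) k
scatter-embed (skip θ) f k       = scatter-embed θ f k

scatter-all : ∀ {d n} (P : ℤ → Set) (θ : Thin d n) f → P 0ℤ → (∀ k → P (f k)) → ∀ i → P (scatter θ f i)
scatter-all P empty    f P0 Pf i       = P0
scatter-all P (keep θ) f P0 Pf zero    = Pf zero
scatter-all P (keep θ) f P0 Pf (suc i) = scatter-all P θ (tail f) P0 (Pf ∘ suc) i
scatter-all P (skip θ) f P0 Pf zero    = P0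
scatter-all P (skip θ) f P0 Pf (suc i) = scatter-all P θ f P0 Pf i

·-scatter : ∀ {d n} (v : Vector ℤ n) (θ : Thin d n) f → v · scatter θ f ≡ (v ∘ embed θ) · f
·-scatter v empty    f = sum-zero λ j → ℤₚ.*-zeroʳ (v j)
·-scatter v (keep θ) f = cong (λ x → v zero * f zero + x) (·-scatter (tail v) θ (tail f))
·-scatter v (skip θ) f = trans (cong (_+ tail v · scatter θ f) (ℤₚ.*-zeroʳ (v zero)))
  (trans (ℤₚ.+-identityˡ _) (·-scatter (tail v) θ f))

-- Minors and linear dependence

columns : ∀ {d e n} → Matrix ℤ d n → (Fin e → Fin n) → Matrix ℤ d e
columns A σ i k = A i (σ k)

minor : ∀ {d n} → Matrix ℤ d n → Thin d n → ℤ
minor A θ = det (columns A (embed θ))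

-- The generalized cross product of the rows: the integral kernel vector given by Cramer's rule.
cofactors : ∀ {d} → Matrix ℤ d (suc d) → Vector ℤ (suc d)
cofactors B j = sgn j * det (λ i k → B i (punchIn j k))

·-cofactors : ∀ {d} (b : Vector ℤ (suc d)) B → b · cofactors B ≡ det (b ∷ B)
·-cofactors b B = sum-cong-≗ λ j → swap (b j) (sgn j) (det (λ i k → B i (punchIn j k)))
  where
  swap : ∀ b s x → b * (s * x) ≡ s * b * x
  swap = solve-∀

-- The product is the determinant of B with a second copy of row i on top.
cofactors-kernel : ∀ {d} (B : Matrix ℤ d (suc d)) i → B i · cofactors B ≡ 0ℤ
cofactors-kernel B i = trans (·-cofactors (B i) B) (det-repeated-row (B i ∷ B) i λ k → refl)

sgn²≡1 : ∀ {n} (p : Fin n) → sgn p * sgn p ≡ 1ℤ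
sgn²≡1 zero    = refl
sgn²≡1 (suc p) = trans (square (sgn p)) (sgn²≡1 p)
  where
  square : ∀ s → -1ℤ * s * (-1ℤ * s) ≡ s * s
  square = solve-∀

sgn*i≢0 : ∀ {n} (p : Fin n) {i} → i ≢ 0ℤ → sgn p * i ≢ 0ℤ
sgn*i≢0 p {i} i≢0 eq = i≢0 (begin
  i                    ≡⟨ ℤₚ.*-identityˡ i ⟨
  1ℤ * i               ≡⟨ cong (_* i) (sgn²≡1 p) ⟨
  sgn p * sgn p * i    ≡⟨ ℤₚ.*-assoc (sgn p) (sgn p) i ⟩
  sgn p * (sgn p * i)  ≡⟨ cong (sgn p *_) eq ⟩
  sgn p * 0ℤ           ≡⟨ ℤₚ.*-zeroʳ (sgn p) ⟩
  0ℤ                   ∎)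
  where open ≡-Reasoning

*-≢0 : ∀ {i j} → i ≢ 0ℤ → j ≢ 0ℤ → i * j ≢ 0ℤ
*-≢0 {i} i≢0 j≢0 eq with ℤₚ.i*j≡0⇒i≡0∨j≡0 i eq
... | inj₁ i≡0 = i≢0 i≡0
... | inj₂ j≡0 = j≢0 j≡0

-- A right inverse without fractions: the vector `inverse i` is a preimage of `scale` times the i-th
-- unit vector, so the transpose of `inverse` divided by `scale` is a rational right inverse.
record RightInverse {d n} (A : Matrix ℤ d n) : Set where
  field
    scale   : ℤ
    scale≢0 : scale ≢ 0ℤ
    inverse : Matrix ℤ d n
    isInverse : ∀ r i → A r · inverse i ≡ scale * unit i r

IndependentRows DependentRows : ∀ {d n} → Matrix ℤ d n → Set
IndependentRows {d} A = ∀ (y : Vector ℤ d) → (∀ j → y · (λ i → A i j) ≡ 0ℤ) → ∀ i → y i ≡ 0ℤ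
DependentRows {d} A = ∃ λ (y : Vector ℤ d) → (∃ λ i → y i ≢ 0ℤ) × (∀ j → y · (λ i → A i j) ≡ 0ℤ)

NonzeroMinor : ∀ {d n} → Matrix ℤ d n → Set
NonzeroMinor {d} {n} A = ∃ λ (θ : Thin d n) → minor A θ ≢ 0ℤ

rightInverse⇒independent : ∀ {d n} {A : Matrix ℤ d n} → RightInverse A → IndependentRows A
rightInverse⇒independent {A = A} inv y yA≡0 i
  with ℤₚ.i*j≡0⇒i≡0∨j≡0 scale scale*yᵢ≡0
  where
  open RightInverse inv
  open ≡-Reasoning
  scale*yᵢ≡0 : scale * y i ≡ 0ℤ
  scale*yᵢ≡0 = begin
    scale * y i                          ≡⟨ cong (scale *_) (·-unit y i) ⟨
    scale * (y · unit i)                 ≡⟨ *-distribˡ-sum scale (λ r → y r * unit i r) ⟩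
    sum (λ r → scale * (y r * unit i r)) ≡⟨ sum-cong-≗ (λ r → swap scale (y r) (unit i r)) ⟩
    y · (λ r → scale * unit i r)         ≡⟨ ·-congʳ y (λ r → sym (isInverse r i)) ⟩
    y · (λ r → A r · inverse i)          ≡⟨ ·-transpose A y (inverse i) ⟩
    (λ j → y · (λ r → A r j)) · inverse i
      ≡⟨ sum-zero (λ j → trans (cong (_* inverse i j) (yA≡0 j)) (ℤₚ.*-zeroˡ (inverse i j))) ⟩
    0ℤ ∎
    where
    swap : ∀ s y u → s * (y * u) ≡ y * (s * u)
    swap = solve-∀
... | inj₁ scale≡0 = contradiction scale≡0 (RightInverse.scale≢0 inv)
... | inj₂ yᵢ≡0    = yᵢ≡0

border : ∀ {d n} → Matrix ℤ (suc d) n → Thin d n → Fin n → Matrix ℤ (suc d) (suc d)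
border A θ c i = A i c ∷ (A i ∘ embed θ)

-- Column c has position p in the enlarged choice; bringing it to the front costs the sign of p.
border-insert : ∀ {d n} (A : Matrix ℤ (suc d) n) {c} {θ : Thin d n} →
  ((θ′ , p , _) : Insertion c θ) → minor A θ′ ≡ sgn p * det (border A θ c)
border-insert A {c} {θ} (θ′ , p , eq , eqs) = begin
  det B
    ≡⟨ det-transpose B ⟨
  det (transpose B)
    ≡⟨ det-move-to-front (transpose B) p ⟩
  sgn p * det (transpose B p ∷ removeAt (transpose B) p)
    ≡⟨ cong (sgn p *_) (det-cong (transpose B p ∷ removeAt (transpose B) p) (transpose (border A θ c))
         λ { zero i → cong (A i) eq ; (suc k) i → cong (A i) (eqs k) }) ⟩
  sgn p * det (transpose (border A θ c))
    ≡⟨ cong (sgn p *_) (det-transpose (border A θ c)) ⟩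
  sgn p * det (border A θ c) ∎
  where
  open ≡-Reasoning
  B = columns A (embed θ′)

border-repeated : ∀ {d n} (A : Matrix ℤ (suc d) n) (θ : Thin d n) k → det (border A θ (embed θ k)) ≡ 0ℤ
border-repeated A θ k = trans (sym (det-transpose (border A θ (embed θ k))))
  (det-repeated-row (transpose (border A θ (embed θ k))) k λ i → refl)

-- The scattered cofactors C of the lower rows are orthogonal to those rows and have product Δ with
-- the top row. So C serves as the new preimage, and a multiple of C clears the top entry of each
-- old one.
extendInverse : ∀ {d n} (A : Matrix ℤ (suc d) n) → NonzeroMinor A → RightInverse (tail A) → RightInverse A
extendInverse {d} {n} A (θ , Δ≢0) inv = record
  { scale = scale * Δ ; scale≢0 = *-≢0 scale≢0 Δ≢0 ; inverse = W ; isInverse = isW }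
  where
  open RightInverse inv
  open ≡-Reasoning
  Δ = minor A θ
  B = columns (tail A) (embed θ)
  C : Vector ℤ n
  C = scatter θ (cofactors B)
  A₀·C : A zero · C ≡ Δ
  A₀·C = trans (·-scatter (A zero) θ (cofactors B)) (trans (·-cofactors (A zero ∘ embed θ) B)
    (det-cong ((A zero ∘ embed θ) ∷ B) (columns A (embed θ)) λ { zero k → refl ; (suc i) k → refl }))
  A₊·C : ∀ r → A (suc r) · C ≡ 0ℤ
  A₊·C r = trans (·-scatter (A (suc r)) θ (cofactors B)) (cofactors-kernel B r)
  s : Fin d → ℤ
  s i = A zero · inverse i
  W : Matrix ℤ (suc d) n
  W zero    j = scale * C j + 0ℤ * C j
  W (suc i) j = Δ * inverse i j + - s i * C j
  isW : ∀ r i → A r · W i ≡ scale * Δ * unit i r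
  isW zero zero = trans (·-linearʳ (A zero) scale C 0ℤ C) (trans (cong (λ x → scale * x + 0ℤ * x) A₀·C) (eq scale Δ))
    where
    eq : ∀ a b → a * b + 0ℤ * b ≡ a * b * 1ℤ
    eq = solve-∀
  isW (suc r) zero = trans (·-linearʳ (A (suc r)) scale C 0ℤ C) (trans (cong (λ x → scale * x + 0ℤ * x) (A₊·C r)) (eq scale Δ))
    where
    eq : ∀ a b → a * 0ℤ + 0ℤ * 0ℤ ≡ a * b * 0ℤ
    eq = solve-∀
  isW zero (suc i) = trans (·-linearʳ (A zero) Δ (inverse i) (- s i) C)
    (trans (cong (λ x → Δ * s i + - s i * x) A₀·C) (eq scale Δ (s i)))
    where
    eq : ∀ a b s → b * s + - s * b ≡ a * b * 0ℤ
    eq = solve-∀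
  isW (suc r) (suc i) = trans (·-linearʳ (A (suc r)) Δ (inverse i) (- s i) C)
    (trans (cong₂ (λ x y → Δ * x + - s i * y) (isInverse r i) (A₊·C r)) (eq scale Δ (s i) (unit i r)))
    where
    eq : ∀ a b s u → b * (a * u) + - s * 0ℤ ≡ a * b * u
    eq = solve-∀

-- Bordering of minors, one row at a time. Take a nonzero minor θ of the lower rows. The determinant
-- bordered by column c is the product of that column with a cofactor vector y independent of c, and
-- the top entry of y is the minor θ. If all bordered determinants vanish, y is a dependence;
-- otherwise a nonzero one enlarges θ.
independent∨dependent : ∀ {d n} (A : Matrix ℤ d n) → (NonzeroMinor A × RightInverse A) ⊎ DependentRows A
independent∨dependent {zero} A = inj₁ ((empty , λ ()) ,
  record { scale = 1ℤ ; scale≢0 = λ () ; inverse = λ () ; isInverse = λ () })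
independent∨dependent {suc d} A with independent∨dependent (tail A)
... | inj₂ (y , (i , yᵢ≢0) , yA≡0) = inj₂ (0ℤ ∷ y , (suc i , yᵢ≢0) ,
      λ j → trans (cong (_+ y · (λ i → A (suc i) j)) (ℤₚ.*-zeroˡ (A zero j))) (trans (ℤₚ.+-identityˡ _) (yA≡0 j)))
... | inj₁ ((θ , Δ≢0) , inv) with Finₚ.any? (λ c → ¬? (det (border A θ c) ℤₚ.≟ 0ℤ))
...   | no all≡0 = inj₂ (y , (zero , sgn*i≢0 {suc d} zero Δ≢0) , λ c → trans (trans
          (sum-cong-≗ λ i → swap (sgn i) (det (λ r k → A (punchIn i r) (embed θ k))) (A i c))
          (sym (det-expand-column (border A θ c))))
          (decidable-stable (det (border A θ c) ℤₚ.≟ 0ℤ) λ ≢0 → all≡0 (c , ≢0)))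
  where
  y : Vector ℤ (suc d)
  y i = sgn i * det (λ r k → A (punchIn i r) (embed θ k))
  swap : ∀ s x a → s * x * a ≡ s * a * x
  swap = solve-∀
...   | yes (c , ≢0) with insert c θ
...     | inj₁ (k , refl) = contradiction (border-repeated A θ k) ≢0
...     | inj₂ ins = inj₁ (nonzero , extendInverse A nonzero inv)
  where
  nonzero : NonzeroMinor A
  nonzero = proj₁ ins , λ eq → sgn*i≢0 (proj₁ (proj₂ ins)) ≢0 (trans (sym (border-insert A ins)) eq)

independent⇒minor : ∀ {d n} {A : Matrix ℤ d n} → IndependentRows A → NonzeroMinor A × RightInverse A
independent⇒minor {A = A} indep with independent∨dependent A
... | inj₁ found = found
... | inj₂ (y , (i , yᵢ≢0) , yA≡0) = contradiction (indep y yA≡0 i) yᵢ≢0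

-- Circuits

∀-punchIn : ∀ {n} (P : Fin (suc n) → Set) c → P c → (∀ k → P (punchIn c k)) → ∀ j → P j
∀-punchIn P c Pc P∖c j with c Finₚ.≟ j
... | yes refl = Pc
... | no  c≢j  = subst P (Finₚ.punchIn-punchOut c≢j) (P∖c (punchOut c≢j))

∀⊎⇒∃⊎∀ : ∀ {n} {P Q : Fin n → Set} → (∀ i → P i ⊎ Q i) → (∃ λ i → P i) ⊎ (∀ i → Q i)
∀⊎⇒∃⊎∀ {zero}  f = inj₂ λ ()
∀⊎⇒∃⊎∀ {suc n} f with f zero | ∀⊎⇒∃⊎∀ (f ∘ suc)
... | inj₁ p | _            = inj₁ (zero , p)
... | inj₂ _ | inj₁ (i , p) = inj₁ (suc i , p)
... | inj₂ q | inj₂ qs      = inj₂ λ { zero → q ; (suc i) → qs i }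

Kernel : ∀ {d n} → Matrix ℤ d n → Vector ℤ n → Set
Kernel A x = ∀ i → A i · x ≡ 0ℤ

Nonzero : ∀ {n} → Vector ℤ n → Set
Nonzero x = ∃ λ i → x i ≢ 0ℤ

MinorBound : ∀ {d n} → Matrix ℤ d n → ℕ → Set
MinorBound {d} {n} A D = ∀ (θ : Thin d n) → ∣ minor A θ ∣ ℕ.≤ D

deleteColumn : ∀ {d n} → Matrix ℤ d (suc n) → Fin (suc n) → Matrix ℤ d n
deleteColumn A c i = removeAt (A i) c

minorBound-delete : ∀ {d n D} (A : Matrix ℤ d (suc n)) → MinorBound A D → ∀ c → MinorBound (deleteColumn A c) D
minorBound-delete {D = D} A bound c θ = subst (λ x → ∣ x ∣ ℕ.≤ D)
  (det-cong (columns A (embed (avoid c θ))) (columns (deleteColumn A c) (embed θ))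
    λ i k → cong (A i) (embed-avoid c θ k))
  (bound (avoid c θ))

·-remove : ∀ {n} (v x : Vector ℤ (suc n)) c → v · x ≡ v c * x c + removeAt v c · removeAt x c
·-remove v x c = sum-remove {i = c} (λ j → v j * x j)

·-insertAt : ∀ {n} (v : Vector ℤ (suc n)) (x : Vector ℤ n) c → v · insertAt x c 0ℤ ≡ removeAt v c · x
·-insertAt v x c = begin
  v · insertAt x c 0ℤ
    ≡⟨ ·-remove v (insertAt x c 0ℤ) c ⟩
  v c * insertAt x c 0ℤ c + removeAt v c · removeAt (insertAt x c 0ℤ) c
    ≡⟨ cong₂ _+_ (trans (cong (v c *_) (insertAt-lookup x c 0ℤ)) (ℤₚ.*-zeroʳ (v c)))
         (·-congʳ (removeAt v c) (removeAt-insertAt x c 0ℤ)) ⟩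
  0ℤ + removeAt v c · x
    ≡⟨ ℤₚ.+-identityˡ _ ⟩
  removeAt v c · x ∎
  where open ≡-Reasoning

kernel-insertAt : ∀ {d n} (A : Matrix ℤ d (suc n)) x c → Kernel (deleteColumn A c) x → Kernel A (insertAt x c 0ℤ)
kernel-insertAt A x c ker i = trans (·-insertAt (A i) x c) (ker i)

kernel-removeAt : ∀ {d n} (A : Matrix ℤ d (suc n)) x c → x c ≡ 0ℤ → Kernel A x → Kernel (deleteColumn A c) (removeAt x c)
kernel-removeAt A x c xc≡0 ker i = begin
  removeAt (A i) c · removeAt x c
    ≡⟨ ℤₚ.+-identityˡ _ ⟨
  0ℤ + removeAt (A i) c · removeAt x c
    ≡⟨ cong (_+ removeAt (A i) c · removeAt x c) (trans (cong (A i c *_) xc≡0) (ℤₚ.*-zeroʳ (A i c))) ⟨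
  A i c * x c + removeAt (A i) c · removeAt x c
    ≡⟨ ·-remove (A i) x c ⟨
  A i · x
    ≡⟨ ker i ⟩
  0ℤ ∎
  where open ≡-Reasoning

nonzero-insertAt : ∀ {n} (x : Vector ℤ n) c → Nonzero x → Nonzero (insertAt x c 0ℤ)
nonzero-insertAt x c (i , xᵢ≢0) = punchIn c i , λ eq → xᵢ≢0 (trans (sym (insertAt-punchIn x c 0ℤ i)) eq)

nonzero-removeAt : ∀ {n} (x : Vector ℤ (suc n)) c → x c ≡ 0ℤ → Nonzero x → Nonzero (removeAt x c)
nonzero-removeAt x c xc≡0 (i , xᵢ≢0) = punchOut c≢i ,
  λ eq → xᵢ≢0 (trans (cong x (sym (Finₚ.punchIn-punchOut c≢i))) eq)
  where
  c≢i : c ≢ i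
  c≢i refl = xᵢ≢0 xc≡0

-- A kernel vector not vanishing at c expresses column c through the others.
independent-delete : ∀ {d n} (A : Matrix ℤ d (suc n)) x c → Kernel A x → x c ≢ 0ℤ →
  IndependentRows A → IndependentRows (deleteColumn A c)
independent-delete A x c ker xc≢0 indep y yA∖c≡0 =
  indep y (∀-punchIn (λ j → yA j ≡ 0ℤ) c yAc≡0 yA∖c≡0)
  where
  open ≡-Reasoning
  yA : Vector ℤ _
  yA j = y · (λ i → A i j)
  product≡0 : yA c * x c ≡ 0ℤ
  product≡0 = begin
    yA c * x c
      ≡⟨ ℤₚ.+-identityʳ _ ⟨
    yA c * x c + 0ℤ
      ≡⟨ cong (λ z → yA c * x c + z) (sum-zero λ k → trans (cong (_* x (punchIn c k)) (yA∖c≡0 k)) (ℤₚ.*-zeroˡ (x (punchIn c k)))) ⟨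
    yA c * x c + removeAt yA c · removeAt x c
      ≡⟨ ·-remove yA x c ⟨
    yA · x
      ≡⟨ ·-transpose A y x ⟨
    y · (λ i → A i · x)
      ≡⟨ sum-zero (λ i → trans (cong (y i *_) (ker i)) (ℤₚ.*-zeroʳ (y i))) ⟩
    0ℤ ∎
  yAc≡0 : yA c ≡ 0ℤ
  yAc≡0 with ℤₚ.i*j≡0⇒i≡0∨j≡0 (yA c) product≡0
  ... | inj₁ eq = eq
  ... | inj₂ eq = contradiction eq xc≢0

∣sgn*i∣≡∣i∣ : ∀ {n} (p : Fin n) i → ∣ sgn p * i ∣ ≡ ∣ i ∣
∣sgn*i∣≡∣i∣ zero    i = cong ∣_∣ (ℤₚ.*-identityˡ i)
∣sgn*i∣≡∣i∣ (suc p) i = begin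
  ∣ -1ℤ * sgn p * i ∣    ≡⟨ cong ∣_∣ (neg (sgn p) i) ⟩
  ∣ - (sgn p * i) ∣      ≡⟨ ℤₚ.∣-i∣≡∣i∣ (sgn p * i) ⟩
  ∣ sgn p * i ∣          ≡⟨ ∣sgn*i∣≡∣i∣ p i ⟩
  ∣ i ∣                  ∎
  where
  open ≡-Reasoning
  neg : ∀ s i → -1ℤ * s * i ≡ - (s * i)
  neg = solve-∀

BoundedBy : ∀ {n} → ℕ → Vector ℤ n → Set
BoundedBy D x = ∀ i → ∣ x i ∣ ℕ.≤ D

bounded-insertAt : ∀ {n D} (x : Vector ℤ n) c → BoundedBy D x → BoundedBy D (insertAt x c 0ℤ)
bounded-insertAt {D = D} x c bound = ∀-punchIn (λ j → ∣ insertAt x c 0ℤ j ∣ ℕ.≤ D) c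
  (subst (λ z → ∣ z ∣ ℕ.≤ D) (sym (insertAt-lookup x c 0ℤ)) ℕ.z≤n)
  (λ k → subst (λ z → ∣ z ∣ ℕ.≤ D) (sym (insertAt-punchIn x c 0ℤ k)) (bound k))

-- The kernel vector of cofactors of d + 1 columns: column c, and a basis among the other columns.
cofactorCircuit : ∀ {d n D} (A : Matrix ℤ d (suc n)) → MinorBound A D → ∀ c → NonzeroMinor (deleteColumn A c) →
  ∃ λ g → Kernel A g × Nonzero g × BoundedBy D g
cofactorCircuit {d} {D = D} A bound c (θ , Δ≢0) with insert c (avoid c θ)
... | inj₁ (k , eq) = contradiction (trans (sym (embed-avoid c θ k)) eq) (Finₚ.punchInᵢ≢i c (embed θ k))
... | inj₂ (θ′ , p , eq , eqs) = g , ker , (embed θ′ p , gₚ≢0) ,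
    scatter-all (λ x → ∣ x ∣ ℕ.≤ D) θ′ (cofactors B) ℕ.z≤n bounded
  where
  B = columns A (embed θ′)
  g = scatter θ′ (cofactors B)
  ker : Kernel A g
  ker i = trans (·-scatter (A i) θ′ (cofactors B)) (cofactors-kernel B i)
  gₚ≢0 : g (embed θ′ p) ≢ 0ℤ
  gₚ≢0 g≡0 = sgn*i≢0 p Δ≢0 (trans (cong (sgn p *_) (det-cong (columns (deleteColumn A c) (embed θ)) (λ i k → B i (punchIn p k))
    λ i k → cong (A i) (sym (trans (eqs k) (embed-avoid c θ k)))))
    (trans (sym (scatter-embed θ′ (cofactors B) p)) g≡0))
  bounded : ∀ k → ∣ cofactors B k ∣ ℕ.≤ D
  bounded k = subst (ℕ._≤ D) (trans
    (cong ∣_∣ (det-cong (columns A (embed (drop θ′ k))) (λ i j → B i (punchIn k j)) λ i j → cong (A i) (embed-drop θ′ k j)))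
    (sym (∣sgn*i∣≡∣i∣ k (det (λ i j → B i (punchIn k j))))))
    (bound (drop θ′ k))

SupportedIn : ∀ {n} → Vector ℤ n → Vector ℤ n → Set
SupportedIn X g = ∀ i → X i ≡ 0ℤ → g i ≡ 0ℤ

-- Columns outside the support of X are deleted as long as the rows stay independent;
-- afterwards every kernel vector vanishes outside the support of X.
circuit : ∀ {d n D} (A : Matrix ℤ d n) → MinorBound A D → IndependentRows A →
  ∀ X → Kernel A X → Nonzero X → ∃ λ g → Kernel A g × Nonzero g × BoundedBy D g × SupportedIn X g
circuit {n = zero}  A bound indep X ker (() , _)
circuit {n = suc n} A bound indep X ker nz@(c₀ , X₀≢0) with ∀⊎⇒∃⊎∀ removable?
  where
  Removable Essential : Fin (suc n) → Set
  Removable c = X c ≡ 0ℤ × IndependentRows (deleteColumn A c)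
  Essential c = X c ≡ 0ℤ → ∀ g → Kernel A g → g c ≡ 0ℤ
  removable? : ∀ c → Removable c ⊎ Essential c
  removable? c with X c ℤₚ.≟ 0ℤ
  ... | no  Xc≢0 = inj₂ λ Xc≡0 → contradiction Xc≡0 Xc≢0
  ... | yes Xc≡0 with independent∨dependent (deleteColumn A c)
  ...   | inj₁ (_ , inv) = inj₁ (Xc≡0 , rightInverse⇒independent inv)
  -- Here c is a coloop: by `independent-delete`, a kernel vector not vanishing at c would keep the
  -- rows independent after deletion.
  ...   | inj₂ (y , (i , yᵢ≢0) , yA≡0) = inj₂ λ _ g ker-g → decidable-stable (g c ℤₚ.≟ 0ℤ)
            λ gc≢0 → yᵢ≢0 (independent-delete A g c ker-g gc≢0 indep y yA≡0 i)
... | inj₁ (c , Xc≡0 , indep′) =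
  let g , ker-g , nz-g , bound-g , supp-g = circuit (deleteColumn A c) (minorBound-delete A bound c) indep′
        (removeAt X c) (kernel-removeAt A X c Xc≡0 ker) (nonzero-removeAt X c Xc≡0 nz)
  in insertAt g c 0ℤ , kernel-insertAt A g c ker-g , nonzero-insertAt g c nz-g , bounded-insertAt g c bound-g ,
     ∀-punchIn (λ i → X i ≡ 0ℤ → insertAt g c 0ℤ i ≡ 0ℤ) c (λ _ → insertAt-lookup g c 0ℤ)
       (λ k X≡0 → trans (insertAt-punchIn g c 0ℤ k) (supp-g k X≡0))
... | inj₂ essential =
  -- Since X does not vanish at c₀, the other columns contain a basis; together with c₀ it makes the
  -- d + 1 columns of a circuit. Its support needs no control, as `essential` applies to every
  -- kernel vector.
  let g , ker-g , nz-g , bound-g = cofactorCircuit A bound c₀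
        (proj₁ (independent⇒minor (independent-delete A X c₀ ker X₀≢0 indep)))
  in g , ker-g , nz-g , bound-g , λ i Xᵢ≡0 → essential i Xᵢ≡0 g ker-g

-- Conformal vectors

-- For x = 0 both implications apply and force g = 0, so containment of supports is built in.
Conformal : ℤ → ℤ → Set
Conformal g x = (0ℤ ≤ x → 0ℤ ≤ g) × (x ≤ 0ℤ → g ≤ 0ℤ)

Between : ℤ → ℤ → Set
Between u x = (0ℤ ≤ x → 0ℤ ≤ u × u ≤ x) × (x ≤ 0ℤ → u ≤ 0ℤ × x ≤ u)

nonNeg*nonNeg : ∀ {i j} → 0ℤ ≤ i → 0ℤ ≤ j → 0ℤ ≤ i * j
nonNeg*nonNeg {i} {j} 0≤i 0≤j = subst (_≤ i * j) (ℤₚ.*-zeroˡ j) (ℤₚ.*-monoʳ-≤-nonNeg j {{ℤ.nonNegative 0≤j}} 0≤i)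

nonPos*nonNeg : ∀ {i j} → i ≤ 0ℤ → 0ℤ ≤ j → i * j ≤ 0ℤ
nonPos*nonNeg {i} {j} i≤0 0≤j = subst (i * j ≤_) (ℤₚ.*-zeroˡ j) (ℤₚ.*-monoʳ-≤-nonNeg j {{ℤ.nonNegative 0≤j}} i≤0)

nonNeg*nonPos : ∀ {i j} → 0ℤ ≤ i → j ≤ 0ℤ → i * j ≤ 0ℤ
nonNeg*nonPos {i} {j} 0≤i j≤0 = subst (_≤ 0ℤ) (ℤₚ.*-comm j i) (nonPos*nonNeg j≤0 0≤i)

i≤0⇒0≤-i : ∀ {i} → i ≤ 0ℤ → 0ℤ ≤ - i
i≤0⇒0≤-i = ℤₚ.neg-mono-≤

0≤-i⇒i≤0 : ∀ {i} → 0ℤ ≤ - i → i ≤ 0ℤ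
0≤-i⇒i≤0 = ℤₚ.neg-cancel-≤

i≤0⇒∣i∣≡-i : ∀ {i} → i ≤ 0ℤ → + ∣ i ∣ ≡ - i
i≤0⇒∣i∣≡-i {i} i≤0 = trans (cong +_ (sym (ℤₚ.∣-i∣≡∣i∣ i))) (ℤₚ.0≤i⇒+∣i∣≡i (i≤0⇒0≤-i i≤0))

0<i*i : ∀ {i} → i ≢ 0ℤ → 0ℤ < i * i
0<i*i {+ zero}   i≢0 = contradiction refl i≢0
0<i*i {+ suc n}  i≢0 = ℤ.+<+ (ℕ.s≤s ℕ.z≤n)
0<i*i { -[1+ n ]} i≢0 = ℤ.+<+ (ℕ.s≤s ℕ.z≤n)

positive⇒conformal : ∀ g x → 0ℤ < g * x → Conformal g x
positive⇒conformal g x 0<gx =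
  (λ 0≤x → ℤₚ.≮⇒≥ λ g<0 → ℤₚ.<⇒≱ 0<gx (nonPos*nonNeg (ℤₚ.<⇒≤ g<0) 0≤x)) ,
  (λ x≤0 → ℤₚ.≮⇒≥ λ 0<g → ℤₚ.<⇒≱ 0<gx (nonNeg*nonPos (ℤₚ.<⇒≤ 0<g) x≤0))

nonNegative⇒conformal : ∀ g x → (x ≡ 0ℤ → g ≡ 0ℤ) → ¬ (g * x < 0ℤ) → Conformal g x
nonNegative⇒conformal g x supp gx≮0 with x ℤₚ.≟ 0ℤ | g ℤₚ.≟ 0ℤ
... | yes x≡0 | _ = (λ _ → ℤₚ.≤-reflexive (sym (supp x≡0))) , (λ _ → ℤₚ.≤-reflexive (supp x≡0))
... | no  _   | yes refl = (λ _ → ℤₚ.≤-refl) , (λ _ → ℤₚ.≤-refl)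
... | no x≢0  | no g≢0 = positive⇒conformal g x
  (ℤₚ.≤∧≢⇒< (ℤₚ.≮⇒≥ gx≮0) (*-≢0 g≢0 x≢0 ∘ sym))

-- This makes the coordinate c that attains the minimal ratio vanish in |g_c| X - |X_c| g.
conformal⇒∣∣-cross : ∀ g x → Conformal g x → + ∣ g ∣ * x - + ∣ x ∣ * g ≡ 0ℤ
conformal⇒∣∣-cross g x (pos , neg) with ℤₚ.≤-total 0ℤ x
... | inj₁ 0≤x = trans (cong₂ (λ a b → a * x - b * g) (ℤₚ.0≤i⇒+∣i∣≡i (pos 0≤x)) (ℤₚ.0≤i⇒+∣i∣≡i 0≤x)) (cross g x)
  where
  cross : ∀ g x → g * x - x * g ≡ 0ℤ
  cross = solve-∀
... | inj₂ x≤0 = trans (cong₂ (λ a b → a * x - b * g) (i≤0⇒∣i∣≡-i (neg x≤0)) (i≤0⇒∣i∣≡-i x≤0)) (cross g x)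
  where
  cross : ∀ g x → - g * x - - x * g ≡ 0ℤ
  cross = solve-∀

-- Where g opposes x, subtracting p g moves away from zero, so the ratio has to be bounded only
-- where the signs strictly agree. The case x ≤ 0 follows by negating both x and g.
conformal-step : ∀ p q x g → (x ≡ 0ℤ → g ≡ 0ℤ) → (0ℤ < g * x → p ℕ.* ∣ g ∣ ℕ.≤ q ℕ.* ∣ x ∣) →
  Conformal (+ q * x - + p * g) x
conformal-step p q x g supp ratio = half x g supp ratio ,
  λ x≤0 → 0≤-i⇒i≤0 (subst (0ℤ ≤_) (negate (+ p) (+ q) x g) (half (- x) (- g)
    (λ -x≡0 → cong -_ (supp (ℤₚ.neg-injective -x≡0)))
    (λ 0<gx → subst₂ (λ a b → p ℕ.* a ℕ.≤ q ℕ.* b) (sym (ℤₚ.∣-i∣≡∣i∣ g)) (sym (ℤₚ.∣-i∣≡∣i∣ x))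
      (ratio (subst (0ℤ <_) (negate² g x) 0<gx)))
    (i≤0⇒0≤-i x≤0)))
  where
  negate : ∀ p q x g → q * - x - p * - g ≡ - (q * x - p * g)
  negate = solve-∀
  negate² : ∀ g x → - g * - x ≡ g * x
  negate² = solve-∀
  half : ∀ x g → (x ≡ 0ℤ → g ≡ 0ℤ) → (0ℤ < g * x → p ℕ.* ∣ g ∣ ℕ.≤ q ℕ.* ∣ x ∣) →
    0ℤ ≤ x → 0ℤ ≤ + q * x - + p * g
  half x g supp ratio 0≤x with 0ℤ ℤₚ.<? g * x
  ... | yes 0<gx = ℤₚ.i≤j⇒0≤j-i (subst₂ _≤_
          (trans (ℤₚ.pos-* p ∣ g ∣) (cong (+ p *_) (ℤₚ.0≤i⇒+∣i∣≡i (proj₁ (positive⇒conformal g x 0<gx) 0≤x))))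
          (trans (ℤₚ.pos-* q ∣ x ∣) (cong (+ q *_) (ℤₚ.0≤i⇒+∣i∣≡i 0≤x)))
          (ℤ.+≤+ (ratio 0<gx)))
  ... | no gx≤0 = ℤₚ.i≤j⇒0≤j-i (ℤₚ.≤-trans (nonNeg*nonPos {+ p} (ℤ.+≤+ ℕ.z≤n) g≤0) (nonNeg*nonNeg {+ q} (ℤ.+≤+ ℕ.z≤n) 0≤x))
    where
    g≤0 : g ≤ 0ℤ
    g≤0 with x ℤₚ.≟ 0ℤ
    ... | yes x≡0 = ℤₚ.≤-reflexive (supp x≡0)
    ... | no  x≢0 = ℤₚ.≮⇒≥ λ 0<g → gx≤0 (ℤₚ.≤∧≢⇒< (nonNeg*nonNeg (ℤₚ.<⇒≤ 0<g) 0≤x)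
                      (*-≢0 (ℤₚ.<⇒≢ 0<g ∘ sym) x≢0 ∘ sym))

-- The ratio test for a / b in cross-multiplied form; coordinates with b = 0 count as infinite
-- ratios.
argmin-ratio : ∀ {n} (a b : Vector ℕ n) → (∃ λ i → 0 ℕ.< b i) →
  ∃ λ c → 0 ℕ.< b c × (∀ i → a c ℕ.* b i ℕ.≤ a i ℕ.* b c)
argmin-ratio {suc n} a b (i₀ , 0<b₀) with Finₚ.any? (λ i → 0 ℕₚ.<? b (suc i))
... | no none = zero , 0<b₀′ i₀ 0<b₀ , λ
    { zero → ℕₚ.≤-refl
    ; (suc i) → subst (λ x → a zero ℕ.* x ℕ.≤ a (suc i) ℕ.* b zero) (sym (ℕₚ.n≤0⇒n≡0 (ℕₚ.≮⇒≥ λ 0<b → none (i , 0<b))))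
        (subst (ℕ._≤ a (suc i) ℕ.* b zero) (sym (ℕₚ.*-zeroʳ (a zero))) ℕ.z≤n) }
  where
  0<b₀′ : ∀ i → 0 ℕ.< b i → 0 ℕ.< b zero
  0<b₀′ zero    0<b = 0<b
  0<b₀′ (suc i) 0<b = contradiction (i , 0<b) none
... | yes some with argmin-ratio (tail a) (tail b) some
...   | c , 0<bc , min with a zero ℕ.* b (suc c) ℕₚ.<? a (suc c) ℕ.* b zero
...     | no  ¬lt = suc c , 0<bc , λ { zero → ℕₚ.≮⇒≥ ¬lt ; (suc i) → min i }
...     | yes lt  = zero , 0<b₀′ , λ
    { zero → ℕₚ.≤-refl
    ; (suc i) → ℕₚ.*-cancelʳ-≤ (a zero ℕ.* b (suc i)) (a (suc i) ℕ.* b zero) (b (suc c)) {{ℕ.>-nonZero 0<bc}} (begin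
        a zero ℕ.* b (suc i) ℕ.* b (suc c)     ≡⟨ swap (a zero) (b (suc i)) (b (suc c)) ⟩
        a zero ℕ.* b (suc c) ℕ.* b (suc i)     ≤⟨ ℕₚ.*-monoˡ-≤ (b (suc i)) (ℕₚ.<⇒≤ lt) ⟩
        a (suc c) ℕ.* b zero ℕ.* b (suc i)     ≡⟨ swap (a (suc c)) (b zero) (b (suc i)) ⟩
        a (suc c) ℕ.* b (suc i) ℕ.* b zero     ≤⟨ ℕₚ.*-monoˡ-≤ (b zero) (min i) ⟩
        a (suc i) ℕ.* b (suc c) ℕ.* b zero     ≡⟨ swap (a (suc i)) (b (suc c)) (b zero) ⟩
        a (suc i) ℕ.* b zero ℕ.* b (suc c)     ∎) }
  where
  open ℕₚ.≤-Reasoning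
  swap : ∀ x y z → x ℕ.* y ℕ.* z ≡ x ℕ.* z ℕ.* y
  swap x y z = trans (ℕₚ.*-assoc x y z) (trans (cong (x ℕ.*_) (ℕₚ.*-comm y z)) (sym (ℕₚ.*-assoc x z y)))
  0<b₀′ : 0 ℕ.< b zero
  0<b₀′ = ℕₚ.n≢0⇒n>0 λ b₀≡0 → ℕₚ.n≮0 (subst (a zero ℕ.* b (suc c) ℕ.<_) (trans (cong (a (suc c) ℕ.*_) b₀≡0) (ℕₚ.*-zeroʳ (a (suc c)))) lt)

kernel-combination : ∀ {d n} (A : Matrix ℤ d n) a x b y → Kernel A x → Kernel A y → Kernel A (λ j → a * x j + b * y j)
kernel-combination A a x b y ker-x ker-y i = trans (·-linearʳ (A i) a x b y)
  (trans (cong₂ (λ u v → a * u + b * v) (ker-x i) (ker-y i)) (eq a b))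
  where
  eq : ∀ a b → a * 0ℤ + b * 0ℤ ≡ 0ℤ
  eq = solve-∀

kernel-difference : ∀ {d n} (A : Matrix ℤ d n) a x b y → Kernel A x → Kernel A y → Kernel A (λ j → a * x j - b * y j)
kernel-difference A a x b y ker-x ker-y i = trans (·-congʳ (A i) (λ j → cong (λ z → a * x j + z) (ℤₚ.neg-distribˡ-* b (y j))))
  (kernel-combination A a x (- b) y ker-x ker-y i)

IsConformal : ∀ {n} → Vector ℤ n → Vector ℤ n → Set
IsConformal g X = ∀ i → Conformal (g i) (X i)

IsCircuit : ∀ {d n} → Matrix ℤ d n → ℕ → Vector ℤ n → Set
IsCircuit A D g = Kernel A g × Nonzero g × BoundedBy D g

-- At a nonzero coordinate of g the vector X is nonzero too, so one of g and - g agrees with X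
-- there. This provides a candidate for the ratio test.
circuit-sign : ∀ {d n D} (A : Matrix ℤ d n) X → (∃ λ g → IsCircuit A D g × SupportedIn X g) →
  ∃ λ g → IsCircuit A D g × SupportedIn X g × ∃ λ i → 0ℤ < g i * X i
circuit-sign {D = D} A X (g , circ@(ker , (i , gᵢ≢0) , bound) , supp) with ℤₚ.<-cmp 0ℤ (g i * X i)
... | tri< 0<gX _ _ = g , circ , supp , i , 0<gX
... | tri≈ _ 0≡gX _ = contradiction (sym 0≡gX) (*-≢0 gᵢ≢0 (gᵢ≢0 ∘ supp i))
... | tri> _ _ gX<0 = (λ j → - g j) ,
    ((λ r → trans (·-congʳ (A r) (λ j → flip-sign (g j)))
                  (kernel-combination A -1ℤ g 0ℤ g ker ker r)) ,
     (i , gᵢ≢0 ∘ ℤₚ.neg-injective) ,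
     (λ j → subst (ℕ._≤ D) (sym (ℤₚ.∣-i∣≡∣i∣ (g j))) (bound j))) ,
    (λ j Xⱼ≡0 → cong -_ (supp j Xⱼ≡0)) , i , subst (0ℤ <_) (ℤₚ.neg-distribˡ-* (g i) (X i)) (ℤₚ.neg-mono-< gX<0)
  where
  flip-sign : ∀ x → - x ≡ -1ℤ * x + 0ℤ * x
  flip-sign = solve-∀

-- As the denominator in `argmin-ratio`, it hides the coordinates at which the signs do not strictly
-- agree.
agreement : ℤ → ℤ → ℕ
agreement g x with 0ℤ ℤₚ.<? g * x
... | yes _ = ∣ g ∣
... | no  _ = 0

agreement-positive : ∀ g x → 0ℤ < g * x → agreement g x ≡ ∣ g ∣
agreement-positive g x 0<gx with 0ℤ ℤₚ.<? g * x
... | yes _   = refl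
... | no  ≮   = contradiction 0<gx ≮

positive-agreement : ∀ g x → 0 ℕ.< agreement g x → 0ℤ < g * x
positive-agreement g x 0<a with 0ℤ ℤₚ.<? g * x
... | yes 0<gx = 0<gx

positive⇒∣g∣>0 : ∀ g x → 0ℤ < g * x → 0 ℕ.< ∣ g ∣
positive⇒∣g∣>0 (+ zero)  x 0<gx = contradiction (sym (ℤₚ.*-zeroˡ x)) (ℤₚ.<⇒≢ 0<gx)
positive⇒∣g∣>0 (+ suc n) x 0<gx = ℕ.s≤s ℕ.z≤n
positive⇒∣g∣>0 -[1+ n ]  x 0<gx = ℕ.s≤s ℕ.z≤n

-- If the circuit g is not conformal to X, subtract the largest multiple of g that keeps
-- X in its orthant; this kills a coordinate of X.
conformalCircuit : ∀ {d n D} (A : Matrix ℤ d n) → MinorBound A D → IndependentRows A →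
  ∀ X → Kernel A X → Nonzero X → ∃ λ g → IsCircuit A D g × IsConformal g X
conformalCircuit {n = zero} A bound indep X ker (() , _)
conformalCircuit {n = suc n} {D} A bound indep X ker nz
  with circuit-sign A X (let g , ker-g , nz-g , bd , supp = circuit A bound indep X ker nz in g , (ker-g , nz-g , bd) , supp)
... | g , circ@(ker-g , _ , _) , supp , i₀ , 0<gX₀ with Finₚ.any? (λ b → g b * X b ℤₚ.<? 0ℤ)
...   | no all≥0 = g , circ , λ i → nonNegative⇒conformal (g i) (X i) (supp i) (λ neg → all≥0 (i , neg))
...   | yes (b , gXb<0) with argmin-ratio (λ i → ∣ X i ∣) (λ i → agreement (g i) (X i))
          (i₀ , subst (0 ℕ.<_) (sym (agreement-positive (g i₀) (X i₀) 0<gX₀)) (positive⇒∣g∣>0 (g i₀) (X i₀) 0<gX₀))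
...     | c , 0<ac , min =
  let g′ , (ker-g′ , nz-g′ , bd-g′) , conf-g′ = conformalCircuit (deleteColumn A c) (minorBound-delete A bound c)
        (independent-delete A X c ker Xc≢0 indep) (removeAt Y c) (kernel-removeAt A Y c Yc≡0 ker-Y)
        (nonzero-removeAt Y c Yc≡0 (b , Yb≢0))
  in insertAt g′ c 0ℤ ,
     (kernel-insertAt A g′ c ker-g′ , nonzero-insertAt g′ c nz-g′ , bounded-insertAt g′ c bd-g′) ,
     ∀-punchIn (λ i → Conformal (insertAt g′ c 0ℤ i) (X i)) c
       (subst (λ z → Conformal z (X c)) (sym (insertAt-lookup g′ c 0ℤ)) ((λ _ → ℤₚ.≤-refl) , (λ _ → ℤₚ.≤-refl)))
       (λ k → subst (λ z → Conformal z (X (punchIn c k))) (sym (insertAt-punchIn g′ c 0ℤ k))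
         ((proj₁ (conf-g′ k) ∘ proj₁ (conf-Y (punchIn c k))) , (proj₂ (conf-g′ k) ∘ proj₂ (conf-Y (punchIn c k)))))
  where
  0<gXc : 0ℤ < g c * X c
  0<gXc = positive-agreement (g c) (X c) 0<ac
  Xc≢0 : X c ≢ 0ℤ
  Xc≢0 Xc≡0 = ℤₚ.<⇒≢ 0<gXc (sym (trans (cong (g c *_) Xc≡0) (ℤₚ.*-zeroʳ (g c))))
  p q : ℕ
  p = ∣ X c ∣
  q = ∣ g c ∣
  Y : Vector ℤ (suc n)
  Y i = + q * X i - + p * g i
  Yc≡0 : Y c ≡ 0ℤ
  Yc≡0 = conformal⇒∣∣-cross (g c) (X c) (positive⇒conformal (g c) (X c) 0<gXc)
  ker-Y : Kernel A Y
  ker-Y = kernel-difference A (+ q) X (+ p) g ker ker-g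
  conf-Y : IsConformal Y X
  conf-Y i = conformal-step p q (X i) (g i) (supp i) λ 0<gX →
    subst₂ (λ s t → p ℕ.* s ℕ.≤ t) (agreement-positive (g i) (X i) 0<gX)
      (trans (cong (∣ X i ∣ ℕ.*_) (agreement-positive (g c) (X c) 0<gXc)) (ℕₚ.*-comm ∣ X i ∣ q)) (min i)
  -- At b the circuit opposes X, so the subtraction pushes Y away from 0: otherwise q X_b² would
  -- equal p g_b X_b, which is not positive.
  Yb≢0 : Y b ≢ 0ℤ
  Yb≢0 Yb≡0 = ℤₚ.<⇒≱ 0<qXX (subst (_≤ 0ℤ) (sym qXX≡pgX) (nonNeg*nonPos {+ p} (ℤ.+≤+ ℕ.z≤n) (ℤₚ.<⇒≤ gXb<0)))
    where
    Xb≢0 : X b ≢ 0ℤ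
    Xb≢0 Xb≡0 = ℤₚ.<⇒≢ gXb<0 (trans (cong (g b *_) Xb≡0) (ℤₚ.*-zeroʳ (g b)))
    0<q : 0ℤ < + q
    0<q = ℤ.+<+ (positive⇒∣g∣>0 (g c) (X c) 0<gXc)
    0<qXX : 0ℤ < + q * (X b * X b)
    0<qXX = subst (_< + q * (X b * X b)) (ℤₚ.*-zeroʳ (+ q)) (ℤₚ.*-monoˡ-<-pos (+ q) {{ℤ.positive 0<q}} (0<i*i Xb≢0))
    qXX≡pgX : + q * (X b * X b) ≡ + p * (g b * X b)
    qXX≡pgX = begin
      + q * (X b * X b)                    ≡⟨ expand (+ p) (+ q) (X b) (g b) ⟩
      Y b * X b + + p * (g b * X b)        ≡⟨ cong (λ y → y * X b + + p * (g b * X b)) Yb≡0 ⟩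
      0ℤ * X b + + p * (g b * X b)         ≡⟨ cancel (X b) (+ p * (g b * X b)) ⟩
      + p * (g b * X b)                    ∎
      where
      open ≡-Reasoning
      expand : ∀ p q x g → q * (x * x) ≡ (q * x - p * g) * x + p * (g * x)
      expand = solve-∀
      cancel : ∀ x y → 0ℤ * x + y ≡ y
      cancel = solve-∀

-- Rounding kernel vectors

-- One circuit is split off by q X = p g + Y, that is X / N = (p / (N q)) g + Y / (N q). The
-- coefficient of g is rounded down, and u is a rounding of Y / (N q); the denominator thus grows
-- from N to N q. Rounding down loses less than one copy of g, hence at most D in each coordinate.
module RoundStep (N q p : ℕ) (0<N : 0 ℕ.< N) (0<q : 0 ℕ.< q) where

  private instance
    q-nonZero : ℕ.NonZero q
    q-nonZero = ℕ.>-nonZero 0<q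
    +q-positive : ℤ.Positive (+ q)
    +q-positive = ℤ.positive (ℤ.+<+ 0<q)
    Nq-nonZero : ℕ.NonZero (N ℕ.* q)
    Nq-nonZero = ℕₚ.m*n≢0 N q {{ℕ.>-nonZero 0<N}}

  quotient remainder : ℕ
  quotient  = p ℕ./ (N ℕ.* q)
  remainder = p ℕ.% (N ℕ.* q)

  p≡ : + p ≡ + remainder + + quotient * (+ N * + q)
  p≡ = trans (cong +_ (m≡m%n+[m/n]*n p (N ℕ.* q))) (trans (ℤₚ.pos-+ remainder _)
    (cong (λ z → + remainder + z) (trans (ℤₚ.pos-* quotient _) (cong (+ quotient *_) (ℤₚ.pos-* N q)))))

  rounded : ℤ → ℤ → ℤ
  rounded u g = 1ℤ * u + + quotient * g

  scaled : ∀ u g → + q * (+ N * rounded u g) ≡ + (N ℕ.* q) * u + + (N ℕ.* q) * (+ quotient * g)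
  scaled u g = trans (eq (+ q) (+ N) u (+ quotient) g)
    (cong (λ z → z * u + z * (+ quotient * g)) (sym (ℤₚ.pos-* N q)))
    where
    eq : ∀ q n u k g → q * (n * (1ℤ * u + k * g)) ≡ n * q * u + n * q * (k * g)
    eq = solve-∀

  between : ∀ x g u → Conformal g x → Conformal (+ q * x - + p * g) x →
    Between (+ (N ℕ.* q) * u) (+ q * x - + p * g) → Between (+ N * rounded u g) x
  between x g u (g⁺ , g⁻) (y⁺ , y⁻) (u⁺ , u⁻) =
    (λ 0≤x → let 0≤u , u≤y = u⁺ (y⁺ 0≤x) in half x g u (g⁺ 0≤x) 0≤u u≤y) ,
    (λ x≤0 → let u≤0 , y≤u = u⁻ (y⁻ x≤0)
                 lower , upper = half (- x) (- g) (- u) (i≤0⇒0≤-i (g⁻ x≤0))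
                   (subst (0ℤ ≤_) (ℤₚ.neg-distribʳ-* (+ (N ℕ.* q)) u) (i≤0⇒0≤-i u≤0))
                   (subst₂ _≤_ (ℤₚ.neg-distribʳ-* (+ (N ℕ.* q)) u) (negate (+ q) x (+ p) g) (ℤₚ.neg-mono-≤ y≤u))
             in 0≤-i⇒i≤0 (subst (0ℤ ≤_) (negate-rounded (+ N) u (+ quotient) g) lower) ,
                ℤₚ.neg-cancel-≤ (subst (_≤ - x) (negate-rounded (+ N) u (+ quotient) g) upper))
    where
    negate : ∀ q x p g → - (q * x - p * g) ≡ q * - x - p * - g
    negate = solve-∀
    negate-rounded : ∀ n u k g → n * (1ℤ * - u + k * - g) ≡ - (n * (1ℤ * u + k * g))
    negate-rounded = solve-∀
    half : ∀ x g u → 0ℤ ≤ g → 0ℤ ≤ + (N ℕ.* q) * u → + (N ℕ.* q) * u ≤ + q * x - + p * g →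
      0ℤ ≤ + N * rounded u g × + N * rounded u g ≤ x
    half x g u 0≤g 0≤u u≤y =
      ℤₚ.*-cancelˡ-≤-pos 0ℤ (+ N * rounded u g) (+ q) (begin
        + q * 0ℤ                                                ≡⟨ ℤₚ.*-zeroʳ (+ q) ⟩
        0ℤ + 0ℤ                                                 ≤⟨ ℤₚ.+-mono-≤ 0≤u 0≤kg ⟩
        + (N ℕ.* q) * u + + (N ℕ.* q) * (+ quotient * g)        ≡⟨ scaled u g ⟨
        + q * (+ N * rounded u g)                               ∎) ,
      ℤₚ.*-cancelˡ-≤-pos (+ N * rounded u g) x (+ q) (begin
        + q * (+ N * rounded u g)                               ≡⟨ scaled u g ⟩
        + (N ℕ.* q) * u + + (N ℕ.* q) * (+ quotient * g)        ≤⟨ ℤₚ.+-mono-≤ u≤y kg≤pg ⟩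
        (+ q * x - + p * g) + + p * g                           ≡⟨ restore (+ q * x) (+ p * g) ⟩
        + q * x                                                 ∎)
      where
      open ℤₚ.≤-Reasoning
      restore : ∀ a b → (a - b) + b ≡ a
      restore = solve-∀
      0≤kg : 0ℤ ≤ + (N ℕ.* q) * (+ quotient * g)
      0≤kg = nonNeg*nonNeg {+ (N ℕ.* q)} (ℤ.+≤+ ℕ.z≤n) (nonNeg*nonNeg {+ quotient} (ℤ.+≤+ ℕ.z≤n) 0≤g)
      regroup : ∀ m k r g → r * g + m * (k * g) ≡ (r + k * m) * g
      regroup = solve-∀
      kg≤pg : + (N ℕ.* q) * (+ quotient * g) ≤ + p * g
      kg≤pg = begin
        + (N ℕ.* q) * (+ quotient * g)                          ≡⟨ ℤₚ.+-identityˡ _ ⟨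
        0ℤ + + (N ℕ.* q) * (+ quotient * g)
          ≤⟨ ℤₚ.+-monoˡ-≤ _ (nonNeg*nonNeg {+ remainder} (ℤ.+≤+ ℕ.z≤n) 0≤g) ⟩
        + remainder * g + + (N ℕ.* q) * (+ quotient * g)        ≡⟨ regroup (+ (N ℕ.* q)) (+ quotient) (+ remainder) g ⟩
        (+ remainder + + quotient * + (N ℕ.* q)) * g
          ≡⟨ cong (_* g) (trans (cong (λ z → + remainder + + quotient * z) (ℤₚ.pos-* N q)) (sym p≡)) ⟩
        + p * g                                                 ∎

  error : ∀ {D} m x g u → ∣ g ∣ ℕ.≤ D →
    ∣ (+ q * x - + p * g) - + (N ℕ.* q) * u ∣ ℕ.≤ N ℕ.* q ℕ.* (m ℕ.* D) →
    ∣ x - + N * rounded u g ∣ ℕ.≤ N ℕ.* (suc m ℕ.* D)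
  error {D} m x g u ∣g∣≤D err = ℕₚ.*-cancelˡ-≤ q (begin
    q ℕ.* ∣ x - + N * rounded u g ∣
      ≡⟨ ℤₚ.abs-* (+ q) (x - + N * rounded u g) ⟨
    ∣ + q * (x - + N * rounded u g) ∣
      ≡⟨ cong ∣_∣ decompose ⟩
    ∣ ((+ q * x - + p * g) - + (N ℕ.* q) * u) + + remainder * g ∣
      ≤⟨ ℤₚ.∣i+j∣≤∣i∣+∣j∣ ((+ q * x - + p * g) - + (N ℕ.* q) * u) (+ remainder * g) ⟩
    ∣ (+ q * x - + p * g) - + (N ℕ.* q) * u ∣ ℕ.+ ∣ + remainder * g ∣
      ≡⟨ cong (∣ (+ q * x - + p * g) - + (N ℕ.* q) * u ∣ ℕ.+_) (ℤₚ.abs-* (+ remainder) g) ⟩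
    ∣ (+ q * x - + p * g) - + (N ℕ.* q) * u ∣ ℕ.+ remainder ℕ.* ∣ g ∣
      ≤⟨ ℕₚ.+-mono-≤ err (ℕₚ.*-mono-≤ (ℕₚ.<⇒≤ (m%n<n p (N ℕ.* q))) ∣g∣≤D) ⟩
    N ℕ.* q ℕ.* (m ℕ.* D) ℕ.+ N ℕ.* q ℕ.* D
      ≡⟨ regroup N q m D ⟩
    q ℕ.* (N ℕ.* (suc m ℕ.* D)) ∎)
    where
    open ℕₚ.≤-Reasoning
    regroup : ∀ N q m D → N ℕ.* q ℕ.* (m ℕ.* D) ℕ.+ N ℕ.* q ℕ.* D ≡ q ℕ.* (N ℕ.* (D ℕ.+ m ℕ.* D))
    regroup = ℕSolver.solve-∀
    eq : ∀ q x n u k g r → q * (x - n * (1ℤ * u + k * g)) ≡ ((q * x - (r + k * (n * q)) * g) - n * q * u) + r * g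
    eq = solve-∀
    decompose : + q * (x - + N * rounded u g) ≡ ((+ q * x - + p * g) - + (N ℕ.* q) * u) + + remainder * g
    decompose = trans (eq (+ q) x (+ N) u (+ quotient) g (+ remainder))
      (cong₂ (λ z w → ((+ q * x - z * g) - w * u) + + remainder * g) (sym p≡) (sym (ℤₚ.pos-* N q)))

roundKernel : ∀ {d n D} (A : Matrix ℤ d n) → MinorBound A D → IndependentRows A →
  ∀ X → Kernel A X → ∀ N → 0 ℕ.< N →
  ∃ λ x → Kernel A x × (∀ i → Between (+ N * x i) (X i)) × (∀ i → ∣ X i - + N * x i ∣ ℕ.≤ N ℕ.* ((n ℕ.∸ d) ℕ.* D))
roundKernel {d} {n} {D} A bound indep X ker N 0<N with Finₚ.any? (λ i → ¬? (X i ℤₚ.≟ 0ℤ))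
... | no none = (λ _ → 0ℤ) , (λ i → sum-zero λ j → ℤₚ.*-zeroʳ (A i j)) ,
    (λ i → subst (λ u → Between u (X i)) (sym (ℤₚ.*-zeroʳ (+ N))) ((λ 0≤X → ℤₚ.≤-refl , 0≤X) , (λ X≤0 → ℤₚ.≤-refl , X≤0))) ,
    (λ i → subst (ℕ._≤ N ℕ.* ((n ℕ.∸ d) ℕ.* D)) (sym (cong ∣_∣ (trans (cong (_- + N * 0ℤ) (X≡0 i)) (zero-error (+ N))))) ℕ.z≤n)
  where
  X≡0 : ∀ i → X i ≡ 0ℤ
  X≡0 i = decidable-stable (X i ℤₚ.≟ 0ℤ) λ X≢0 → none (i , X≢0)
  zero-error : ∀ n → 0ℤ - n * 0ℤ ≡ 0ℤ
  zero-error = solve-∀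
roundKernel {d} {suc n} {D} A bound indep X ker N 0<N | yes nz with conformalCircuit A bound indep X ker nz
... | g , (ker-g , (i₀ , g₀≢0) , bd) , conf with argmin-ratio (λ i → ∣ X i ∣) (λ i → ∣ g i ∣)
        (i₀ , ℕₚ.n≢0⇒n>0 (g₀≢0 ∘ ℤₚ.∣i∣≡0⇒i≡0))
...   | c , 0<q , min =
  let u , ker-u , btw-u , err-u = roundKernel (deleteColumn A c) (minorBound-delete A bound c) indep′
        (removeAt Y c) (kernel-removeAt A Y c Yc≡0 ker-Y) (N ℕ.* q) (ℕₚ.*-mono-< {0} {N} {0} {q} 0<N 0<q)
      u′ = insertAt u c 0ℤ
      btw-u′ : ∀ i → Between (+ (N ℕ.* q) * u′ i) (Y i)
      btw-u′ = ∀-punchIn (λ i → Between (+ (N ℕ.* q) * u′ i) (Y i)) c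
        (subst₂ Between (sym (trans (cong (+ (N ℕ.* q) *_) (insertAt-lookup u c 0ℤ)) (ℤₚ.*-zeroʳ (+ (N ℕ.* q))))) (sym Yc≡0)
          ((λ _ → ℤₚ.≤-refl , ℤₚ.≤-refl) , (λ _ → ℤₚ.≤-refl , ℤₚ.≤-refl)))
        (λ k → subst (λ z → Between (+ (N ℕ.* q) * z) (Y (punchIn c k))) (sym (insertAt-punchIn u c 0ℤ k)) (btw-u k))
      err-u′ : ∀ i → ∣ Y i - + (N ℕ.* q) * u′ i ∣ ℕ.≤ N ℕ.* q ℕ.* ((n ℕ.∸ d) ℕ.* D)
      err-u′ = ∀-punchIn (λ i → ∣ Y i - + (N ℕ.* q) * u′ i ∣ ℕ.≤ N ℕ.* q ℕ.* ((n ℕ.∸ d) ℕ.* D)) c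
        (subst (λ z → ∣ z ∣ ℕ.≤ N ℕ.* q ℕ.* ((n ℕ.∸ d) ℕ.* D))
          (sym (trans (cong₂ (λ y v → y - + (N ℕ.* q) * v) Yc≡0 (insertAt-lookup u c 0ℤ)) (zero-error (+ (N ℕ.* q))))) ℕ.z≤n)
        (λ k → subst (λ z → ∣ Y (punchIn c k) - + (N ℕ.* q) * z ∣ ℕ.≤ N ℕ.* q ℕ.* ((n ℕ.∸ d) ℕ.* D))
          (sym (insertAt-punchIn u c 0ℤ k)) (err-u k))
  in (λ i → S.rounded (u′ i) (g i)) ,
     kernel-combination A 1ℤ u′ (+ S.quotient) g (kernel-insertAt A u c ker-u) ker-g ,
     (λ i → S.between (X i) (g i) (u′ i) (conf i) (conf-Y i) (btw-u′ i)) ,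
     -- The rows stay independent on the n remaining columns, so d ≤ n, and the truncated difference
     -- really drops by one with the deleted column.
     (λ i → subst (λ m → ∣ X i - + N * S.rounded (u′ i) (g i) ∣ ℕ.≤ N ℕ.* (m ℕ.* D)) (sym (ℕₚ.+-∸-assoc 1 d≤n))
       (S.error (n ℕ.∸ d) (X i) (g i) (u′ i) (bd i) (err-u′ i)))
  where
  p q : ℕ
  p = ∣ X c ∣
  q = ∣ g c ∣
  module S = RoundStep N q p 0<N 0<q
  Y : Vector ℤ (suc n)
  Y i = + q * X i - + p * g i
  zero-error : ∀ n → 0ℤ - n * 0ℤ ≡ 0ℤ
  zero-error = solve-∀
  Yc≡0 : Y c ≡ 0ℤ
  Yc≡0 = conformal⇒∣∣-cross (g c) (X c) (conf c)
  ker-Y : Kernel A Y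
  ker-Y = kernel-difference A (+ q) X (+ p) g ker ker-g
  supp : ∀ i → X i ≡ 0ℤ → g i ≡ 0ℤ
  supp i X≡0 = ℤₚ.≤-antisym (proj₂ (conf i) (ℤₚ.≤-reflexive X≡0)) (proj₁ (conf i) (ℤₚ.≤-reflexive (sym X≡0)))
  conf-Y : IsConformal Y X
  conf-Y i = conformal-step p q (X i) (g i) (supp i) λ _ →
    subst (p ℕ.* ∣ g i ∣ ℕ.≤_) (ℕₚ.*-comm ∣ X i ∣ q) (min i)
  Xc≢0 : X c ≢ 0ℤ
  Xc≢0 X≡0 = ℕₚ.<⇒≢ 0<q (sym (cong ∣_∣ (supp c X≡0)))
  indep′ : IndependentRows (deleteColumn A c)
  indep′ = independent-delete A X c ker Xc≢0 indep
  d≤n : d ℕ.≤ n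
  d≤n = thin⇒≤ (proj₁ (proj₁ (independent⇒minor indep′)))

-- Nonnegative solutions

InSemigroup : ∀ {d n} → Matrix ℤ d n → Vector ℤ d → Set
InSemigroup {n = n} A h = ∃ λ (z : Vector ℤ n) → (∀ j → 0ℤ ≤ z j) × (∀ i → A i · z ≡ h i)

-- Membership of h in Q + ℤ a_j.
InSemigroupUpTo : ∀ {d n} → Matrix ℤ d n → Fin n → Vector ℤ d → Set
InSemigroupUpTo {n = n} A j h = ∃ λ (z : Vector ℤ n) → (∀ c → c ≢ j → 0ℤ ≤ z c) × (∀ i → A i · z ≡ h i)

-- Integrality absorbs the slack of the approximate solutions: greater than -1 means nonnegative.
-N<N*i⇒0≤i : ∀ {N} i → 0 ℕ.< N → - + N < + N * i → 0ℤ ≤ i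
-N<N*i⇒0≤i {N} i 0<N lt = ℤₚ.i<j⇒suc[i]≤j {i = -1ℤ} (ℤₚ.*-cancelˡ-<-nonNeg (+ N) (subst (_< + N * i) (minus (+ N)) lt))
  where
  minus : ∀ n → - n ≡ n * -1ℤ
  minus = solve-∀

-- The vector L / N is a rational solution which need only be greater than -1 in each coordinate.
-- Rounding the kernel vector z - L / N and subtracting the result from z makes z nonnegative.
solution-correction : ∀ {d n D} (A : Matrix ℤ d n) → MinorBound A D → IndependentRows A →
  ∀ (h : Vector ℤ d) N (L : Vector ℤ n) → 0 ℕ.< N → (∀ i → A i · L ≡ + N * h i) → (∀ j → - + N < L j) →
  ∀ j → InSemigroupUpTo A j h → + (N ℕ.* ((n ℕ.∸ d) ℕ.* D)) < L j + + N → InSemigroup A h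
solution-correction {d} {n} {D} A bound indep h N L 0<N AL≡Nh -N<L j₀ (z , 0≤z , Az≡h) large =
  let x , ker-x , btw , err = roundKernel A bound indep X ker-X N 0<N
  in (λ j → 1ℤ * z j - 1ℤ * x j) ,
     (λ j → subst (0ℤ ≤_) (sym (unscale (z j) (x j))) (nonNegative x btw err j)) ,
     (λ i → trans (·-linear- (A i) 1ℤ z 1ℤ x) (trans (cong₂ (λ a b → 1ℤ * a - 1ℤ * b) (Az≡h i) (ker-x i)) (drop-zero (h i))))
  where
  open ℤₚ.≤-Reasoning
  X : Vector ℤ n
  X j = + N * z j - 1ℤ * L j
  unscale : ∀ a b → 1ℤ * a - 1ℤ * b ≡ a - b
  unscale = solve-∀
  drop-zero : ∀ a → 1ℤ * a - 1ℤ * 0ℤ ≡ a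
  drop-zero = solve-∀
  ·-linear- : ∀ (v : Vector ℤ n) a x b y → v · (λ j → a * x j - b * y j) ≡ a * (v · x) - b * (v · y)
  ·-linear- v a x b y = trans (·-congʳ v (λ j → cong (λ z → a * x j + z) (ℤₚ.neg-distribˡ-* b (y j))))
    (trans (·-linearʳ v a x (- b) y) (cong (λ z → a * (v · x) + z) (sym (ℤₚ.neg-distribˡ-* b (v · y)))))
  ker-X : Kernel A X
  ker-X i = trans (·-linear- (A i) (+ N) z 1ℤ L) (trans (cong₂ (λ a b → + N * a - 1ℤ * b) (Az≡h i) (AL≡Nh i)) (cancel (+ N) (h i)))
    where
    cancel : ∀ n h → n * h - 1ℤ * (n * h) ≡ 0ℤ
    cancel = solve-∀
  nonNegative : ∀ x → (∀ i → Between (+ N * x i) (X i)) → (∀ i → ∣ X i - + N * x i ∣ ℕ.≤ N ℕ.* ((n ℕ.∸ d) ℕ.* D)) →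
    ∀ j → 0ℤ ≤ z j - x j
  nonNegative x btw err j with j Finₚ.≟ j₀
  -- At j₀ nothing is known about z, but N (z - x) differs from L by at most the rounding error K,
  -- and L - K > - N.
  ... | yes refl = -N<N*i⇒0≤i (z j - x j) 0<N (begin-strict
    - + N                                                    ≡⟨ shift (+ N) (+ K) ⟩
    (+ K - + N) - + K                                        <⟨ ℤₚ.+-monoˡ-< (- + K) (subst (+ K - + N <_) (restore (L j) (+ N)) (ℤₚ.+-monoˡ-< (- + N) large)) ⟩
    L j - + K                                                ≤⟨ ℤₚ.+-monoʳ-≤ (L j) (-∣i∣≤i (X j - + N * x j) (err j)) ⟩
    L j + (X j - + N * x j)                                  ≡⟨ expand (+ N) (z j) (L j) (x j) ⟩
    + N * (z j - x j)                                        ∎)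
    where
    K = N ℕ.* ((n ℕ.∸ d) ℕ.* D)
    shift : ∀ n k → - n ≡ (k - n) - k
    shift = solve-∀
    restore : ∀ l n → (l + n) - n ≡ l
    restore = solve-∀
    expand : ∀ n z l x → l + ((n * z - 1ℤ * l) - n * x) ≡ n * (z - x)
    expand = solve-∀
    -∣i∣≤i : ∀ i {k} → ∣ i ∣ ℕ.≤ k → - + k ≤ i
    -∣i∣≤i (+ m)    _  = ℤₚ.neg-≤-pos
    -∣i∣≤i -[1+ m ] le = ℤₚ.neg-mono-≤ (ℤ.+≤+ le)
  ... | no j≢j₀ with ℤₚ.≤-total 0ℤ (X j)
  -- Here N x ≤ X, so z - x is at least L / N.
  ...   | inj₁ 0≤X = -N<N*i⇒0≤i (z j - x j) 0<N (begin-strict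
    - + N                                                    <⟨ -N<L j ⟩
    L j                                                      ≡⟨ split (+ N * z j) (L j) ⟩
    + N * z j - X j                                          ≤⟨ ℤₚ.+-monoʳ-≤ (+ N * z j) (ℤₚ.neg-mono-≤ (proj₂ (proj₁ (btw j) 0≤X))) ⟩
    + N * z j - + N * x j                                    ≡⟨ factor (+ N) (z j) (x j) ⟩
    + N * (z j - x j)                                        ∎)
    where
    split : ∀ a l → l ≡ a - (a - 1ℤ * l)
    split = solve-∀
    factor : ∀ n z x → n * z - n * x ≡ n * (z - x)
    factor = solve-∀
  -- Here x ≤ 0, so z - x is at least z.
  ...   | inj₂ X≤0 = ℤₚ.i≤j⇒0≤j-i (ℤₚ.≤-trans x≤0 (0≤z j j≢j₀))
    where
    x≤0 : x j ≤ 0ℤ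
    x≤0 = ℤₚ.*-cancelˡ-≤-pos (x j) 0ℤ (+ N) {{ℤ.positive (ℤ.+<+ 0<N)}}
      (subst (+ N * x j ≤_) (sym (ℤₚ.*-zeroʳ (+ N))) (proj₁ (proj₂ (btw j) X≤0)))

-- Counting columns

sumₙ-mono : ∀ {n} {f g : Vector ℕ n} → (∀ i → f i ℕ.≤ g i) → sumₙ f ℕ.≤ sumₙ g
sumₙ-mono {zero}  f≤g = ℕ.z≤n
sumₙ-mono {suc n} f≤g = ℕₚ.+-mono-≤ (f≤g zero) (sumₙ-mono (f≤g ∘ suc))

term≤sumₙ : ∀ {n} (f : Vector ℕ n) i → f i ℕ.≤ sumₙ f
term≤sumₙ f zero    = ℕₚ.m≤m+n _ _
term≤sumₙ f (suc i) = ℕₚ.m≤n⇒m≤o+n (f zero) (term≤sumₙ (tail f) i)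

sumₙ-const : ∀ n k → sumₙ {n} (λ _ → k) ≡ n ℕ.* k
sumₙ-const zero    k = refl
sumₙ-const (suc n) k = cong (k ℕ.+_) (sumₙ-const n k)

∣sum∣≤ : ∀ {n} (f : Vector ℤ n) → ∣ sum f ∣ ℕ.≤ sumₙ (∣_∣ ∘ f)
∣sum∣≤ {zero}  f = ℕ.z≤n
∣sum∣≤ {suc n} f = ℕₚ.≤-trans (ℤₚ.∣i+j∣≤∣i∣+∣j∣ (f zero) (sum (tail f))) (ℕₚ.+-monoʳ-≤ ∣ f zero ∣ (∣sum∣≤ (tail f)))

∣·∣≤ : ∀ {n} (v w : Vector ℤ n) {b} → (∀ j → ∣ w j ∣ ℕ.≤ b) → ∣ v · w ∣ ℕ.≤ sumₙ (∣_∣ ∘ v) ℕ.* b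
∣·∣≤ v w {b} ∣w∣≤b = begin
  ∣ v · w ∣                         ≤⟨ ∣sum∣≤ (λ j → v j * w j) ⟩
  sumₙ (λ j → ∣ v j * w j ∣)        ≤⟨ sumₙ-mono (λ j → ℕₚ.≤-trans (ℕₚ.≤-reflexive (ℤₚ.abs-* (v j) (w j))) (ℕₚ.*-monoʳ-≤ ∣ v j ∣ (∣w∣≤b j))) ⟩
  sumₙ (λ j → ∣ v j ∣ ℕ.* b)        ≡⟨ *-distribʳ-sumₙ b (∣_∣ ∘ v) ⟨
  sumₙ (∣_∣ ∘ v) ℕ.* b              ∎
  where open ℕₚ.≤-Reasoning

indicator : {P : Set} → Dec P → ℕ
indicator (yes _) = 1
indicator (no  _) = 0

indicator-yes : {P : Set} (P? : Dec P) → P → indicator P? ≡ 1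
indicator-yes (yes _) p = refl
indicator-yes (no ¬p) p = contradiction p ¬p

indicator-no : {P : Set} (P? : Dec P) → ¬ P → indicator P? ≡ 0
indicator-no (yes p) ¬p = contradiction p ¬p
indicator-no (no _)  ¬p = refl

sumₙ-indicator≤1 : ∀ {n} {P : Fin n → Set} (P? : ∀ i → Dec (P i)) → (∀ i j → P i → P j → i ≡ j) →
  sumₙ (λ i → indicator (P? i)) ℕ.≤ 1
sumₙ-indicator≤1 {zero}  P? unique = ℕ.z≤n
sumₙ-indicator≤1 {suc n} P? unique with P? zero
... | no  _ = sumₙ-indicator≤1 (P? ∘ suc) λ i j p q → Finₚ.suc-injective (unique (suc i) (suc j) p q)
... | yes p = ℕ.s≤s (ℕₚ.≤-reflexive (trans
  (sumₙ-cong-≗ λ i → indicator-no (P? (suc i)) λ q → Finₚ.0≢1+n (unique zero (suc i) p q))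
  (trans (sumₙ-const n 0) (ℕₚ.*-zeroʳ n))))

≢0⇒∣∣>0 : ∀ {i} → i ≢ 0ℤ → 0 ℕ.< ∣ i ∣
≢0⇒∣∣>0 i≢0 = ℕₚ.n≢0⇒n>0 (i≢0 ∘ ℤₚ.∣i∣≡0⇒i≡0)

rowSum : ∀ {d n} → Matrix ℤ d n → Fin d → ℕ
rowSum A i = sumₙ λ j → ∣ A i j ∣

columnSum : ∀ {d n} → Matrix ℤ d n → Fin n → ℕ
columnSum A j = sumₙ λ i → ∣ A i j ∣

NonzeroColumn : ∀ {d n} → Matrix ℤ d n → Fin n → Set
NonzeroColumn A j = ∃ λ i → A i j ≢ 0ℤ

DistinctColumns NoOppositeColumns : ∀ {d n} → Matrix ℤ d n → Set
DistinctColumns A = ∀ j k → (∀ i → A i j ≡ A i k) → j ≡ k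
NoOppositeColumns A = ∀ j k → (∀ i → A i j ≡ - A i k) → ¬ NonzeroColumn A j

∣i∣≡1⇒±1 : ∀ i → ∣ i ∣ ≡ 1 → i ≡ 1ℤ ⊎ i ≡ -1ℤ
∣i∣≡1⇒±1 (+ 1)      refl = inj₁ refl
∣i∣≡1⇒±1 -[1+ 0 ]   refl = inj₂ refl

abs-sum≡1 : ∀ {d} (f : Vector ℤ d) i → sumₙ (∣_∣ ∘ f) ≡ 1 → f i ≢ 0ℤ → ∣ f i ∣ ≡ 1 × (∀ r → r ≢ i → f r ≡ 0ℤ)
abs-sum≡1 {suc e} f i sum≡1 fᵢ≢0 = ∣fᵢ∣≡1 , ∀-punchIn (λ r → r ≢ i → f r ≡ 0ℤ) i (λ i≢i → contradiction refl i≢i)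
  λ k _ → ℤₚ.∣i∣≡0⇒i≡0 (ℕₚ.n≤0⇒n≡0 (subst (∣ f (punchIn i k) ∣ ℕ.≤_) rest≡0 (term≤sumₙ (λ k → ∣ f (punchIn i k) ∣) k)))
  where
  rest = sumₙ (λ k → ∣ f (punchIn i k) ∣)
  total : ∣ f i ∣ ℕ.+ rest ≡ 1
  total = trans (sym (sumₙ-remove {i = i} (∣_∣ ∘ f))) sum≡1
  ∣fᵢ∣≡1 : ∣ f i ∣ ≡ 1
  ∣fᵢ∣≡1 = ℕₚ.≤-antisym (subst (∣ f i ∣ ℕ.≤_) total (ℕₚ.m≤m+n ∣ f i ∣ rest)) (≢0⇒∣∣>0 fᵢ≢0)
  rest≡0 : rest ≡ 0
  rest≡0 = ℕₚ.suc-injective (trans (cong (ℕ._+ rest) (sym ∣fᵢ∣≡1)) total)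

module ColumnCount {d n} (A : Matrix ℤ d n) (nonzero : ∀ j → NonzeroColumn A j)
  (distinct : DistinctColumns A) (noOpposite : NoOppositeColumns A) where

  SignedUnit : Fin d → Fin n → Set
  SignedUnit i j = columnSum A j ≡ 1 × A i j ≢ 0ℤ

  signedUnit? : ∀ i j → Dec (SignedUnit i j)
  signedUnit? i j = (columnSum A j ℕₚ.≟ 1) ×-dec ¬? (A i j ℤₚ.≟ 0ℤ)

  -- Two signed unit columns with their entries in the same row are equal or opposite, and both are
  -- excluded.
  signedUnit-unique : ∀ i j k → SignedUnit i j → SignedUnit i k → j ≡ k
  signedUnit-unique i j k (sumⱼ≡1 , Aᵢⱼ≢0) (sumₖ≡1 , Aᵢₖ≢0) =
    compare (∣i∣≡1⇒±1 (A i j) (proj₁ unitⱼ)) (∣i∣≡1⇒±1 (A i k) (proj₁ unitₖ))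
    where
    unitⱼ = abs-sum≡1 (λ r → A r j) i sumⱼ≡1 Aᵢⱼ≢0
    unitₖ = abs-sum≡1 (λ r → A r k) i sumₖ≡1 Aᵢₖ≢0
    agree : ∀ (f : ℤ → ℤ) → A i j ≡ f (A i k) → 0ℤ ≡ f 0ℤ → ∀ r → A r j ≡ f (A r k)
    agree f eq f0 r with r Finₚ.≟ i
    ... | yes refl = eq
    ... | no  r≢i  = trans (proj₂ unitⱼ r r≢i) (trans f0 (cong f (sym (proj₂ unitₖ r r≢i))))
    compare : A i j ≡ 1ℤ ⊎ A i j ≡ -1ℤ → A i k ≡ 1ℤ ⊎ A i k ≡ -1ℤ → j ≡ k
    compare (inj₁ p) (inj₁ q) = distinct j k (agree (λ x → x) (trans p (sym q)) refl)
    compare (inj₂ p) (inj₂ q) = distinct j k (agree (λ x → x) (trans p (sym q)) refl)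
    compare (inj₁ p) (inj₂ q) = contradiction (i , Aᵢⱼ≢0) (noOpposite j k (agree -_ (trans p (sym (cong -_ q))) refl))
    compare (inj₂ p) (inj₁ q) = contradiction (i , Aᵢⱼ≢0) (noOpposite j k (agree -_ (trans p (sym (cong -_ q))) refl))

  -- Tops up the absolute sum of a signed unit column from 1 to 2, charging the row of its nonzero
  -- entry.
  bonus : Fin d → Fin n → ℕ
  bonus i j = indicator (signedUnit? i j)

  column≥2 : ∀ j → 2 ℕ.≤ sumₙ (λ i → ∣ A i j ∣ ℕ.+ bonus i j)
  column≥2 j = cases (nonzero j) (columnSum A j ℕₚ.≟ 1)
    where
    open ℕₚ.≤-Reasoning
    cases : NonzeroColumn A j → Dec (columnSum A j ≡ 1) → 2 ℕ.≤ sumₙ (λ i → ∣ A i j ∣ ℕ.+ bonus i j)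
    cases (i , Aᵢⱼ≢0) (yes sum≡1) = begin
      1 ℕ.+ 1                                 ≤⟨ ℕₚ.+-mono-≤ (≢0⇒∣∣>0 Aᵢⱼ≢0) (ℕₚ.≤-reflexive (sym (indicator-yes (signedUnit? i j) (sum≡1 , Aᵢⱼ≢0)))) ⟩
      ∣ A i j ∣ ℕ.+ bonus i j                 ≤⟨ term≤sumₙ (λ i → ∣ A i j ∣ ℕ.+ bonus i j) i ⟩
      sumₙ (λ i → ∣ A i j ∣ ℕ.+ bonus i j)    ∎
    cases (i , Aᵢⱼ≢0) (no sum≢1) = begin
      2                                       ≤⟨ ℕₚ.≤∧≢⇒< (ℕₚ.≤-trans (≢0⇒∣∣>0 Aᵢⱼ≢0) (term≤sumₙ (λ i → ∣ A i j ∣) i)) (sum≢1 ∘ sym) ⟩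
      columnSum A j                           ≤⟨ sumₙ-mono (λ i → ℕₚ.m≤m+n ∣ A i j ∣ (bonus i j)) ⟩
      sumₙ (λ i → ∣ A i j ∣ ℕ.+ bonus i j)    ∎

  -- Every column has absolute sum at least 2, except signed unit vectors, of which each row meets at most one.
  2n≤d[R+1] : ∀ {R} → (∀ i → rowSum A i ℕ.≤ R) → n ℕ.* 2 ℕ.≤ d ℕ.* (R ℕ.+ 1)
  2n≤d[R+1] {R} rows = begin
    n ℕ.* 2
      ≡⟨ sumₙ-const n 2 ⟨
    sumₙ {n} (λ j → 2)
      ≤⟨ sumₙ-mono column≥2 ⟩
    sumₙ (λ j → sumₙ λ i → ∣ A i j ∣ ℕ.+ bonus i j)
      ≡⟨ ∑ₙ-comm (λ j i → ∣ A i j ∣ ℕ.+ bonus i j) ⟩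
    sumₙ (λ i → sumₙ λ j → ∣ A i j ∣ ℕ.+ bonus i j)
      ≡⟨ sumₙ-cong-≗ (λ i → ∑ₙ-distrib-+ (λ j → ∣ A i j ∣) (bonus i)) ⟩
    sumₙ (λ i → rowSum A i ℕ.+ sumₙ (bonus i))
      ≤⟨ sumₙ-mono (λ i → ℕₚ.+-mono-≤ (rows i) (sumₙ-indicator≤1 (signedUnit? i) (signedUnit-unique i))) ⟩
    sumₙ {d} (λ i → R ℕ.+ 1)
      ≡⟨ sumₙ-const d (R ℕ.+ 1) ⟩
    d ℕ.* (R ℕ.+ 1) ∎
    where open ℕₚ.≤-Reasoning

-- Here n ∸ d ≤ d (R - 1) / 2, so R (n ∸ d) ≤ d (R - 1)² because R ≤ 2 (R - 1) unless R ≤ 1.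
column-arithmetic : ∀ d n R → d ℕ.≤ n → n ℕ.* 2 ℕ.≤ d ℕ.* (R ℕ.+ 1) → R ℕ.* (n ℕ.∸ d) ℕ.≤ suc d ℕ.* ((R ℕ.∸ 1) ℕ.* (R ℕ.∸ 1))
column-arithmetic d n zero    d≤n count = ℕ.z≤n
column-arithmetic d n (suc M) d≤n count = ℕₚ.≤-trans (bound M 2m≤dM) (ℕₚ.m≤n+m (d ℕ.* (M ℕ.* M)) (M ℕ.* M))
  where
  open ℕₚ.≤-Reasoning
  m = n ℕ.∸ d
  2m≤dM : m ℕ.* 2 ℕ.≤ d ℕ.* M
  2m≤dM = ℕₚ.+-cancelʳ-≤ (d ℕ.* 2) (m ℕ.* 2) (d ℕ.* M) (begin
    m ℕ.* 2 ℕ.+ d ℕ.* 2      ≡⟨ ℕₚ.*-distribʳ-+ 2 m d ⟨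
    (m ℕ.+ d) ℕ.* 2          ≡⟨ cong (ℕ._* 2) (ℕₚ.m∸n+n≡m d≤n) ⟩
    n ℕ.* 2                  ≤⟨ count ⟩
    d ℕ.* (suc M ℕ.+ 1)      ≡⟨ eq d M ⟩
    d ℕ.* M ℕ.+ d ℕ.* 2      ∎)
    where
    eq : ∀ d M → d ℕ.* (1 ℕ.+ M ℕ.+ 1) ≡ d ℕ.* M ℕ.+ d ℕ.* 2
    eq = ℕSolver.solve-∀
  bound : ∀ M → m ℕ.* 2 ℕ.≤ d ℕ.* M → suc M ℕ.* m ℕ.≤ d ℕ.* (M ℕ.* M)
  -- For R = 1 the estimate R ≤ 2 (R - 1) fails, but the count already forces m = 0.
  bound zero    2m≤0 = ℕₚ.≤-trans (ℕₚ.≤-reflexive (ℕₚ.+-identityʳ m)) (ℕₚ.≤-trans (ℕₚ.m≤m*n m 2) 2m≤0)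
  bound (suc K) 2m≤dM = ℕₚ.*-cancelʳ-≤ (suc (suc K) ℕ.* m) (d ℕ.* (suc K ℕ.* suc K)) 2 (begin
    suc (suc K) ℕ.* m ℕ.* 2                   ≡⟨ ℕₚ.*-assoc (suc (suc K)) m 2 ⟩
    suc (suc K) ℕ.* (m ℕ.* 2)                 ≤⟨ ℕₚ.*-mono-≤ 2+K≤2[1+K] 2m≤dM ⟩
    suc K ℕ.* 2 ℕ.* (d ℕ.* suc K)             ≡⟨ eq d (suc K) ⟩
    d ℕ.* (suc K ℕ.* suc K) ℕ.* 2             ∎)
    where
    2+K≤2[1+K] : suc (suc K) ℕ.≤ suc K ℕ.* 2
    2+K≤2[1+K] = ℕ.s≤s (ℕ.s≤s (ℕₚ.m≤m*n K 2))
    eq : ∀ d M → M ℕ.* 2 ℕ.* (d ℕ.* M) ≡ d ℕ.* (M ℕ.* M) ℕ.* 2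
    eq = ℕSolver.solve-∀

-- The bound for integral data

-- L / N solves A λ = h exactly, with entries greater than -1 / P. The final bound takes P = 1;
-- arbitrary P makes the notion stable under merging columns, which adds up two slacks.
ApproximateSolutions : ∀ {d n} → Matrix ℤ d n → Vector ℤ d → Set
ApproximateSolutions {n = n} A h = ∀ P → ∃ λ N → ∃ λ (L : Vector ℤ n) →
  0 ℕ.< N × (∀ i → A i · L ≡ + N * h i) × (∀ j → - + N < + P * L j)

-- Approximate solutions stand for membership of h in the real cone, and the solutions with one
-- unconstrained coordinate for the finiteness of the set of holes.
record IntegralHole {d n} (A : Matrix ℤ d n) (h : Vector ℤ d) (R D : ℕ) : Set where
  field
    independent  : IndependentRows A
    minors≤D     : MinorBound A D
    rows≤R       : ∀ i → rowSum A i ℕ.≤ R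
    noOpposite   : NoOppositeColumns A
    approximate  : ApproximateSolutions A h
    upToColumn   : ∀ j → NonzeroColumn A j → ¬ ¬ InSemigroupUpTo A j h
    notInSemigroup : ¬ InSemigroup A h

-- Treats zero columns (u = 0) and repeated columns (u a unit vector) at once: the weight of column
-- c is moved onto the columns selected by u.
module DeleteColumn {d n} (A : Matrix ℤ d (suc n)) (c : Fin (suc n))
  (u : Vector ℤ n) (u∈01 : ∀ k → u k ≡ 0ℤ ⊎ u k ≡ 1ℤ) (Ac≡A∖c·u : ∀ i → A i c ≡ deleteColumn A c i · u) where

  A∖c : Matrix ℤ d n
  A∖c = deleteColumn A c

  merge : Vector ℤ (suc n) → Vector ℤ n
  merge z k = 1ℤ * z (punchIn c k) + z c * u k

  A∖c·merge : ∀ z i → A∖c i · merge z ≡ A i · z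
  A∖c·merge z i = begin
    A∖c i · merge z                                        ≡⟨ ·-linearʳ (A∖c i) 1ℤ (removeAt z c) (z c) u ⟩
    1ℤ * (A∖c i · removeAt z c) + z c * (A∖c i · u)        ≡⟨ cong (λ a → 1ℤ * (A∖c i · removeAt z c) + z c * a) (Ac≡A∖c·u i) ⟨
    1ℤ * (A∖c i · removeAt z c) + z c * A i c              ≡⟨ swap (A∖c i · removeAt z c) (z c) (A i c) ⟩
    A i c * z c + A∖c i · removeAt z c                     ≡⟨ ·-remove (A i) z c ⟨
    A i · z                                                ∎
    where
    open ≡-Reasoning
    swap : ∀ r z a → 1ℤ * r + z * a ≡ a * z + r
    swap = solve-∀

  0≤u : ∀ k → 0ℤ ≤ u k
  0≤u k with u∈01 k
  ... | inj₁ eq = ℤₚ.≤-reflexive (sym eq)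
  ... | inj₂ eq = subst (0ℤ ≤_) (sym eq) (ℤ.+≤+ ℕ.z≤n)

  merge-nonNeg : ∀ z k → 0ℤ ≤ z (punchIn c k) → 0ℤ ≤ z c → 0ℤ ≤ merge z k
  merge-nonNeg z k 0≤zₖ 0≤zc = ℤₚ.+-mono-≤ (subst (0ℤ ≤_) (sym (ℤₚ.*-identityˡ (z (punchIn c k)))) 0≤zₖ)
    (nonNeg*nonNeg 0≤zc (0≤u k))

  independent-deleted : IndependentRows A → IndependentRows A∖c
  independent-deleted indep y yA∖c≡0 = indep y (∀-punchIn (λ j → y · (λ i → A i j) ≡ 0ℤ) c yAc≡0 yA∖c≡0)
    where
    yAc≡0 : y · (λ i → A i c) ≡ 0ℤ
    yAc≡0 = trans (·-congʳ y Ac≡A∖c·u) (trans (·-transpose A∖c y u)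
      (sum-zero λ k → trans (cong (_* u k) (yA∖c≡0 k)) (ℤₚ.*-zeroˡ (u k))))

  -- Doubling P leaves room for adding two coordinates.
  approximate-deleted : ∀ {h} → ApproximateSolutions A h → ApproximateSolutions A∖c h
  approximate-deleted approx P with approx (2 ℕ.* P)
  ... | N , L , 0<N , AL≡Nh , -N<2PL = N , merge L , 0<N , (λ i → trans (A∖c·merge L i) (AL≡Nh i)) , λ k →
    ℤₚ.*-cancelˡ-<-nonNeg (+ 2) (begin-strict
      + 2 * - + N                                          ≡⟨ double (+ N) ⟩
      - + N + - + N                                        <⟨ ℤₚ.+-mono-<-≤ (lower (punchIn c k)) (scaled k) ⟩
      + 2 * + P * L (punchIn c k) + u k * (+ 2 * + P * L c) ≡⟨ collect (+ P) (L (punchIn c k)) (L c) (u k) ⟩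
      + 2 * (+ P * merge L k)                              ∎)
    where
    open ℤₚ.≤-Reasoning
    double : ∀ n → + 2 * - n ≡ - n + - n
    double = solve-∀
    collect : ∀ p a b u → + 2 * p * a + u * (+ 2 * p * b) ≡ + 2 * (p * (1ℤ * a + b * u))
    collect = solve-∀
    lower : ∀ j → - + N < + 2 * + P * L j
    lower j = subst (λ z → - + N < z * L j) (ℤₚ.pos-* 2 P) (-N<2PL j)
    scaled : ∀ k → - + N ≤ u k * (+ 2 * + P * L c)
    scaled k with u∈01 k
    ... | inj₁ eq = subst (λ v → - + N ≤ v * (+ 2 * + P * L c)) (sym eq) (ℤₚ.neg-≤-pos {N} {0})
    ... | inj₂ eq = subst (λ v → - + N ≤ v * (+ 2 * + P * L c)) (sym eq)
                      (subst (- + N ≤_) (sym (ℤₚ.*-identityˡ (+ 2 * + P * L c))) (ℤₚ.<⇒≤ (lower c)))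

  delete : ∀ {h R D} → IntegralHole A h R D → IntegralHole A∖c h R D
  delete {h} {R} {D} hole = record
    { independent  = independent-deleted independent
    ; minors≤D     = minorBound-delete A minors≤D c
    ; rows≤R       = λ i → ℕₚ.≤-trans (ℕₚ.m≤n+m (rowSum A∖c i) ∣ A i c ∣)
                       (subst (ℕ._≤ R) (sumₙ-remove {i = c} (λ j → ∣ A i j ∣)) (rows≤R i))
    ; noOpposite   = λ j k → noOpposite (punchIn c j) (punchIn c k)
    ; approximate  = approximate-deleted approximate
    -- The free coordinate is `punchIn c k`, so z is nonnegative at c, and merging that weight
    -- creates no negative entry away from k.
    ; upToColumn   = λ k nz ¬z → upToColumn (punchIn c k) nz λ (z , 0≤z , Az≡h) →
        ¬z (merge z , (λ l l≢k → merge-nonNeg z l (0≤z (punchIn c l) (l≢k ∘ Finₚ.punchIn-injective c l k))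
                                   (0≤z c (Finₚ.punchInᵢ≢i c k ∘ sym))) ,
                      λ i → trans (A∖c·merge z i) (Az≡h i))
    ; notInSemigroup = λ (z , 0≤z , A∖cz≡h) → notInSemigroup (insertAt z c 0ℤ ,
        ∀-punchIn (λ j → 0ℤ ≤ insertAt z c 0ℤ j) c
          (ℤₚ.≤-reflexive (sym (insertAt-lookup z c 0ℤ)))
          (λ k → subst (0ℤ ≤_) (sym (insertAt-punchIn z c 0ℤ k)) (0≤z k)) ,
        λ i → trans (·-insertAt (A i) z c) (A∖cz≡h i))
    }
    where open IntegralHole hole

unit∈01 : ∀ {n} (i j : Fin n) → unit i j ≡ 0ℤ ⊎ unit i j ≡ 1ℤ
unit∈01 zero    zero    = inj₂ refl
unit∈01 zero    (suc j) = inj₁ refl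
unit∈01 (suc i) zero    = inj₁ refl
unit∈01 (suc i) (suc j) = unit∈01 i j

bound-reduced : ∀ {d n R D} (A : Matrix ℤ d n) (h : Vector ℤ d) → IntegralHole A h R D →
  (∀ j → NonzeroColumn A j) → DistinctColumns A →
  ∀ i → ∣ h i ∣ ℕ.≤ suc d ℕ.* ((R ℕ.∸ 1) ℕ.* (R ℕ.∸ 1)) ℕ.* D
bound-reduced {d} {n} {R} {D} A h hole nonzero distinct i = begin
  ∣ h i ∣
    ≤⟨ ℕₚ.*-cancelˡ-≤ N {{ℕ.>-nonZero 0<N}} scaled ⟩
  R ℕ.* (m ℕ.* D)
    ≡⟨ ℕₚ.*-assoc R m D ⟨
  R ℕ.* m ℕ.* D
    ≤⟨ ℕₚ.*-monoˡ-≤ D (column-arithmetic d n R d≤n (ColumnCount.2n≤d[R+1] A nonzero distinct noOpposite rows≤R)) ⟩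
  suc d ℕ.* ((R ℕ.∸ 1) ℕ.* (R ℕ.∸ 1)) ℕ.* D ∎
  where
  open IntegralHole hole
  open ℕₚ.≤-Reasoning
  m = n ℕ.∸ d
  d≤n : d ℕ.≤ n
  d≤n = thin⇒≤ (proj₁ (proj₁ (independent⇒minor independent)))
  N = proj₁ (approximate 1)
  L : Vector ℤ n
  L = proj₁ (proj₂ (approximate 1))
  0<N : 0 ℕ.< N
  0<N = proj₁ (proj₂ (proj₂ (approximate 1)))
  AL≡Nh : ∀ i → A i · L ≡ + N * h i
  AL≡Nh = proj₁ (proj₂ (proj₂ (proj₂ (approximate 1))))
  -N<L : ∀ j → - + N < L j
  -N<L j = subst (- + N <_) (ℤₚ.*-identityˡ (L j)) (proj₂ (proj₂ (proj₂ (proj₂ (approximate 1)))) j)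
  K = N ℕ.* (m ℕ.* D)
  L+N≤K : ∀ j → L j + + N ≤ + K
  -- The inequality is proved by refuting its negation, so the doubly negated `upToColumn` is
  -- enough.
  L+N≤K j = ℤₚ.≮⇒≥ λ K<L+N → upToColumn j (nonzero j) λ upTo →
    notInSemigroup (solution-correction A minors≤D independent h N L 0<N AL≡Nh -N<L j upTo K<L+N)
  -- From - N < L and L + N ≤ K it follows that K > 0, so m D ≥ 1. This covers the negative entries
  -- of L, whose absolute value is below N.
  N≤K : ∀ j → N ℕ.≤ K
  N≤K j = ℕₚ.m≤m*n N (m ℕ.* D) {{ℕ.≢-nonZero λ mD≡0 → ℕₚ.n≮0 (ℤₚ.drop‿+<+
    (subst (λ x → 0ℤ < + x) (trans (cong (N ℕ.*_) mD≡0) (ℕₚ.*-zeroʳ N)) 0<K))}}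
    where
    0<K : 0ℤ < + K
    0<K = ℤₚ.<-≤-trans (subst (_< L j + + N) (ℤₚ.+-inverseˡ (+ N)) (ℤₚ.+-monoˡ-< (+ N) (-N<L j))) (L+N≤K j)
  ∣L∣≤K : ∀ j → ∣ L j ∣ ℕ.≤ K
  ∣L∣≤K j with ℤₚ.≤-total 0ℤ (L j)
  ... | inj₁ 0≤L = ℤₚ.drop‿+≤+ (subst (_≤ + K) (sym (ℤₚ.0≤i⇒+∣i∣≡i 0≤L))
          (ℤₚ.≤-trans (ℤₚ.i≤i+j (L j) (+ N)) (L+N≤K j)))
  ... | inj₂ L≤0 = ℕₚ.≤-trans (ℤₚ.drop‿+≤+ (subst₂ _≤_ (sym (i≤0⇒∣i∣≡-i L≤0)) (ℤₚ.neg-involutive (+ N))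
          (ℤₚ.neg-mono-≤ (ℤₚ.<⇒≤ (-N<L j))))) (N≤K j)
  scaled : N ℕ.* ∣ h i ∣ ℕ.≤ N ℕ.* (R ℕ.* (m ℕ.* D))
  scaled = begin
    N ℕ.* ∣ h i ∣                ≡⟨ ℤₚ.abs-* (+ N) (h i) ⟨
    ∣ + N * h i ∣                ≡⟨ cong ∣_∣ (AL≡Nh i) ⟨
    ∣ A i · L ∣                  ≤⟨ ∣·∣≤ (A i) L ∣L∣≤K ⟩
    rowSum A i ℕ.* K             ≤⟨ ℕₚ.*-monoˡ-≤ K (rows≤R i) ⟩
    R ℕ.* K                      ≡⟨ swap R N (m ℕ.* D) ⟩
    N ℕ.* (R ℕ.* (m ℕ.* D))      ∎
    where
    swap : ∀ r n k → r ℕ.* (n ℕ.* k) ≡ n ℕ.* (r ℕ.* k)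
    swap = ℕSolver.solve-∀

-- `IntegralHole` asks R and D only to be upper bounds, so both stay fixed, along with h, while zero
-- and repeated columns are deleted.
bound-integral : ∀ {d n R D} (A : Matrix ℤ d n) (h : Vector ℤ d) → IntegralHole A h R D →
  ∀ i → ∣ h i ∣ ℕ.≤ suc d ℕ.* ((R ℕ.∸ 1) ℕ.* (R ℕ.∸ 1)) ℕ.* D
bound-integral {n = zero} A h hole = bound-reduced A h hole (λ ()) (λ ())
bound-integral {n = suc n} A h hole
  with Finₚ.any? (λ c → Finₚ.all? (λ i → A i c ℤₚ.≟ 0ℤ))
... | yes (c , Ac≡0) = bound-integral (deleteColumn A c) h (DeleteColumn.delete A c (λ _ → 0ℤ) (λ _ → inj₁ refl)
        (λ i → trans (Ac≡0 i) (sym (sum-zero λ k → ℤₚ.*-zeroʳ (A i (punchIn c k))))) hole)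
... | no noZero with Finₚ.any? (λ c → Finₚ.any? (λ k → Finₚ.all? (λ i → A i c ℤₚ.≟ A i (punchIn c k))))
...   | yes (c , k , Ac≡) = bound-integral (deleteColumn A c) h (DeleteColumn.delete A c (unit k) (unit∈01 k)
        (λ i → trans (Ac≡ i) (sym (·-unit (deleteColumn A c i) k))) hole)
...   | no noRepeat = bound-reduced A h hole
        (λ j → Finₚ.¬∀⟶∃¬ _ (λ i → A i j ≡ 0ℤ) (λ i → A i j ℤₚ.≟ 0ℤ) λ Aj≡0 → noZero (j , Aj≡0))
        (λ j k Aj≡Ak → decidable-stable (j Finₚ.≟ k) λ j≢k →
          noRepeat (j , punchOut j≢k , λ i → trans (Aj≡Ak i) (cong (A i) (sym (Finₚ.punchIn-punchOut j≢k)))))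

-- The embedding of the integers in the rationals

ι : ℤ → ℚ
ι z = z ℚ./ 1

-- `z ℚ./ 1` is normalised by a gcd and does not reduce for a variable z; in the form with
-- denominator 1 the operations compute.
ι≡mkℚ : ∀ z → ι z ≡ mkℚ z 0 (Coprimality.sym (Coprimality.1-coprimeTo ∣ z ∣))
ι≡mkℚ z = ℚₚ.↥p/↧p≡p (mkℚ z 0 (Coprimality.sym (Coprimality.1-coprimeTo ∣ z ∣)))

ι-+ : ∀ a b → ι (a + b) ≡ ι a ℚ.+ ι b
ι-+ a b = trans (cong ι (cong₂ _+_ (sym (ℤₚ.*-identityʳ a)) (sym (ℤₚ.*-identityʳ b))))
  (sym (cong₂ ℚ._+_ (ι≡mkℚ a) (ι≡mkℚ b)))

ι-* : ∀ a b → ι (a * b) ≡ ι a ℚ.* ι b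
ι-* a b = sym (cong₂ ℚ._*_ (ι≡mkℚ a) (ι≡mkℚ b))

ι-neg : ∀ a → ι (- a) ≡ ℚ.- ι a
ι-neg a = trans (cong ι (sym (ℤₚ.-1*i≡-i a))) (trans (ι-* -1ℤ a) (trans (sym (ℚₚ.neg-distribˡ-* 1ℚ (ι a)))
  (cong ℚ.-_ (ℚₚ.*-identityˡ (ι a)))))

ι-minus : ∀ a b → ι (a - b) ≡ ι a ℚ.- ι b
ι-minus a b = trans (ι-+ a (- b)) (cong (λ q → ι a ℚ.+ q) (ι-neg b))

ι-mono-≤ : ∀ {a b} → a ≤ b → ι a ℚ.≤ ι b
ι-mono-≤ {a} {b} a≤b = subst₂ ℚ._≤_ (sym (ι≡mkℚ a)) (sym (ι≡mkℚ b))
  (ℚ.*≤* (subst₂ _≤_ (sym (ℤₚ.*-identityʳ a)) (sym (ℤₚ.*-identityʳ b)) a≤b))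

ι-mono-< : ∀ {a b} → a < b → ι a ℚ.< ι b
ι-mono-< {a} {b} a<b = subst₂ ℚ._<_ (sym (ι≡mkℚ a)) (sym (ι≡mkℚ b))
  (ℚ.*<* (subst₂ _<_ (sym (ℤₚ.*-identityʳ a)) (sym (ℤₚ.*-identityʳ b)) a<b))

ι-cancel-≤ : ∀ {a b} → ι a ℚ.≤ ι b → a ≤ b
ι-cancel-≤ ιa≤ιb = ℤₚ.≮⇒≥ λ b<a → ℚₚ.<-irrefl refl (ℚₚ.<-≤-trans (ι-mono-< b<a) ιa≤ιb)

ι-cancel-< : ∀ {a b} → ι a ℚ.< ι b → a < b
ι-cancel-< ιa<ιb = ℤₚ.≰⇒> λ b≤a → ℚₚ.<-irrefl refl (ℚₚ.<-≤-trans ιa<ιb (ι-mono-≤ b≤a))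

ι-∣∣ : ∀ a → ℚ.∣ ι a ∣ ≡ ι (+ ∣ a ∣)
ι-∣∣ a = trans (cong ℚ.∣_∣ (ι≡mkℚ a)) (sym (ι≡mkℚ (+ ∣ a ∣)))

ι-· : ∀ {n} (v w : Vector ℤ n) → sumℚ (λ j → ι (v j) ℚ.* ι (w j)) ≡ ι (v · w)
ι-· {zero}  v w = refl
ι-· {suc n} v w = trans (cong₂ ℚ._+_ (sym (ι-* (v zero) (w zero))) (ι-· (tail v) (tail w)))
  (sym (ι-+ (v zero * w zero) (tail v · tail w)))

0<ι : ∀ {N} → 0 ℕ.< N → 0ℚ ℚ.< ι (+ N)
0<ι 0<N = ι-mono-< (ℤ.+<+ 0<N)

*-denominator : ∀ q → q ℚ.* ι (ℚ.↧ q) ≡ ι (ℚ.↥ q)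
*-denominator q@(mkℚ n d _) = ℚₚ.toℚᵘ-injective (begin
  ℚ.toℚᵘ (q ℚ.* ι (+ suc d))                     ≈⟨ ℚₚ.toℚᵘ-homo-* q (ι (+ suc d)) ⟩
  ℚ.toℚᵘ q ℚᵘ.* ℚ.toℚᵘ (ι (+ suc d))             ≈⟨ ℚᵘₚ.*-congˡ {ℚ.toℚᵘ q} (ℚₚ.toℚᵘ-fromℚᵘ (ℚᵘ.mkℚᵘ (+ suc d) 0)) ⟩
  ℚᵘ.mkℚᵘ n d ℚᵘ.* ℚᵘ.mkℚᵘ (+ suc d) 0           ≈⟨ ℚᵘ.*≡* (trans (ℤₚ.*-identityʳ (n * + suc d)) (cong (λ k → n * + k) (sym (ℕₚ.*-identityʳ (suc d))))) ⟩
  ℚᵘ.mkℚᵘ n 0                                    ≈⟨ ℚₚ.toℚᵘ-fromℚᵘ (ℚᵘ.mkℚᵘ n 0) ⟨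
  ℚ.toℚᵘ (ι n)                                   ∎)
  where open ℚᵘₚ.≃-Reasoning

clearDenominators : ∀ {n} (q : Vector ℚ n) →
  ∃ λ N → ∃ λ (L : Vector ℤ n) → 0 ℕ.< N × (∀ j → q j ℚ.* ι (+ N) ≡ ι (L j))
clearDenominators {zero}  q = 1 , (λ ()) , ℕ.s≤s ℕ.z≤n , λ ()
clearDenominators {suc n} q with clearDenominators (tail q)
... | N , L , 0<N , eqs = M ℕ.* N , (ℚ.↥ q zero * + N) ∷ (λ j → L j * + M) , ℕₚ.*-mono-< {0} {M} {0} {N} (ℕ.s≤s ℕ.z≤n) 0<N ,
  λ { zero    → trans (scale-by (q zero) M N) (trans (cong (ℚ._* ι (+ N)) (*-denominator (q zero))) (sym (ι-* (ℚ.↥ q zero) (+ N))))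
    ; (suc j) → trans (cong (λ k → q (suc j) ℚ.* ι (+ k)) (ℕₚ.*-comm M N))
                  (trans (scale-by (q (suc j)) N M) (trans (cong (ℚ._* ι (+ M)) (eqs j)) (sym (ι-* (L j) (+ M))))) }
  where
  M = ℚ.↧ₙ q zero
  scale-by : ∀ p a b → p ℚ.* ι (+ (a ℕ.* b)) ≡ p ℚ.* ι (+ a) ℚ.* ι (+ b)
  scale-by p a b = trans (cong (λ z → p ℚ.* z) (trans (cong ι (ℤₚ.pos-* a b)) (ι-* (+ a) (+ b)))) (sym (ℚₚ.*-assoc p (ι (+ a)) (ι (+ b))))

-- From approximate to exact solutions

-- What membership in the real cone reveals at a single late index of the Cauchy sequences.
NearSolution : ∀ {d n} → Matrix ℤ d n → Vector ℤ d → ℚ → Set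
NearSolution {n = n} A h ε = ∃ λ (q : Vector ℚ n) →
  (∀ i → ℚ.∣ ι (h i) ℚ.- sumℚ (λ j → ι (A i j) ℚ.* q j) ∣ ℚ.≤ ε) × (∀ j → 0ℚ ℚ.≤ q j ℚ.+ ε)

-- A near solution q = L / N with ε = 1 / G, all inequalities multiplied by G N.
IntegralNearSolution : ∀ {d n} → Matrix ℤ d n → Vector ℤ d → ℕ → Set
IntegralNearSolution {n = n} A h G = ∃ λ N → ∃ λ (L : Vector ℤ n) →
  0 ℕ.< N × (∀ i → ∣ + G * (+ N * h i - A i · L) ∣ ℕ.≤ N) × (∀ j → - + N ≤ + G * L j)

integralNearSolution : ∀ {d n} (A : Matrix ℤ d n) (h : Vector ℤ d) G ε → 0 ℕ.< G → ι (+ G) ℚ.* ε ≡ 1ℚ →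
  NearSolution A h ε → IntegralNearSolution A h G
integralNearSolution A h G ε 0<G Gε≡1 (q , near , 0≤q+ε) with clearDenominators q
... | N , L , 0<N , qN≡L = N , L , 0<N , bounded , lower
  where
  open ℚₚ.≤-Reasoning
  open +-*-Solver using (solve; _:+_; _:*_; _:-_; _:=_)
  g = ι (+ G)
  m = ι (+ N)
  0≤gm : 0ℚ ℚ.≤ g ℚ.* m
  0≤gm = ℚₚ.≤-trans (ι-mono-≤ {+ 0} {+ G * + N} (nonNeg*nonNeg {+ G} (ℤ.+≤+ ℕ.z≤n) (ℤ.+≤+ ℕ.z≤n))) (ℚₚ.≤-reflexive (ι-* (+ G) (+ N)))
  gmε≡m : g ℚ.* m ℚ.* ε ≡ m
  gmε≡m = trans (solve 3 (λ g m e → g :* m :* e := g :* e :* m) refl g m ε) (trans (cong (ℚ._* m) Gε≡1) (ℚₚ.*-identityˡ m))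
  scaledSum : ∀ i → sumℚ (λ j → ι (A i j) ℚ.* q j) ℚ.* m ≡ ι (A i · L)
  scaledSum i = trans (*-distribʳ-sumℚ m (λ j → ι (A i j) ℚ.* q j))
    (trans (sumℚ-cong-≗ λ j → trans (ℚₚ.*-assoc (ι (A i j)) (q j) m) (cong (λ z → ι (A i j) ℚ.* z) (qN≡L j))) (ι-· (A i) L))
  bounded : ∀ i → ∣ + G * (+ N * h i - A i · L) ∣ ℕ.≤ N
  bounded i = ℤₚ.drop‿+≤+ (ι-cancel-≤ (begin
    ι (+ ∣ + G * (+ N * h i - A i · L) ∣)       ≡⟨ ι-∣∣ (+ G * (+ N * h i - A i · L)) ⟨
    ℚ.∣ ι (+ G * (+ N * h i - A i · L)) ∣       ≡⟨ cong ℚ.∣_∣ expand ⟩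
    ℚ.∣ g ℚ.* m ℚ.* r ∣                         ≡⟨ ℚₚ.∣p*q∣≡∣p∣*∣q∣ (g ℚ.* m) r ⟩
    ℚ.∣ g ℚ.* m ∣ ℚ.* ℚ.∣ r ∣                   ≡⟨ cong (ℚ._* ℚ.∣ r ∣) (ℚₚ.0≤p⇒∣p∣≡p 0≤gm) ⟩
    g ℚ.* m ℚ.* ℚ.∣ r ∣                         ≤⟨ ℚₚ.*-monoˡ-≤-nonNeg (g ℚ.* m) {{ℚ.nonNegative 0≤gm}} (near i) ⟩
    g ℚ.* m ℚ.* ε                               ≡⟨ gmε≡m ⟩
    m                                           ∎))
    where
    s = sumℚ (λ j → ι (A i j) ℚ.* q j)
    r = ι (h i) ℚ.- s
    expand : ι (+ G * (+ N * h i - A i · L)) ≡ g ℚ.* m ℚ.* r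
    expand = trans (ι-* (+ G) (+ N * h i - A i · L)) (trans (cong (λ z → g ℚ.* z)
      (trans (ι-minus (+ N * h i) (A i · L)) (cong₂ ℚ._-_ (ι-* (+ N) (h i)) (sym (scaledSum i)))))
      (solve 4 (λ g m h s → g :* (m :* h :- s :* m) := g :* m :* (h :- s)) refl g m (ι (h i)) s))
  lower : ∀ j → - + N ≤ + G * L j
  lower j = ι-cancel-≤ (begin
    ι (- + N)                                       ≡⟨ ι-neg (+ N) ⟩
    ℚ.- m                                           ≡⟨ ℚₚ.+-identityˡ (ℚ.- m) ⟨
    0ℚ ℚ.- m                                        ≡⟨ cong (ℚ._- m) (ℚₚ.*-zeroʳ (g ℚ.* m)) ⟨
    g ℚ.* m ℚ.* 0ℚ ℚ.- m                            ≤⟨ ℚₚ.+-monoˡ-≤ (ℚ.- m) (ℚₚ.*-monoˡ-≤-nonNeg (g ℚ.* m) {{ℚ.nonNegative 0≤gm}} (0≤q+ε j)) ⟩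
    g ℚ.* m ℚ.* (q j ℚ.+ ε) ℚ.- m                   ≡⟨ cong (ℚ._- m) (ℚₚ.*-distribˡ-+ (g ℚ.* m) (q j) ε) ⟩
    (g ℚ.* m ℚ.* q j ℚ.+ g ℚ.* m ℚ.* ε) ℚ.- m       ≡⟨ cong (λ z → (g ℚ.* m ℚ.* q j ℚ.+ z) ℚ.- m) gmε≡m ⟩
    (g ℚ.* m ℚ.* q j ℚ.+ m) ℚ.- m                   ≡⟨ solve 3 (λ g m q → (g :* m :* q :+ m) :- m := g :* (q :* m)) refl g m (q j) ⟩
    g ℚ.* (q j ℚ.* m)                               ≡⟨ cong (λ z → g ℚ.* z) (qN≡L j) ⟩
    g ℚ.* ι (L j)                                   ≡⟨ ι-* (+ G) (L j) ⟨
    ι (+ G * L j)                                   ∎)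

+∣i∣*∣i∣≡i*i : ∀ i → + (∣ i ∣ ℕ.* ∣ i ∣) ≡ i * i
+∣i∣*∣i∣≡i*i i = trans (ℤₚ.pos-* ∣ i ∣ ∣ i ∣) (square (ℤₚ.+∣i∣≡i⊎+∣i∣≡-i i))
  where
  neg² : ∀ i → - i * - i ≡ i * i
  neg² = solve-∀
  square : + ∣ i ∣ ≡ i ⊎ + ∣ i ∣ ≡ - i → + ∣ i ∣ * + ∣ i ∣ ≡ i * i
  square (inj₁ eq) = cong₂ _*_ eq eq
  square (inj₂ eq) = trans (cong₂ _*_ eq eq) (neg² i)

-∣i∣≤i : ∀ i → - + ∣ i ∣ ≤ i
-∣i∣≤i (+ m)    = ℤₚ.neg-≤-pos
-∣i∣≤i -[1+ m ] = ℤₚ.≤-refl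

-- A right inverse of A turns the residue of a near solution into a small correction.
module Correction {d n} (A : Matrix ℤ d n) (inv : RightInverse A) (h : Vector ℤ d) (P : ℕ) where
  open RightInverse inv renaming (scale to δ; scale≢0 to δ≢0; inverse to W; isInverse to AW≡δ)

  weight : ℕ
  weight = sumₙ λ j → sumₙ λ i → ∣ W i j ∣

  -- The precision needed: in units of the new denominator, the slack of L costs P, the correction
  -- at most P times `weight`, and the added 1 makes the final inequality strict.
  G : ℕ
  G = suc (P ℕ.+ P ℕ.* weight)

  correct : IntegralNearSolution A h G → ∃ λ N → ∃ λ (L : Vector ℤ n) →
    0 ℕ.< N × (∀ i → A i · L ≡ + N * h i) × (∀ j → - + N < + P * L j)
  correct (N , L , 0<N , near , lower) = ∣ δ ∣ ℕ.* ∣ δ ∣ ℕ.* N , L′ , ℕₚ.*-mono-< {0} {e²} {0} {N} 0<e² 0<N , exact , lower′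
    where
    e e² : ℕ
    e = ∣ δ ∣
    e² = e ℕ.* e
    0<e : 0 ℕ.< e
    0<e = ≢0⇒∣∣>0 δ≢0
    0<e² : 0 ℕ.< e²
    0<e² = ℕₚ.*-mono-< {0} {e} {0} {e} 0<e 0<e
    E : Vector ℤ d
    E i = + N * h i - A i · L
    correction : Vector ℤ n
    correction j = (λ i → W i j) · E
    L′ : Vector ℤ n
    -- A maps the correction to δ E. A further factor δ turns this into δ² E, so the new denominator
    -- e² N is positive whatever the sign of δ.
    L′ j = + e² * L j + δ * correction j
    A·correction : ∀ r → A r · correction ≡ δ * E r
    A·correction r = begin
      A r · correction
        ≡⟨ ·-congʳ (A r) (λ j → ·-comm (λ i → W i j) E) ⟩
      A r · (λ j → E · (λ i → W i j))
        ≡⟨ ·-comm (A r) (λ j → E · (λ i → W i j)) ⟩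
      (λ j → E · (λ i → W i j)) · A r
        ≡⟨ ·-transpose W E (A r) ⟨
      E · (λ i → W i · A r)
        ≡⟨ ·-congʳ E (λ i → trans (·-comm (W i) (A r)) (trans (AW≡δ r i) (cong (δ *_) (unit-sym i r)))) ⟩
      E · (λ i → δ * unit r i)
        ≡⟨ ·-congʳ E (λ i → pad δ (unit r i)) ⟩
      E · (λ i → δ * unit r i + 0ℤ * unit r i)
        ≡⟨ ·-linearʳ E δ (unit r) 0ℤ (unit r) ⟩
      δ * (E · unit r) + 0ℤ * (E · unit r)
        ≡⟨ pad δ (E · unit r) ⟨
      δ * (E · unit r)
        ≡⟨ cong (δ *_) (·-unit E r) ⟩
      δ * E r ∎
      where
      open ≡-Reasoning
      pad : ∀ d u → d * u ≡ d * u + 0ℤ * u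
      pad = solve-∀
    exact : ∀ i → A i · L′ ≡ + (e² ℕ.* N) * h i
    exact i = begin
      A i · L′
        ≡⟨ ·-linearʳ (A i) (+ e²) L δ correction ⟩
      + e² * (A i · L) + δ * (A i · correction)
        ≡⟨ cong₂ (λ x y → x * (A i · L) + δ * y) (+∣i∣*∣i∣≡i*i δ) (A·correction i) ⟩
      δ * δ * (A i · L) + δ * (δ * (+ N * h i - A i · L))
        ≡⟨ cancel δ (A i · L) (+ N) (h i) ⟩
      δ * δ * + N * h i
        ≡⟨ cong (λ x → x * + N * h i) (+∣i∣*∣i∣≡i*i δ) ⟨
      + e² * + N * h i
        ≡⟨ cong (_* h i) (ℤₚ.pos-* e² N) ⟨
      + (e² ℕ.* N) * h i ∎
      where
      open ≡-Reasoning
      cancel : ∀ d a n h → d * d * a + d * (d * (n * h - a)) ≡ d * d * n * h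
      cancel = solve-∀
    column≤weight : ∀ j → sumₙ (λ i → ∣ W i j ∣) ℕ.≤ weight
    column≤weight j = term≤sumₙ (λ j → sumₙ λ i → ∣ W i j ∣) j
    small : ∀ j → ∣ (λ i → W i j) · (λ i → + G * E i) ∣ ℕ.≤ weight ℕ.* N
    small j = ℕₚ.≤-trans (∣·∣≤ (λ i → W i j) (λ i → + G * E i) near) (ℕₚ.*-monoˡ-≤ N (column≤weight j))
    G*correction : ∀ j → + G * correction j ≡ (λ i → W i j) · (λ i → + G * E i)
    G*correction j = trans (*-distribˡ-sum (+ G) (λ i → W i j * E i)) (sum-cong-≗ λ i → swap (+ G) (W i j) (E i))
      where
      swap : ∀ g w x → g * (w * x) ≡ w * (g * x)
      swap = solve-∀
    budget : P ℕ.* (e² ℕ.* N) ℕ.+ P ℕ.* (e ℕ.* (weight ℕ.* N)) ℕ.< G ℕ.* (e² ℕ.* N)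
    budget = begin-strict
      P ℕ.* (e² ℕ.* N) ℕ.+ P ℕ.* (e ℕ.* (weight ℕ.* N))
        ≤⟨ ℕₚ.+-monoʳ-≤ (P ℕ.* (e² ℕ.* N)) (ℕₚ.*-monoʳ-≤ P (ℕₚ.*-monoˡ-≤ (weight ℕ.* N) (ℕₚ.m≤m*n e e {{ℕ.>-nonZero 0<e}}))) ⟩
      P ℕ.* (e² ℕ.* N) ℕ.+ P ℕ.* (e² ℕ.* (weight ℕ.* N))
        ≡⟨ collect P e² N weight ⟩
      (P ℕ.+ P ℕ.* weight) ℕ.* (e² ℕ.* N)
        <⟨ ℕₚ.m<n+m ((P ℕ.+ P ℕ.* weight) ℕ.* (e² ℕ.* N)) (ℕₚ.*-mono-< {0} {e²} {0} {N} 0<e² 0<N) ⟩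
      G ℕ.* (e² ℕ.* N) ∎
      where
      open ℕₚ.≤-Reasoning
      collect : ∀ P s N w → P ℕ.* (s ℕ.* N) ℕ.+ P ℕ.* (s ℕ.* (w ℕ.* N)) ≡ (P ℕ.+ P ℕ.* w) ℕ.* (s ℕ.* N)
      collect = ℕSolver.solve-∀
    lower′ : ∀ j → - + (e² ℕ.* N) < + P * L′ j
    lower′ j = ℤₚ.*-cancelˡ-<-nonNeg (+ G) (begin-strict
      + G * - + (e² ℕ.* N)
        ≡⟨ trans (sym (ℤₚ.neg-distribʳ-* (+ G) (+ (e² ℕ.* N)))) (cong -_ (sym (ℤₚ.pos-* G (e² ℕ.* N)))) ⟩
      - + (G ℕ.* (e² ℕ.* N))
        <⟨ ℤₚ.neg-mono-< (ℤ.+<+ budget) ⟩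
      - + (P ℕ.* (e² ℕ.* N) ℕ.+ P ℕ.* (e ℕ.* (weight ℕ.* N)))
        ≡⟨ trans (cong -_ (ℤₚ.pos-+ (P ℕ.* (e² ℕ.* N)) _)) (ℤₚ.neg-distrib-+ (+ (P ℕ.* (e² ℕ.* N))) _) ⟩
      - + (P ℕ.* (e² ℕ.* N)) + - + (P ℕ.* (e ℕ.* (weight ℕ.* N)))
        ≤⟨ ℤₚ.+-mono-≤ main residue ⟩
      + P * (+ e² * (+ G * L j)) + + P * (δ * V)
        ≡⟨ cong (λ x → + P * (+ e² * (+ G * L j)) + + P * (δ * x)) (G*correction j) ⟨
      + P * (+ e² * (+ G * L j)) + + P * (δ * (+ G * correction j))
        ≡⟨ factor (+ P) (+ e²) (+ G) (L j) δ (correction j) ⟩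
      + G * (+ P * L′ j) ∎)
      where
      open ℤₚ.≤-Reasoning
      V = (λ i → W i j) · (λ i → + G * E i)
      factor : ∀ p s g l d c → p * (s * (g * l)) + p * (d * (g * c)) ≡ g * (p * (s * l + d * c))
      factor = solve-∀
      main : - + (P ℕ.* (e² ℕ.* N)) ≤ + P * (+ e² * (+ G * L j))
      main = ℤₚ.≤-trans (ℤₚ.≤-reflexive (trans (cong -_ (trans (ℤₚ.pos-* P _) (cong (+ P *_) (ℤₚ.pos-* e² N)))) (pull (+ P) (+ e²) (+ N))))
        (ℤₚ.*-monoˡ-≤-nonNeg (+ P) (ℤₚ.*-monoˡ-≤-nonNeg (+ e²) (lower j)))
        where
        pull : ∀ p s n → - (p * (s * n)) ≡ p * (s * - n)
        pull = solve-∀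
      residue : - + (P ℕ.* (e ℕ.* (weight ℕ.* N))) ≤ + P * (δ * V)
      residue = ℤₚ.≤-trans (ℤₚ.neg-mono-≤ (ℤ.+≤+ (ℕₚ.≤-trans (ℕₚ.≤-reflexive (trans (ℤₚ.abs-* (+ P) (δ * V)) (cong (P ℕ.*_) (ℤₚ.abs-* δ V))))
        (ℕₚ.*-monoʳ-≤ P (ℕₚ.*-monoʳ-≤ e (small j)))))) (-∣i∣≤i (+ P * (δ * V)))

-- Real data

Close : (ℕ → ℚ) → (ℕ → ℚ) → Set
Close p q = ∀ ε → 0ℚ ℚ.< ε → ∃ λ N → ∀ k → N ℕ.≤ k → ℚ.∣ p k ℚ.- q k ∣ ℚ.< ε

Close-≗ : ∀ {p q} → p ≗ q → Close p q
Close-≗ {p} {q} p≗q ε 0<ε = 0 , λ k _ → subst (ℚ._< ε) (sym (cong ℚ.∣_∣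
  (trans (cong (ℚ._- q k) (p≗q k)) (ℚₚ.+-inverseʳ (q k))))) 0<ε

Close-respʳ : ∀ p {q r} → q ≗ r → Close p q → Close p r
Close-respʳ p q≗r close ε 0<ε with close ε 0<ε
... | N , near = N , λ k N≤k → subst (λ z → ℚ.∣ p k ℚ.- z ∣ ℚ.< ε) (q≗r k) (near k N≤k)

-- Stated over an abstract ring, since over ℝ conversion checking would unfold the Cauchy moduli.
module Observation (R : RawRing 0ℓ 0ℓ)
  (φ : RawRing.Carrier R → ℕ → ℚ)
  (φ-0 : ∀ k → φ (RawRing.0# R) k ≡ 0ℚ)
  (φ-+ : ∀ x y k → φ (RawRing._+_ R x y) k ≡ φ x k ℚ.+ φ y k)
  (φ-* : ∀ x y k → φ (RawRing._*_ R x y) k ≡ φ x k ℚ.* φ y k)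
  (≈⇒Close : ∀ x y → RawRing._≈_ R x y → Close (φ x) (φ y))
  (Close⇒≈ : ∀ x y → Close (φ x) (φ y) → RawRing._≈_ R x y) where

  open RawRing R using (Carrier) renaming (_≈_ to _≈′_; _*_ to _*′_; 0# to 0′; +-rawMonoid to +′-rawMonoid)
  open LinearAlgebra R
  open RawMonoidDefs +′-rawMonoid using () renaming (sum to sum′)

  observe-sum : ∀ {n} (x : Vector Carrier n) k → φ (sum′ x) k ≡ sumℚ (λ j → φ (x j) k)
  observe-sum {zero}  x k = φ-0 k
  observe-sum {suc n} x k = trans (φ-+ (x zero) (sum′ (tail x)) k) (cong (λ q → φ (x zero) k ℚ.+ q) (observe-sum (tail x) k))

  observe-*ᵥ : ∀ {d n} (M : Matrix Carrier d n) c i k → φ ((M *ᵥ c) i) k ≡ sumℚ (λ j → φ (M i j) k ℚ.* φ (c j) k)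
  observe-*ᵥ M c i k = trans (observe-sum (λ j → M i j *′ c j) k) (sumℚ-cong-≗ λ j → φ-* (M i j) (c j) k)

  observe-solution : ∀ {d n} (M : Matrix Carrier d n) c x → x ≈ᵥ M *ᵥ c →
    ∀ i → Close (φ (x i)) (λ k → sumℚ (λ j → φ (M i j) k ℚ.* φ (c j) k))
  observe-solution M c x x≈Mc i = Close-respʳ (φ (x i)) (observe-*ᵥ M c i) (≈⇒Close (x i) ((M *ᵥ c) i) (x≈Mc i))

  reflect-solution : ∀ {d n} (M : Matrix Carrier d n) c x →
    (∀ i → Close (φ (x i)) (λ k → sumℚ (λ j → φ (M i j) k ℚ.* φ (c j) k))) → x ≈ᵥ M *ᵥ c
  reflect-solution M c x close i = Close⇒≈ (x i) ((M *ᵥ c) i) (Close-respʳ (φ (x i)) (λ k → sym (observe-*ᵥ M c i k)) (close i))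

  observe-independent : ∀ {d n} (M : Matrix Carrier d n) → LinearlyIndependentRows M →
    ∀ y → (∀ j k → sumℚ (λ i → φ (M i j) k ℚ.* φ (y i) k) ≡ 0ℚ) → ∀ i → y i ≈′ 0′
  observe-independent M indep y eq = indep y λ j → Close⇒≈ ((transpose M *ᵥ y) j) 0′ (Close-≗ λ k →
    trans (observe-*ᵥ (transpose M) y j k) (trans (eq j k) (sym (φ-0 k))))

open Observation ℝ-rawRing seq (λ k → refl) (λ x y k → refl) (λ x y k → refl) (λ x y x≈y → x≈y) (λ x y close → close)

fromℤ≈0⇒≡0 : ∀ z → fromℤ z ≈ℝ 0ℝ → z ≡ 0ℤ
fromℤ≈0⇒≡0 z z≈0 with z≈0 1ℚ (ℚₚ.positive⁻¹ 1ℚ)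
... | N , near = ℤₚ.∣i∣≡0⇒i≡0 (ℕₚ.n<1⇒n≡0 (ℤₚ.drop‿+<+ (ι-cancel-< {+ ∣ z ∣} {1ℤ}
  (subst (ℚ._< 1ℚ) (trans (cong ℚ.∣_∣ (ℚₚ.+-identityʳ (ι z))) (ι-∣∣ z)) (near N ℕₚ.≤-refl)))))

fullRowRank⇒independent : ∀ {d n} (A : Matrix ℤ d n) → FullRowRank A → IndependentRows A
fullRowRank⇒independent A full y yA≡0 i = fromℤ≈0⇒≡0 (y i) (observe-independent (matℝ A) full (vecℝ y)
  (λ j k → trans (ι-· (transpose A j) y) (cong ι (trans (·-comm (transpose A j) y) (yA≡0 j)))) i)

eventually-all : ∀ {n} {P : Fin n → ℕ → Set} → (∀ j → ∃ λ N → ∀ k → N ℕ.≤ k → P j k) →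
  ∃ λ N → ∀ k → N ℕ.≤ k → ∀ j → P j k
eventually-all {zero}  ev = 0 , λ _ _ ()
eventually-all {suc n} ev with ev zero | eventually-all (ev ∘ suc)
... | M , p | N , ps = M ℕ.⊔ N , λ k M⊔N≤k →
  λ { zero → p k (ℕₚ.m⊔n≤o⇒m≤o M N M⊔N≤k) ; (suc j) → ps k (ℕₚ.m⊔n≤o⇒n≤o M N M⊔N≤k) j }

-- Only finitely many limits are involved, so one late index serves all equations and all sign
-- conditions.
cone⇒nearSolution : ∀ {d n} (A : Matrix ℤ d n) h → vecℝ h ∈ cone A → ∀ ε → 0ℚ ℚ.< ε → NearSolution A h ε
cone⇒nearSolution A h (c , 0≤c , h≈Ac) ε 0<ε =
  let M , near   = eventually-all (λ i → observe-solution (matℝ A) c (vecℝ h) h≈Ac i ε 0<ε)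
      N , nonNeg = eventually-all (λ j → 0≤c j ε 0<ε)
      k = M ℕ.⊔ N
  in (λ j → seq (c j) k) ,
     (λ i → ℚₚ.<⇒≤ (near k (ℕₚ.m≤m⊔n M N) i)) ,
     (λ j → ℚₚ.<⇒≤ (nonNeg k (ℕₚ.m≤n⊔m M N) j))

reciprocal : ∀ G → 0 ℕ.< G → ∃ λ ε → 0ℚ ℚ.< ε × ι (+ G) ℚ.* ε ≡ 1ℚ
reciprocal G 0<G = ε , ℚₚ.positive⁻¹ ε {{ℚₚ.1/pos⇒pos g}} , ℚₚ.*-inverseʳ g
  where
  g = ι (+ G)
  instance
    g-positive : ℚ.Positive g
    g-positive = ℚ.positive (0<ι {G} 0<G)
    g-nonZero : ℚ.NonZero g
    g-nonZero = ℚₚ.pos⇒nonZero g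
  ε : ℚ
  ε = ℚ.1/ g

cone⇒integralNearSolution : ∀ {d n} (A : Matrix ℤ d n) h → vecℝ h ∈ cone A → ∀ G → 0 ℕ.< G → IntegralNearSolution A h G
cone⇒integralNearSolution A h h∈cone G 0<G =
  let ε , 0<ε , Gε≡1 = reciprocal G 0<G
  in integralNearSolution A h G ε 0<G Gε≡1 (cone⇒nearSolution A h h∈cone ε 0<ε)

cone⇒approximate : ∀ {d n} (A : Matrix ℤ d n) h → RightInverse A → vecℝ h ∈ cone A → ApproximateSolutions A h
cone⇒approximate A h inv h∈cone P = correct (cone⇒integralNearSolution A h h∈cone G (ℕ.s≤s ℕ.z≤n))
  where open Correction A inv h P using (G; correct)

-- Translates of a hole along a column, and finiteness of the holes

0≤unit : ∀ {n} (i j : Fin n) → 0ℤ ≤ unit i j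
0≤unit i j with unit∈01 i j
... | inj₁ eq = ℤₚ.≤-reflexive (sym eq)
... | inj₂ eq = subst (0ℤ ≤_) (sym eq) (ℤ.+≤+ ℕ.z≤n)

unit-off : ∀ {n} {i j : Fin n} → j ≢ i → unit i j ≡ 0ℤ
unit-off {i = zero}  {zero}  j≢i = contradiction refl j≢i
unit-off {i = zero}  {suc j} j≢i = refl
unit-off {i = suc i} {zero}  j≢i = refl
unit-off {i = suc i} {suc j} j≢i = unit-off (j≢i ∘ cong suc)

sumℚ-combination : ∀ {n} (a x y : Vector ℚ n) → sumℚ (λ j → a j ℚ.* (x j ℚ.+ y j)) ≡ sumℚ (λ j → a j ℚ.* x j) ℚ.+ sumℚ (λ j → a j ℚ.* y j)
sumℚ-combination a x y = trans (sumℚ-cong-≗ λ j → ℚₚ.*-distribˡ-+ (a j) (x j) (y j))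
  (∑ℚ-distrib-+ (λ j → a j ℚ.* x j) (λ j → a j ℚ.* y j))

sumℚ-scale : ∀ {n} b (a x : Vector ℚ n) → sumℚ (λ j → a j ℚ.* (b ℚ.* x j)) ≡ b ℚ.* sumℚ (λ j → a j ℚ.* x j)
sumℚ-scale b a x = trans (sumℚ-cong-≗ λ j → solve 3 (λ a b x → a :* (b :* x) := b :* (a :* x)) refl (a j) b (x j))
  (sym (*-distribˡ-sumℚ b (λ j → a j ℚ.* x j)))
  where open +-*-Solver using (solve; _:*_; _:=_)

addMultiple : ∀ {d n} → Matrix ℤ d n → Vector ℤ d → ℕ → Fin n → Vector ℤ d
addMultiple A h k j i = h i + + k * A i j

-- Adding k to the j-th coefficient changes both sides of the equation by the same rational
-- constant, so their difference is unchanged at every index.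
cone-addMultiple : ∀ {d n} (A : Matrix ℤ d n) h k j → vecℝ h ∈ cone A → vecℝ (addMultiple A h k j) ∈ cone A
cone-addMultiple A h k j (c , 0≤c , h≈Ac) = c′ , 0≤c′ , reflect-solution (matℝ A) c′ (vecℝ (addMultiple A h k j)) h′≈Ac′
  where
  c′ : Vector ℝ _
  c′ l = c l +ℝ fromℤ (+ k * unit j l)
  0≤c′ : ∀ l → 0ℝ ≤ℝ c′ l
  0≤c′ l ε 0<ε = let N , 0<c+ε = 0≤c l ε 0<ε in N , λ m N≤m → ℚₚ.<-≤-trans (0<c+ε m N≤m) (ℚₚ.+-monoˡ-≤ ε
    (subst (ℚ._≤ seq (c l) m ℚ.+ ι (+ k * unit j l)) (ℚₚ.+-identityʳ (seq (c l) m))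
      (ℚₚ.+-monoʳ-≤ (seq (c l) m) (ι-mono-≤ {0ℤ} (nonNeg*nonNeg {+ k} (ℤ.+≤+ ℕ.z≤n) (0≤unit j l))))))
  h′≈Ac′ : ∀ i → Close (λ _ → ι (addMultiple A h k j i)) (λ m → sumℚ (λ l → ι (A i l) ℚ.* seq (c′ l) m))
  h′≈Ac′ i ε 0<ε = let N , near = observe-solution (matℝ A) c (vecℝ h) h≈Ac i ε 0<ε in N , λ m N≤m → subst (λ q → ℚ.∣ q ∣ ℚ.< ε) (sym (same m)) (near m N≤m)
    where
    same : ∀ m → ι (addMultiple A h k j i) ℚ.- sumℚ (λ l → ι (A i l) ℚ.* seq (c′ l) m) ≡ ι (h i) ℚ.- sumℚ (λ l → ι (A i l) ℚ.* seq (c l) m)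
    same m = begin
      ι (h i + + k * A i j) ℚ.- sumℚ (λ l → ι (A i l) ℚ.* seq (c′ l) m)
        ≡⟨ cong₂ ℚ._-_ (ι-+ (h i) (+ k * A i j)) (sumℚ-combination (ι ∘ A i) (λ l → seq (c l) m) (λ l → ι (+ k * unit j l))) ⟩
      (ι (h i) ℚ.+ t) ℚ.- (s ℚ.+ sumℚ (λ l → ι (A i l) ℚ.* ι (+ k * unit j l)))
        ≡⟨ cong (λ z → (ι (h i) ℚ.+ t) ℚ.- (s ℚ.+ z)) shift ⟩
      (ι (h i) ℚ.+ t) ℚ.- (s ℚ.+ t)
        ≡⟨ solve 3 (λ h t s → (h :+ t) :- (s :+ t) := h :- s) refl (ι (h i)) t s ⟩
      ι (h i) ℚ.- s ∎
      where
      open ≡-Reasoning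
      open +-*-Solver using (solve; _:+_; _:-_; _:=_)
      t = ι (+ k * A i j)
      s = sumℚ (λ l → ι (A i l) ℚ.* seq (c l) m)
      shift : sumℚ (λ l → ι (A i l) ℚ.* ι (+ k * unit j l)) ≡ t
      shift = trans (sumℚ-cong-≗ λ l → cong (λ z → ι (A i l) ℚ.* z) (ι-* (+ k) (unit j l)))
        (trans (sumℚ-scale (ι (+ k)) (ι ∘ A i) (ι ∘ unit j))
        (trans (cong (λ z → ι (+ k) ℚ.* z) (trans (ι-· (A i) (unit j)) (cong ι (·-unit (A i) j)))) (sym (ι-* (+ k) (A i j)))))

lattice-addMultiple : ∀ {d n} (A : Matrix ℤ d n) h k j → h ∈ lattice A → addMultiple A h k j ∈ lattice A
lattice-addMultiple A h k j (z , h≡Az) = (λ l → 1ℤ * z l + + k * unit j l) , λ i → sym (begin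
  A i · (λ l → 1ℤ * z l + + k * unit j l)   ≡⟨ ·-linearʳ (A i) 1ℤ z (+ k) (unit j) ⟩
  1ℤ * (A i · z) + + k * (A i · unit j)     ≡⟨ cong₂ (λ a b → a + + k * b) (trans (ℤₚ.*-identityˡ (A i · z)) (sym (h≡Az i))) (·-unit (A i) j) ⟩
  h i + + k * A i j                         ∎)
  where open ≡-Reasoning

maxAbs : ∀ {d} → List (Vector ℤ d) → Fin d → ℕ
maxAbs xs i = List.foldr ℕ._⊔_ 0 (List.map (λ x → ∣ x i ∣) xs)

any⇒∣∣≤maxAbs : ∀ {d} {x : Vector ℤ d} {xs} i → Any (x ≗_) xs → ∣ x i ∣ ℕ.≤ maxAbs xs i
any⇒∣∣≤maxAbs i (here x≗y)  = ℕₚ.m≤n⇒m≤n⊔o _ (ℕₚ.≤-reflexive (cong ∣_∣ (x≗y i)))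
any⇒∣∣≤maxAbs i (there x∈) = ℕₚ.m≤n⇒m≤o⊔n _ (any⇒∣∣≤maxAbs i x∈)

-- By finiteness h + k a_j is not a hole when k is large.
finite⇒upToColumn : ∀ {d n} (A : Matrix ℤ d n) → Finite (holes A) → ∀ h → h ∈ saturation A →
  ∀ j → NonzeroColumn A j → ¬ ¬ InSemigroupUpTo A j h
finite⇒upToColumn {d} {n} A (xs , listed) h (h∈cone , h∈lattice) j (i , Aᵢⱼ≢0) ¬upTo =
  ℕₚ.<⇒≱ large (any⇒∣∣≤maxAbs i (listed x
    ((cone-addMultiple A h k j h∈cone , lattice-addMultiple A h k j h∈lattice) , λ x∈Q → ¬upTo (upTo x∈Q))))
  where
  -- As |A_ij| ≥ 1, the i-th entry of h + k a_j has absolute value at least k - |h_i|, which exceeds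
  -- that of every listed hole.
  k = suc (maxAbs xs i ℕ.+ ∣ h i ∣)
  x = addMultiple A h k j
  large : maxAbs xs i ℕ.< ∣ x i ∣
  large = ℕₚ.+-cancelʳ-≤ (∣ h i ∣) (suc (maxAbs xs i)) (∣ x i ∣) (begin
    k                                        ≤⟨ ℕₚ.m≤m*n k (∣ A i j ∣) {{ℕ.>-nonZero (≢0⇒∣∣>0 Aᵢⱼ≢0)}} ⟩
    k ℕ.* ∣ A i j ∣                          ≡⟨ ℤₚ.abs-* (+ k) (A i j) ⟨
    ∣ + k * A i j ∣                          ≡⟨ cong ∣_∣ (difference (h i) (+ k * A i j)) ⟩
    ∣ x i - h i ∣                            ≤⟨ ℤₚ.∣i-j∣≤∣i∣+∣j∣ (x i) (h i) ⟩
    ∣ x i ∣ ℕ.+ ∣ h i ∣                      ∎)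
    where
    open ℕₚ.≤-Reasoning
    difference : ∀ h y → y ≡ (h + y) - h
    difference = solve-∀
  upTo : x ∈ semigroup A → InSemigroupUpTo A j h
  -- Subtracting k a_j again can spoil nonnegativity at coordinate j only.
  upTo (c , x≡Ac) = (λ l → 1ℤ * + c l + - + k * unit j l) ,
    (λ l l≢j → subst (0ℤ ≤_) (sym (trans (cong (λ u → 1ℤ * + c l + - + k * u) (unit-off l≢j)) (keepFirst (+ c l) (+ k)))) (ℤ.+≤+ ℕ.z≤n)) ,
    λ r → trans (·-linearʳ (A r) 1ℤ (+_ ∘ c) (- + k) (unit j))
      (trans (cong₂ (λ a b → 1ℤ * a + - + k * b) (sym (x≡Ac r)) (·-unit (A r) j)) (undo (h r) (+ k) (A r j)))
    where
    keepFirst : ∀ c k → 1ℤ * c + - k * 0ℤ ≡ c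
    keepFirst = solve-∀
    undo : ∀ h k a → 1ℤ * (h + k * a) + - k * a ≡ h
    undo = solve-∀

-- Pointedness and opposite columns

0≤∣p∣+p : ∀ p → 0ℚ ℚ.≤ ℚ.∣ p ∣ ℚ.+ p
0≤∣p∣+p p with ℚₚ.∣p∣≡p∨∣p∣≡-p p
... | inj₁ eq = ℚₚ.+-mono-≤ {0ℚ} {ℚ.∣ p ∣} {0ℚ} {p} (ℚₚ.0≤∣p∣ p) (subst (0ℚ ℚ.≤_) eq (ℚₚ.0≤∣p∣ p))
... | inj₂ eq = ℚₚ.≤-reflexive (sym (trans (cong (ℚ._+ p) eq) (ℚₚ.+-inverseˡ p)))

-- From some index N on the sequence stays within 1 of its term t_N, so b = |t_N| + 1 works.
eventually-boundedBelow : ∀ t → ∃ λ b → 0ℚ ℚ.≤ b × ∃ λ N → ∀ m → N ℕ.≤ m → 0ℚ ℚ.≤ b ℚ.+ seq t m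
eventually-boundedBelow t with cauchy t 1ℚ (ℚₚ.positive⁻¹ 1ℚ)
... | N , close = ℚ.∣ tN ∣ ℚ.+ 1ℚ , ℚₚ.+-mono-≤ {0ℚ} {ℚ.∣ tN ∣} {0ℚ} {1ℚ} (ℚₚ.0≤∣p∣ tN) (ℚₚ.<⇒≤ (ℚₚ.positive⁻¹ 1ℚ)) , N , λ m N≤m → begin
    0ℚ ℚ.+ 0ℚ
      ≤⟨ ℚₚ.+-mono-≤ (0≤∣p∣+p tN) (0≤∣p∣+p (seq t m ℚ.- tN)) ⟩
    (ℚ.∣ tN ∣ ℚ.+ tN) ℚ.+ (ℚ.∣ seq t m ℚ.- tN ∣ ℚ.+ (seq t m ℚ.- tN))
      ≤⟨ ℚₚ.+-monoʳ-≤ (ℚ.∣ tN ∣ ℚ.+ tN) (ℚₚ.+-monoˡ-≤ (seq t m ℚ.- tN) (ℚₚ.<⇒≤ (close m N N≤m ℕₚ.≤-refl))) ⟩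
    (ℚ.∣ tN ∣ ℚ.+ tN) ℚ.+ (1ℚ ℚ.+ (seq t m ℚ.- tN))
      ≡⟨ solve 4 (λ a b o s → (a :+ b) :+ (o :+ (s :- b)) := (a :+ o) :+ s) refl ℚ.∣ tN ∣ tN 1ℚ (seq t m) ⟩
    (ℚ.∣ tN ∣ ℚ.+ 1ℚ) ℚ.+ seq t m ∎
  where
  open ℚₚ.≤-Reasoning
  open +-*-Solver using (solve; _:+_; _:-_; _:=_)
  tN = seq t N

nonNegℚ : ∀ {p q} → 0ℚ ℚ.≤ p → 0ℚ ℚ.≤ q → 0ℚ ℚ.≤ p ℚ.* q
nonNegℚ {p} {q} 0≤p 0≤q = ℚₚ.nonNegative⁻¹ (p ℚ.* q) {{ℚₚ.nonNeg*nonNeg⇒nonNeg p {{ℚ.nonNegative 0≤p}} q {{ℚ.nonNegative 0≤q}}}}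

-- If a_k = - a_j, then t a_j = (b + t) a_j + b a_k for all b, so the cone contains the line spanned by a_j.
pointed⇒noOpposite : ∀ {d n} (A : Matrix ℤ d n) → Pointed (cone A) → NoOppositeColumns A
pointed⇒noOpposite {d} {n} A pointed j k Aj≡-Ak (i₀ , Aᵢⱼ≢0) = pointed
  ((λ _ → 0ℝ) , (λ i → fromℤ (A i j)) , (λ v≈0 → Aᵢⱼ≢0 (fromℤ≈0⇒≡0 (A i₀ j) (v≈0 i₀))) , line)
  where
  line : ∀ t → (λ i → 0ℝ +ℝ t *ℝ fromℤ (A i j)) ∈ cone A
  line t = c , 0≤c , reflect-solution (matℝ A) c (λ i → 0ℝ +ℝ t *ℝ fromℤ (A i j)) (λ i → Close-≗ λ m → sym (value i m))
    where
    bound = eventually-boundedBelow t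
    b : ℚ
    b = proj₁ bound
    0≤b : 0ℚ ℚ.≤ b
    0≤b = proj₁ (proj₂ bound)
    N : ℕ
    N = proj₁ (proj₂ (proj₂ bound))
    0≤b+t : ∀ m → N ℕ.≤ m → 0ℚ ℚ.≤ b ℚ.+ seq t m
    0≤b+t = proj₂ (proj₂ (proj₂ bound))
    both : Vector ℤ n
    both l = 1ℤ * unit j l + 1ℤ * unit k l
    c : Vector ℝ n
    c l = fromℚ b *ℝ fromℤ (both l) +ℝ t *ℝ fromℤ (unit j l)
    open +-*-Solver using (solve; _:+_; _:*_; _:-_; _:=_; con)
    0≤c : ∀ l → 0ℝ ≤ℝ c l
    0≤c l ε 0<ε = N , λ m N≤m → ℚₚ.≤-<-trans (0≤value m N≤m)
      (subst (ℚ._< seq (c l) m ℚ.+ ε) (ℚₚ.+-identityʳ (seq (c l) m)) (ℚₚ.+-monoʳ-< (seq (c l) m) 0<ε))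
      where
      regroup : ∀ m → seq (c l) m ≡ (b ℚ.+ seq t m) ℚ.* ι (unit j l) ℚ.+ b ℚ.* ι (unit k l)
      regroup m = trans
        (cong (λ z → b ℚ.* z ℚ.+ seq t m ℚ.* ι (unit j l)) (trans (ι-+ (1ℤ * unit j l) (1ℤ * unit k l))
          (cong₂ (λ u v → ι u ℚ.+ ι v) (ℤₚ.*-identityˡ (unit j l)) (ℤₚ.*-identityˡ (unit k l)))))
        (solve 4 (λ b t u v → b :* (u :+ v) :+ t :* u := (b :+ t) :* u :+ b :* v) refl b (seq t m) (ι (unit j l)) (ι (unit k l)))
      0≤value : ∀ m → N ℕ.≤ m → 0ℚ ℚ.≤ seq (c l) m
      0≤value m N≤m = subst (0ℚ ℚ.≤_) (sym (regroup m)) (ℚₚ.+-mono-≤ {0ℚ} {_} {0ℚ}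
        (nonNegℚ (0≤b+t m N≤m) (ι-mono-≤ {0ℤ} (0≤unit j l))) (nonNegℚ 0≤b (ι-mono-≤ {0ℤ} (0≤unit k l))))
    A·both : ∀ i → A i · both ≡ 0ℤ
    A·both i = trans (·-linearʳ (A i) 1ℤ (unit j) 1ℤ (unit k)) (trans (cong₂ (λ x y → 1ℤ * x + 1ℤ * y)
      (trans (·-unit (A i) j) (Aj≡-Ak i)) (·-unit (A i) k)) (cancel (A i k)))
      where
      cancel : ∀ a → 1ℤ * - a + 1ℤ * a ≡ 0ℤ
      cancel = solve-∀
    value : ∀ i m → sumℚ (λ l → ι (A i l) ℚ.* seq (c l) m) ≡ 0ℚ ℚ.+ seq t m ℚ.* ι (A i j)
    value i m = begin
      sumℚ (λ l → ι (A i l) ℚ.* (b ℚ.* ι (both l) ℚ.+ seq t m ℚ.* ι (unit j l)))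
        ≡⟨ sumℚ-combination (ι ∘ A i) (λ l → b ℚ.* ι (both l)) (λ l → seq t m ℚ.* ι (unit j l)) ⟩
      sumℚ (λ l → ι (A i l) ℚ.* (b ℚ.* ι (both l))) ℚ.+ sumℚ (λ l → ι (A i l) ℚ.* (seq t m ℚ.* ι (unit j l)))
        ≡⟨ cong₂ ℚ._+_ (trans (sumℚ-scale b (ι ∘ A i) (ι ∘ both)) (cong (λ z → b ℚ.* z) (trans (ι-· (A i) both) (cong ι (A·both i)))))
             (trans (sumℚ-scale (seq t m) (ι ∘ A i) (ι ∘ unit j)) (cong (λ z → seq t m ℚ.* z) (trans (ι-· (A i) (unit j)) (cong ι (·-unit (A i) j))))) ⟩
      b ℚ.* 0ℚ ℚ.+ seq t m ℚ.* ι (A i j)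
        ≡⟨ cong (ℚ._+ seq t m ℚ.* ι (A i j)) (ℚₚ.*-zeroʳ b) ⟩
      0ℚ ℚ.+ seq t m ℚ.* ι (A i j) ∎
      where open ≡-Reasoning

-- The maxima in the statement

thin∈columnChoices : ∀ {d n} (θ : Thin d n) → ∃ λ c → c List.∈ columnChoices d n × (∀ k → Vec.lookup c k ≡ embed θ k)
thin∈columnChoices empty = Vec.[] , here refl , λ ()
thin∈columnChoices {suc d} {suc n} (keep θ) with thin∈columnChoices θ
... | c , c∈ , eqs = zero Vec.∷ Vec.map suc c , ∈-++⁺ˡ (∈-map⁺ (λ c → zero Vec.∷ Vec.map suc c) c∈) ,
  λ { zero → refl ; (suc k) → trans (lookup-map k suc c) (cong suc (eqs k)) }
thin∈columnChoices {zero}  (skip θ) = Vec.[] , here refl , λ ()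
thin∈columnChoices {suc d} (skip θ) with thin∈columnChoices θ
... | c , c∈ , eqs = Vec.map suc c , ∈-++⁺ʳ _ (∈-map⁺ (Vec.map suc) c∈) ,
  λ k → trans (lookup-map k suc c) (cong suc (eqs k))

∈⇒≤max : ∀ {X : Set} (f : X → ℕ) {x xs} → x List.∈ xs → f x ℕ.≤ List.foldr ℕ._⊔_ 0 (List.map f xs)
∈⇒≤max f (here refl) = ℕₚ.m≤m⊔n (f _) _
∈⇒≤max f (there x∈)  = ℕₚ.m≤n⇒m≤o⊔n _ (∈⇒≤max f x∈)

minorBound-D : ∀ {d n} (A : Matrix ℤ d n) → MinorBound A (D A)
minorBound-D A θ with thin∈columnChoices θ
... | c , c∈ , eqs = subst (ℕ._≤ D A)
  (cong ∣_∣ (det-cong (λ i k → A i (Vec.lookup c k)) (columns A (embed θ)) λ i k → cong (A i) (eqs k)))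
  (∈⇒≤max (λ c → ∣ det (λ i k → A i (Vec.lookup c k)) ∣) c∈)

≤maximum : ∀ {n} (f : Vector ℕ n) i → f i ℕ.≤ maximum f
≤maximum f zero    = ℕₚ.m≤m⊔n (f zero) _
≤maximum f (suc i) = ℕₚ.m≤n⇒m≤o⊔n (f zero) (≤maximum (tail f) i)

maximum≤ : ∀ {n} (f : Vector ℕ n) {b} → (∀ i → f i ℕ.≤ b) → maximum f ℕ.≤ b
maximum≤ {zero}  f f≤b = ℕ.z≤n
maximum≤ {suc n} f f≤b = ℕₚ.⊔-lub (f≤b zero) (maximum≤ (tail f) (f≤b ∘ suc))

-- For R ≡ 0 the subtraction on the left is truncated.
[R∸1]²≤[R-1]² : ∀ R → + ((R ℕ.∸ 1) ℕ.* (R ℕ.∸ 1)) ≤ (+ R - 1ℤ) ^ 2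
[R∸1]²≤[R-1]² zero    = ℤ.+≤+ ℕ.z≤n
[R∸1]²≤[R-1]² (suc M) = ℤₚ.≤-reflexive (trans (ℤₚ.pos-* M M) (cong (+ M *_) (sym (ℤₚ.*-identityʳ (+ M)))))

integralHole : ∀ {d n} (A : Matrix ℤ d n) → FullRowRank A → Pointed (cone A) → Finite (holes A) →
  ∀ h → h ∈ holes A → IntegralHole A h (maximum (rowSum A)) (D A)
integralHole A full pointed finite h (h∈sat@(h∈cone , _) , h∉Q) = record
  { independent    = indep
  ; minors≤D       = minorBound-D A
  ; rows≤R         = ≤maximum (rowSum A)
  ; noOpposite     = pointed⇒noOpposite A pointed
  ; approximate    = cone⇒approximate A h (proj₂ (independent⇒minor indep)) h∈cone
  ; upToColumn     = finite⇒upToColumn A finite h h∈sat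
  ; notInSemigroup = λ (z , 0≤z , Az≡h) → h∉Q ((λ j → ∣ z j ∣) ,
      λ i → trans (sym (Az≡h i)) (·-congʳ (A i) (λ j → sym (ℤₚ.0≤i⇒+∣i∣≡i (0≤z j)))))
  }
  where
  indep : IndependentRows A
  indep = fullRowRank⇒independent A full

theorem6p1 : ∀ (d n : ℕ) (A : Matrix ℤ d n) →
    FullRowRank A →
    Pointed (cone A) →
    Finite (holes A) →
    (h : Vector ℤ d) → h ∈ holes A →
    + ‖ h ‖∞ ≤ + suc d * M-F A ^ 2 * + D A
theorem6p1 d n A full pointed finite h h∈H = begin
  + ‖ h ‖∞
    ≤⟨ ℤ.+≤+ (maximum≤ (λ i → ∣ h i ∣) (bound-integral A h (integralHole A full pointed finite h h∈H))) ⟩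
  + (suc d ℕ.* ((R ℕ.∸ 1) ℕ.* (R ℕ.∸ 1)) ℕ.* D A)
    ≡⟨ trans (ℤₚ.pos-* (suc d ℕ.* ((R ℕ.∸ 1) ℕ.* (R ℕ.∸ 1))) (D A)) (cong (_* + D A) (ℤₚ.pos-* (suc d) ((R ℕ.∸ 1) ℕ.* (R ℕ.∸ 1)))) ⟩
  + suc d * + ((R ℕ.∸ 1) ℕ.* (R ℕ.∸ 1)) * + D A
    ≤⟨ ℤₚ.*-monoʳ-≤-nonNeg (+ D A) (ℤₚ.*-monoˡ-≤-nonNeg (+ suc d) ([R∸1]²≤[R-1]² R)) ⟩
  + suc d * M-F A ^ 2 * + D A ∎
  where
  open ℤₚ.≤-Reasoning
  R = maximum (rowSum A)
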